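{- Let $p$ be a prime with $p\equiv 2\pmod 3$, let $m_p=(p+1)/3$, and let $n\in\mathbb{N}$. If $A\subset\mathbb{F}_p^n$ is sum-free and $|A|\ge (m_p-1/2+1/p)p^{n-1}$, then $A$ is normal, i.e. there exist a subspace $V<\mathbb{F}_p^n$ of co-dimension $1$ and $w\in\mathbb{F}_p^n\setminus V$ with $A\subset\{m_pw,(m_p+1)w,\ldots,(2m_p-1)w\}+V$.
   Context: A set $A\subset\mathbb{F}_p^n$ is sum-free if there are no $a,b,c\in A$ with $a+b=c$. -}

module Defs where

open import Data.Nat using (ℕ; zero; suc; _+_; _*_; _≤_; NonZero)
open import Data.Nat.DivMod using (_mod_)
open import Data.Fin using (Fin; toℕ)
open import Data.Vec using (Vec; []; _∷_; zipWith; map; replicate)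
open import Data.List using (List; length; filter; concatMap; allFin)
import Data.List as L
open import Data.Bool using (Bool; true; T)
open import Data.Bool.Properties using (T?)
open import Data.Product using (Σ; ∃; _×_)
open import Relation.Binary.PropositionalEquality using (_≡_)
open import Relation.Nullary using (¬_)

module _ (p : ℕ) .{{_ : NonZero p}} where

  𝔽 : Set
  𝔽 = Fin p

  Vecp : ℕ → Set
  Vecp n = Vec 𝔽 n

  _+𝔽_ : 𝔽 → 𝔽 → 𝔽
  a +𝔽 b = (toℕ a + toℕ b) mod p

  _*𝔽_ : 𝔽 → 𝔽 → 𝔽
  a *𝔽 b = (toℕ a * toℕ b) mod p

  zeroV : ∀ n → Vecp n
  zeroV n = replicate n (0 mod p)

  _⊕_ : ∀ {n} → Vecp n → Vecp n → Vecp n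
  _⊕_ = zipWith _+𝔽_

  _·_ : ∀ {n} → 𝔽 → Vecp n → Vecp n
  c · v = map (c *𝔽_) v

  _ℕ·_ : ∀ {n} → ℕ → Vecp n → Vecp n
  k ℕ· v = map (λ x → (k * toℕ x) mod p) v

  allVecs : ∀ n → List (Vecp n)
  allVecs zero = [] L.∷ L.[]
  allVecs (suc n) = concatMap (λ x → L.map (x ∷_) (allVecs n)) (allFin p)

  Subset : ℕ → Set
  Subset n = Vecp n → Bool

  _∈_ : ∀ {n} → Vecp n → Subset n → Set
  x ∈ A = T (A x)

  card : ∀ {n} → Subset n → ℕ
  card {n} A = length (filter (λ x → T? (A x)) (allVecs n))

  SumFree : ∀ {n} → Subset n → Set
  SumFree A = ∀ a b c → a ∈ A → b ∈ A → c ∈ A → ¬ (a ⊕ b ≡ c)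

  record IsSubspace {n : ℕ} (V : Vecp n → Set) : Set where
    field
      zero-mem : V (zeroV n)
      add-mem  : ∀ u v → V u → V v → V (u ⊕ v)
      smul-mem : ∀ (c : 𝔽) v → V v → V (c · v)

  -- V has codimension 1: the quotient 𝔽_p^n / V is 1-dimensional, i.e. it is
  -- spanned by the class of a single vector u ∉ V.
  Codim1 : ∀ {n} → (Vecp n → Set) → Set
  Codim1 {n} V = Σ (Vecp n) λ u → ¬ V u ×
    (∀ x → Σ 𝔽 λ c → Σ (Vecp n) λ v → V v × x ≡ (c · u) ⊕ v)

  Normal : ∀ {n} → ℕ → Subset n → Set₁
  Normal {n} m A = Σ (Vecp n → Set) λ V → IsSubspace V × Codim1 V ×
    Σ (Vecp n) λ w → ¬ V w ×
      (∀ a → a ∈ A → Σ ℕ λ k → Σ (Vecp n) λ v →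
         m ≤ k × k + 1 ≤ 2 * m × V v × a ≡ (k ℕ· w) ⊕ v)

{-# OPTIONS --safe #-}
-- For ξ ≠ 0 let c i be the size of the slice {x ∈ A : ξ · x = i}, write q = pⁿ⁻¹, and suppose first that 2 c i ≤ q
-- for all ξ and i.  Put b = q - 2c ≥ 0 and let λ k be half the sum of (c j - c (j + k))² over j.  Counting the solutions of
-- ξ · x + ξ · y = ξ · z with x, y, z ∈ A over all ξ (there are few of them, as x + y ≠ z) yields an upper bound for the
-- average of Σ b λ.  On the other hand √λ is subadditive, so by Cauchy-Davenport the sublevel sets of λ double at each
-- quadrupling of the level, and Σ b λ cannot be that small.  (This replaces the usual Fourier argument, with λ in the role
-- of 1 - cos.)  Hence some slice has more than q/2 elements.  Slices with c i + c j > q satisfy c (i + j) = 0, and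
-- c i + c j + c (i + j) ≤ q + q/p whenever the three are non-empty, by Kneser's theorem.  With Cauchy-Davenport
-- applied to the level sets of c this forces exactly m = (p + 1)/3 non-empty slices, all with more than q/2 elements; their
-- indices form a sum-free set of m residues, which is a dilate of {m, ..., 2m - 1} by Vosper's theorem.
module Submission where

open import Algebra.Bundles using (AbelianGroup)
open import Algebra.Structures using (IsAbelianGroup)
import Algebra.Properties.AbelianGroup
import Algebra.Properties.CommutativeSemigroup
import Algebra.Properties.Monoid.Mult
open import Data.Bool using (Bool; true; false; _∧_; _∨_; not; T)
open import Data.Bool.Properties using (∧-comm; T?)
open import Data.Empty using (⊥; ⊥-elim)
open import Data.Fin using (Fin; zero; suc; toℕ; fromℕ<)
open import Data.Fin.Patterns using (1F; 2F; 3F; 4F; 5F)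
import Data.Fin.Properties as Fin
import Data.Integer.Properties as ℤ
open import Data.Integer.Tactic.RingSolver using (solve-∀)
open import Data.List using (List; []; _∷_; length; map; _++_; concatMap; allFin; downFrom; filter)
open import Data.List.Properties using (map-tabulate)
import Data.List as List
import Data.Nat as ℕ
open import Data.Nat using (ℕ; suc; _∸_; _⊓_; _<ᵇ_; _^_; NonZero)
import Data.Nat.Properties as ℕ
open import Data.Nat.Coprimality using (prime⇒coprime; coprime-Bézout)
open import Data.Nat.DivMod using (_%_; _/_; _mod_; %-distribˡ-+; %-distribˡ-*; m<n⇒m%n≡m; m%n<n; m*n%n≡0; m≡m%n+[m/n]*n; m*n/n≡m)
open import Data.Nat.GCD using (module Bézout)
open Bézout using (+-; -+)
open import Data.Nat.Primality using (Prime; prime?; prime⇒nonZero; prime⇒nonTrivial)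
open import Data.Product using (∃; _×_; _,_; proj₁; proj₂)
open import Data.Sum using (_⊎_; inj₁; inj₂; [_,_]′)
open import Data.Unit using (tt)
open import Data.Vec using ([]; _∷_)
import Data.Vec as Vec
import Data.Vec.Properties as Vec
open import Relation.Binary.Definitions using (DecidableEquality; tri<; tri≈; tri>)
open import Relation.Binary.PropositionalEquality using (_≡_; _≢_; refl; sym; trans; cong; cong₂; subst; subst₂; isEquivalence; module ≡-Reasoning)
open import Relation.Nullary using (¬_; Dec; yes; no; does; from-no)


-- By Parseval λ k is (1/p) times the sum of |ĉ(t)|² (1 - cos(2πkt/p)), so it has the mean and the
-- maximum typical of 1 - cos, while every statement stays an inequality between integers. The
-- constants explain the split by p. Put d = pq - 3|A|; the density says 2pd ≤ (p - 6)q. If all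
-- slices are light, nonnegativity of Σ b λ alone gives d ≥ 0, which rules out p = 2 and p = 5. The
-- lower bound for Σ b λ gives (p - 6)q ≤ 28d, which contradicts the density as soon as 2p > 28,
-- hence from p = 17 on. At p = 11 it falls short, and even the bound improved by parity wins only
-- by 1075 < 1078. In the second half the obstacle is the part of c below r = q - max c. Level sets
-- control what lies above r, but below it the weight may spread over as many as p - 1 residues.
-- Only the Kneser bound, applied to pairs of indices that differ by the index of the largest slice,
-- limits that part.

module FiniteSums where

  open import Data.Integer using (ℤ; +_; -[1+_]; +[1+_]; -_; _+_; _*_; _-_; _≤_; _<_; 0ℤ; 1ℤ; +≤+)

  private
    variable
      X Y : Set

  -- Inequalities are proved by certificates: `d` is a combination of known nonnegative quantities,
  -- and the ring solver checks that it equals `y - x`.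
  0≤⇒≤ : ∀ {x y} d → 0ℤ ≤ d → d ≡ y - x → x ≤ y
  0≤⇒≤ d h e = ℤ.0≤i-j⇒j≤i (subst (0ℤ ≤_) e h)

  ≤⇒0≤ : ∀ {x y} → x ≤ y → 0ℤ ≤ y - x
  ≤⇒0≤ = ℤ.i≤j⇒0≤j-i

  0≤+ : ∀ {x y} → 0ℤ ≤ x → 0ℤ ≤ y → 0ℤ ≤ x + y
  0≤+ = ℤ.+-mono-≤

  0≤* : ∀ {x y} → 0ℤ ≤ x → 0ℤ ≤ y → 0ℤ ≤ x * y
  0≤* {+ m} {+ n} _ _ = subst (0ℤ ≤_) (ℤ.pos-* m n) (+≤+ ℕ.z≤n)

  0≤+ℕ : ∀ n → 0ℤ ≤ + n
  0≤+ℕ n = +≤+ ℕ.z≤n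

  0≤sq : ∀ x → 0ℤ ≤ x * x
  0≤sq (+ n) = 0≤* (0≤+ℕ n) (0≤+ℕ n)
  0≤sq -[1+ n ] = +≤+ ℕ.z≤n

  <⇒1+≤ : ∀ {x y} → x < y → 1ℤ + x ≤ y
  <⇒1+≤ = ℤ.i<j⇒suc[i]≤j

  ≰⇒1+≤ : ∀ {x y} → ¬ x ≤ y → 1ℤ + y ≤ x
  ≰⇒1+≤ h = <⇒1+≤ (ℤ.≰⇒> h)

  1+≰ : ∀ {x} → ¬ 1ℤ + x ≤ x
  1+≰ h = ℤ.<-irrefl refl (ℤ.suc[i]≤j⇒i<j h)

  -- The certificate for a contradiction: the hypotheses, with nonnegative multipliers, add up to a
  -- polynomial that is identically -1.
  0≰-1 : ∀ {d} → 0ℤ ≤ d → ¬ (d ≡ - 1ℤ)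
  0≰-1 () refl

  *-cancel-≤ : ∀ {k x y} → 1ℤ ≤ k → k * x ≤ k * y → x ≤ y
  *-cancel-≤ {+ 0} (+≤+ ())
  *-cancel-≤ {+[1+ k ]} _ h = ℤ.*-cancelˡ-≤-pos _ _ +[1+ k ] h

  *-cancel-≡ : ∀ {k x y} → 1ℤ ≤ k → k * x ≡ k * y → x ≡ y
  *-cancel-≡ h e = ℤ.≤-antisym (*-cancel-≤ h (ℤ.≤-reflexive e)) (*-cancel-≤ h (ℤ.≤-reflexive (sym e)))

  1≤+ℕ : ∀ {n} → 0 ℕ.< n → 1ℤ ≤ + n
  1≤+ℕ = +≤+

  -- Indicators of Boolean predicates

  ⟦_⟧ : Bool → ℤ
  ⟦ true ⟧ = 1ℤ
  ⟦ false ⟧ = 0ℤ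

  0≤⟦_⟧ : ∀ b → 0ℤ ≤ ⟦ b ⟧
  0≤⟦ true ⟧ = 0≤+ℕ 1
  0≤⟦ false ⟧ = 0≤+ℕ 0

  ⟦∧⟧ : ∀ a b → ⟦ a ∧ b ⟧ ≡ ⟦ a ⟧ * ⟦ b ⟧
  ⟦∧⟧ true true = refl
  ⟦∧⟧ true false = refl
  ⟦∧⟧ false true = refl
  ⟦∧⟧ false false = refl

  ⟦⟧-mono : ∀ a b → (a ≡ true → b ≡ true) → ⟦ a ⟧ ≤ ⟦ b ⟧
  ⟦⟧-mono true b f rewrite f refl = ℤ.≤-refl
  ⟦⟧-mono false b f = 0≤⟦ b ⟧

  ⟦not⟧≡1- : ∀ b → ⟦ not b ⟧ ≡ 1ℤ - ⟦ b ⟧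
  ⟦not⟧≡1- true = refl
  ⟦not⟧≡1- false = refl

  ⟦not⟧ : ∀ b → ⟦ b ⟧ + ⟦ not b ⟧ ≡ 1ℤ
  ⟦not⟧ true = refl
  ⟦not⟧ false = refl

  ∨∧ : ∀ a b → ⟦ a ∨ b ⟧ + ⟦ a ∧ b ⟧ ≡ ⟦ a ⟧ + ⟦ b ⟧
  ∨∧ true true = refl
  ∨∧ true false = refl
  ∨∧ false true = refl
  ∨∧ false false = refl

  ∧-intro : ∀ {a b} → a ≡ true → b ≡ true → a ∧ b ≡ true
  ∧-intro refl refl = refl

  ∧-elimˡ : ∀ {a b} → a ∧ b ≡ true → a ≡ true
  ∧-elimˡ {true} _ = refl

  ∧-elimʳ : ∀ {a b} → a ∧ b ≡ true → b ≡ true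
  ∧-elimʳ {true} e = e

  ∨-introˡ : ∀ {a b} → a ≡ true → a ∨ b ≡ true
  ∨-introˡ refl = refl

  ∨-elim : ∀ {a b} → a ∨ b ≡ true → a ≡ true ⊎ b ≡ true
  ∨-elim {true} _ = inj₁ refl
  ∨-elim {false} e = inj₂ e

  not-elim : ∀ {a} → not a ≡ true → a ≡ false
  not-elim {false} _ = refl

  true≢false : ∀ {a} → a ≡ true → a ≡ false → ⊥
  true≢false refl ()

  ¬true⇒false : ∀ {a} → ¬ a ≡ true → a ≡ false
  ¬true⇒false {true} h = ⊥-elim (h refl)
  ¬true⇒false {false} _ = refl

  ¬false⇒true : ∀ {a} → ¬ a ≡ false → a ≡ true
  ¬false⇒true {true} _ = refl
  ¬false⇒true {false} h = ⊥-elim (h refl)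

  does-yes : ∀ {P : Set} (d : Dec P) → P → does d ≡ true
  does-yes (yes _) _ = refl
  does-yes (no ¬p) p = ⊥-elim (¬p p)

  does-no : ∀ {P : Set} (d : Dec P) → ¬ P → does d ≡ false
  does-no (no _) _ = refl
  does-no (yes p) ¬p = ⊥-elim (¬p p)

  yes-does : ∀ {P : Set} (d : Dec P) → does d ≡ true → P
  yes-does (yes p) _ = p

  no-does : ∀ {P : Set} (d : Dec P) → does d ≡ false → ¬ P
  no-does (no ¬p) _ = ¬p

  does-⇔ : ∀ {P Q : Set} (d : Dec P) (e : Dec Q) → (P → Q) → (Q → P) → does d ≡ does e
  does-⇔ (yes p) e f g = sym (does-yes e (f p))
  does-⇔ (no ¬p) e f g = sym (does-no e (λ q → ¬p (g q)))

  -- Finite sums and finite types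

  ∑ : List X → (X → ℤ) → ℤ
  ∑ [] f = 0ℤ
  ∑ (x ∷ xs) f = f x + ∑ xs f

  ∑-cong : (xs : List X) {f g : X → ℤ} → (∀ x → f x ≡ g x) → ∑ xs f ≡ ∑ xs g
  ∑-cong [] h = refl
  ∑-cong (x ∷ xs) h = cong₂ _+_ (h x) (∑-cong xs h)

  ∑-mono : (xs : List X) {f g : X → ℤ} → (∀ x → f x ≤ g x) → ∑ xs f ≤ ∑ xs g
  ∑-mono [] h = ℤ.≤-refl
  ∑-mono (x ∷ xs) h = ℤ.+-mono-≤ (h x) (∑-mono xs h)

  ∑-zero : (xs : List X) → ∑ xs (λ _ → 0ℤ) ≡ 0ℤ
  ∑-zero [] = refl
  ∑-zero (x ∷ xs) = trans (ℤ.+-identityˡ _) (∑-zero xs)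

  ∑-nonneg : (xs : List X) {f : X → ℤ} → (∀ x → 0ℤ ≤ f x) → 0ℤ ≤ ∑ xs f
  ∑-nonneg xs h = subst (_≤ ∑ xs _) (∑-zero xs) (∑-mono xs h)

  ∑-+ : (xs : List X) (f g : X → ℤ) → ∑ xs (λ x → f x + g x) ≡ ∑ xs f + ∑ xs g
  ∑-+ [] f g = refl
  ∑-+ (x ∷ xs) f g rewrite ∑-+ xs f g = lem (f x) (g x) (∑ xs f) (∑ xs g)
    where
    lem : ∀ a b c d → a + b + (c + d) ≡ a + c + (b + d)
    lem = solve-∀

  ∑-*ˡ : (xs : List X) (k : ℤ) (f : X → ℤ) → ∑ xs (λ x → k * f x) ≡ k * ∑ xs f
  ∑-*ˡ [] k f = sym (ℤ.*-zeroʳ k)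
  ∑-*ˡ (x ∷ xs) k f rewrite ∑-*ˡ xs k f = sym (ℤ.*-distribˡ-+ k (f x) (∑ xs f))

  ∑-*ʳ : (xs : List X) (k : ℤ) (f : X → ℤ) → ∑ xs (λ x → f x * k) ≡ ∑ xs f * k
  ∑-*ʳ xs k f = trans (∑-cong xs (λ x → ℤ.*-comm (f x) k)) (trans (∑-*ˡ xs k f) (ℤ.*-comm k _))

  ∑-neg : (xs : List X) (f : X → ℤ) → ∑ xs (λ x → - f x) ≡ - ∑ xs f
  ∑-neg [] f = refl
  ∑-neg (x ∷ xs) f rewrite ∑-neg xs f = sym (ℤ.neg-distrib-+ (f x) (∑ xs f))

  ∑-⊖ : (xs : List X) (f g : X → ℤ) → ∑ xs (λ x → f x - g x) ≡ ∑ xs f - ∑ xs g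
  ∑-⊖ xs f g = trans (∑-+ xs f (λ x → - g x)) (cong (λ z → ∑ xs f + z) (∑-neg xs g))

  ∑-const : (xs : List X) (k : ℤ) → ∑ xs (λ _ → k) ≡ ∑ xs (λ _ → 1ℤ) * k
  ∑-const xs k = trans (∑-cong xs (λ _ → sym (ℤ.*-identityˡ k))) (∑-*ʳ xs k (λ _ → 1ℤ))

  ∑-swap : (xs : List X) (ys : List Y) (f : X → Y → ℤ) →
    ∑ xs (λ x → ∑ ys (f x)) ≡ ∑ ys (λ y → ∑ xs (λ x → f x y))
  ∑-swap [] ys f = sym (∑-zero ys)
  ∑-swap (x ∷ xs) ys f rewrite ∑-swap xs ys f = sym (∑-+ ys (f x) (λ y → ∑ xs (λ x → f x y)))

  ∑-∑-* : (xs : List X) (ys : List Y) (f : X → ℤ) (g : Y → ℤ) →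
    ∑ xs (λ x → ∑ ys (λ y → f x * g y)) ≡ ∑ xs f * ∑ ys g
  ∑-∑-* xs ys f g = trans (∑-cong xs (λ x → ∑-*ˡ ys (f x) g)) (∑-*ʳ xs (∑ ys g) f)

  -- That the list has no repetitions and no omissions is stated as a single sum, the form in which
  -- `pick` and double counting use it.
  record Finite (X : Set) : Set where
    infix 4 _≟_
    field
      elems : List X
      _≟_ : DecidableEquality X
      once : ∀ a → ∑ elems (λ x → ⟦ does (x ≟ a) ⟧) ≡ 1ℤ

    sum : (X → ℤ) → ℤ
    sum = ∑ elems

    card : (X → Bool) → ℤ
    card A = sum (λ x → ⟦ A x ⟧)

    size : ℤ
    size = sum (λ _ → 1ℤ)

    pick : ∀ a (h : X → ℤ) → sum (λ x → ⟦ does (x ≟ a) ⟧ * h x) ≡ h a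
    pick a h = trans (∑-cong elems step) (trans (∑-*ʳ elems (h a) _) (trans (cong (_* h a) (once a)) (ℤ.*-identityˡ (h a))))
      where
      step : ∀ x → ⟦ does (x ≟ a) ⟧ * h x ≡ ⟦ does (x ≟ a) ⟧ * h a
      step x with x ≟ a
      ... | yes refl = refl
      ... | no _ = trans (ℤ.*-zeroˡ (h x)) (sym (ℤ.*-zeroˡ (h a)))

    -- If the scan of the list meets no witness, any `a` satisfying `P` occurs zero times in it,
    -- against `once`.
    search : (P : X → Bool) → (∃ λ x → P x ≡ true) ⊎ (∀ x → P x ≡ false)
    search P with go elems
      where
      go : (xs : List X) → (∃ λ x → P x ≡ true) ⊎ (∀ a → P a ≡ true → ∑ xs (λ x → ⟦ does (x ≟ a) ⟧) ≡ 0ℤ)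
      go [] = inj₂ (λ _ _ → refl)
      go (x ∷ xs) with P x in eq | go xs
      ... | true | _ = inj₁ (x , eq)
      ... | false | inj₁ w = inj₁ w
      ... | false | inj₂ f = inj₂ g
        where
        g : ∀ a → P a ≡ true → ⟦ does (x ≟ a) ⟧ + ∑ xs (λ y → ⟦ does (y ≟ a) ⟧) ≡ 0ℤ
        g a e with x ≟ a
        ... | yes refl = ⊥-elim (true≢false e eq)
        ... | no _ = trans (ℤ.+-identityˡ _) (f a e)
    ... | inj₁ w = inj₁ w
    ... | inj₂ f = inj₂ (λ a → ¬true⇒false (λ e → one≢zero (trans (sym (once a)) (f a e))))
      where
      one≢zero : ¬ (1ℤ ≡ 0ℤ)
      one≢zero ()

    term≤sum : ∀ a {f : X → ℤ} → (∀ x → x ≢ a → 0ℤ ≤ f x) → f a ≤ sum f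
    term≤sum a {f} h = subst (_≤ sum f) (pick a f) (∑-mono elems step)
      where
      step : ∀ x → ⟦ does (x ≟ a) ⟧ * f x ≤ f x
      step x with x ≟ a
      ... | yes refl = ℤ.≤-reflexive (ℤ.*-identityˡ (f x))
      ... | no x≢a = subst (_≤ f x) (sym (ℤ.*-zeroˡ (f x))) (h x x≢a)

    card≥0 : ∀ A → 0ℤ ≤ card A
    card≥0 A = ∑-nonneg elems (λ x → 0≤⟦ A x ⟧)

    card-cong : ∀ {A B} → (∀ x → A x ≡ B x) → card A ≡ card B
    card-cong h = ∑-cong elems (λ x → cong ⟦_⟧ (h x))

    card-mono : ∀ {A B} → (∀ x → A x ≡ true → B x ≡ true) → card A ≤ card B
    card-mono {A} {B} h = ∑-mono elems (λ x → ⟦⟧-mono (A x) (B x) (h x))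

    card≥1 : ∀ {A} a → A a ≡ true → 1ℤ ≤ card A
    card≥1 {A} a e = subst (λ b → ⟦ b ⟧ ≤ card A) e (term≤sum a (λ x _ → 0≤⟦ A x ⟧))

    card-empty : ∀ {A} → (∀ x → A x ≡ false) → card A ≡ 0ℤ
    card-empty h = trans (∑-cong elems (λ x → cong ⟦_⟧ (h x))) (∑-zero elems)

    inhabited : ∀ {A} → 1ℤ ≤ card A → ∃ λ a → A a ≡ true
    inhabited {A} h with search A
    ... | inj₁ w = w
    ... | inj₂ f = ⊥-elim (0≰-1 (≤⇒0≤ (subst (1ℤ ≤_) (card-empty f) h)) refl)

    card-∪∩ : ∀ A B → card (λ x → A x ∨ B x) + card (λ x → A x ∧ B x) ≡ card A + card B
    card-∪∩ A B = trans (sym (∑-+ elems _ _)) (trans (∑-cong elems (λ x → ∨∧ (A x) (B x))) (∑-+ elems _ _))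

    card-not : ∀ A → card A + card (λ x → not (A x)) ≡ size
    card-not A = trans (sym (∑-+ elems _ _)) (∑-cong elems (λ x → ⟦not⟧ (A x)))

    card-disjoint : ∀ {A B C} → (∀ x → A x ≡ true → C x ≡ true) → (∀ x → B x ≡ true → C x ≡ true) →
      (∀ x → A x ≡ true → B x ≡ true → ⊥) → card A + card B ≤ card C
    card-disjoint {A} {B} {C} hA hB dis =
      subst (_≤ card C) (trans (sym (cong (λ z → card (λ x → A x ∨ B x) + z) ∩≡0)) (card-∪∩ A B))
        (subst (_≤ card C) (sym (ℤ.+-identityʳ _)) (card-mono ∪⊆C))
      where
      ∪⊆C : ∀ x → A x ∨ B x ≡ true → C x ≡ true
      ∪⊆C x e with ∨-elim {A x} e
      ... | inj₁ a = hA x a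
      ... | inj₂ b = hB x b
      ∩≡0 : card (λ x → A x ∧ B x) ≡ 0ℤ
      ∩≡0 = card-empty (λ x → ¬true⇒false (λ e → dis x (∧-elimˡ e) (∧-elimʳ {A x} e)))

    card-singleton : ∀ a → card (λ x → does (x ≟ a)) ≡ 1ℤ
    card-singleton = once

    card-strict : ∀ {A B} b → (∀ x → A x ≡ true → B x ≡ true) → B b ≡ true → A b ≡ false → card A + 1ℤ ≤ card B
    card-strict {A} {B} b sub eB eA = subst (λ z → card A + z ≤ card B) (card-singleton b)
      (card-disjoint sub (λ x e → subst (λ y → B y ≡ true) (sym (yes-does (x ≟ b) e)) eB)
        (λ x a e → true≢false (subst (λ y → A y ≡ true) (yes-does (x ≟ b) e) a) eA))

    card-⊆-≥ : ∀ {A B} → (∀ x → A x ≡ true → B x ≡ true) → card B ≤ card A → ∀ x → B x ≡ true → A x ≡ true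
    card-⊆-≥ {A} {B} sub h x e = ¬false⇒true (λ eA → 1+≰ (ℤ.≤-trans (subst (_≤ card B) (ℤ.+-comm (card A) 1ℤ) (card-strict x sub e eA)) h))

    card≤1 : ∀ {A} → (∀ x y → A x ≡ true → A y ≡ true → x ≡ y) → card A ≤ 1ℤ
    card≤1 {A} h with search A
    ... | inj₂ f = subst (_≤ 1ℤ) (sym (card-empty f)) (0≤+ℕ 1)
    ... | inj₁ (a , ea) = subst (card A ≤_) (card-singleton a) (card-mono (λ x e → does-yes (x ≟ a) (h x a e ea)))

    card≥2 : ∀ {A} x y → A x ≡ true → A y ≡ true → x ≢ y → + 2 ≤ card A
    card≥2 {A} x y ex ey x≢y = subst (_≤ card A) (cong₂ _+_ (card-singleton x) (card-singleton y))
      (card-disjoint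
        (λ z e → subst (λ w → A w ≡ true) (sym (yes-does (z ≟ x) e)) ex)
        (λ z e → subst (λ w → A w ≡ true) (sym (yes-does (z ≟ y) e)) ey)
        (λ z e f → x≢y (trans (sym (yes-does (z ≟ x) e)) (yes-does (z ≟ y) f))))

    card<2 : ∀ {A} → card A ≤ 1ℤ → ∀ x y → A x ≡ true → A y ≡ true → x ≡ y
    card<2 {A} h x y ex ey with x ≟ y
    ... | yes e = e
    ... | no ne = ⊥-elim (0≰-1 (≤⇒0≤ (ℤ.≤-trans (card≥2 x y ex ey ne) h)) refl)

  -- Double counting over the graph of the bijection: it has one point above each `x` and one above
  -- each `y`.
  reindex : (F : Finite X) (G : Finite Y) (φ : X → Y) (ψ : Y → X) →
    (∀ y → φ (ψ y) ≡ y) → (∀ x → ψ (φ x) ≡ x) → ∀ f → Finite.sum F (λ x → f (φ x)) ≡ Finite.sum G f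
  reindex F G φ ψ φψ ψφ f = begin
    F.sum (λ x → f (φ x))                                              ≡⟨ ∑-cong F.elems (λ x → sym (G.pick (φ x) f)) ⟩
    F.sum (λ x → G.sum (λ y → ⟦ does (y G.≟ φ x) ⟧ * f y))             ≡⟨ ∑-swap F.elems G.elems _ ⟩
    G.sum (λ y → F.sum (λ x → ⟦ does (y G.≟ φ x) ⟧ * f y))             ≡⟨ ∑-cong G.elems (λ y → trans (∑-cong F.elems (λ x → cong (λ b → ⟦ b ⟧ * f y) (same x y))) (F.pick (ψ y) (λ _ → f y))) ⟩
    G.sum f ∎
    where
    open ≡-Reasoning
    module F = Finite F
    module G = Finite G
    same : ∀ x y → does (y G.≟ φ x) ≡ does (x F.≟ ψ y)
    same x y = does-⇔ (y G.≟ φ x) (x F.≟ ψ y) (λ e → trans (sym (ψφ x)) (cong ψ (sym e))) (λ e → trans (sym (φψ y)) (cong φ (sym e)))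

  module _ (F : Finite X) where
    open Finite F

    every : (X → Bool) → Bool
    every P with search (λ x → not (P x))
    ... | inj₁ _ = false
    ... | inj₂ _ = true

    every-elim : ∀ {P} → every P ≡ true → ∀ x → P x ≡ true
    every-elim {P} e x with search (λ x → not (P x))
    ... | inj₂ f = ¬false⇒true (λ e′ → true≢false (cong not e′) (f x))

    every-intro : ∀ {P} → (∀ x → P x ≡ true) → every P ≡ true
    every-intro {P} h with search (λ x → not (P x))
    ... | inj₁ (x , e) = ⊥-elim (true≢false (h x) (not-elim e))
    ... | inj₂ _ = refl

    every-false : ∀ {P} → every P ≡ false → ∃ λ x → P x ≡ false
    every-false {P} e with search (λ x → not (P x))
    ... | inj₁ (x , e′) = x , not-elim e′

  infixr 5 _⇒_
  _⇒_ : Bool → Bool → Bool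
  a ⇒ b = not a ∨ b

  ⇒-elim : ∀ {a b} → a ⇒ b ≡ true → a ≡ true → b ≡ true
  ⇒-elim e refl = e

  ⇒-intro : ∀ {a b} → (a ≡ true → b ≡ true) → a ⇒ b ≡ true
  ⇒-intro {true} f = f refl
  ⇒-intro {false} f = refl

  ⇒-falseˡ : ∀ {a b} → a ⇒ b ≡ false → a ≡ true
  ⇒-falseˡ {true} _ = refl

  ⇒-falseʳ : ∀ {a b} → a ⇒ b ≡ false → b ≡ false
  ⇒-falseʳ {true} e = e

  ∑-map : (f : X → Y) (xs : List X) (g : Y → ℤ) → ∑ (map f xs) g ≡ ∑ xs (λ x → g (f x))
  ∑-map f [] g = refl
  ∑-map f (x ∷ xs) g = cong (λ z → g (f x) + z) (∑-map f xs g)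

  ∑-++ : (xs ys : List X) (g : X → ℤ) → ∑ (xs ++ ys) g ≡ ∑ xs g + ∑ ys g
  ∑-++ [] ys g = sym (ℤ.+-identityˡ _)
  ∑-++ (x ∷ xs) ys g rewrite ∑-++ xs ys g = sym (ℤ.+-assoc (g x) (∑ xs g) (∑ ys g))

  ∑-concatMap : (f : X → List Y) (xs : List X) (g : Y → ℤ) → ∑ (concatMap f xs) g ≡ ∑ xs (λ x → ∑ (f x) g)
  ∑-concatMap f [] g = refl
  ∑-concatMap f (x ∷ xs) g rewrite ∑-++ (f x) (concatMap f xs) g | ∑-concatMap f xs g = refl

  ∑-allFin-suc : ∀ n (g : Fin (suc n) → ℤ) → ∑ (allFin (suc n)) g ≡ g zero + ∑ (allFin n) (λ i → g (suc i))
  ∑-allFin-suc n g = cong (λ z → g zero + z) (trans (cong (λ xs → ∑ xs g) (sym (map-tabulate (λ i → i) suc))) (∑-map suc (allFin n) g))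

  finFinite : ∀ n → Finite (Fin n)
  finFinite n = record { elems = allFin n ; _≟_ = Fin._≟_ ; once = once n }
    where
    once : ∀ n (a : Fin n) → ∑ (allFin n) (λ x → ⟦ does (x Fin.≟ a) ⟧) ≡ 1ℤ
    once (suc n) zero = trans (∑-allFin-suc n (λ x → ⟦ does (x Fin.≟ zero) ⟧)) (cong (λ z → 1ℤ + z) (∑-zero (allFin n)))
    once (suc n) (suc a) = trans (∑-allFin-suc n (λ x → ⟦ does (x Fin.≟ suc a) ⟧)) (trans (ℤ.+-identityˡ _) (trans (∑-cong (allFin n) same) (once n a)))
      where
      same : ∀ x → ⟦ does (suc x Fin.≟ suc a) ⟧ ≡ ⟦ does (x Fin.≟ a) ⟧
      same x with x Fin.≟ a
      ... | yes _ = refl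
      ... | no _ = refl

  size-Fin : ∀ n → Finite.size (finFinite n) ≡ + n
  size-Fin ℕ.zero = refl
  size-Fin (suc n) = trans (∑-allFin-suc n (λ _ → 1ℤ)) (cong (λ z → 1ℤ + z) (size-Fin n))

-- Sumsets in elementary abelian groups: Kneser, Cauchy-Davenport, Vosper

module SumsetTheory where

  open import Data.Integer using (ℤ; ∣_∣; +_; -_; _+_; _*_; _-_; _≤_; 0ℤ; 1ℤ; +≤+)
  open FiniteSums

  record ElementaryAbelian (p : ℕ) (G : Set) : Set where
    infixl 6 _⊹_
    infixr 8 _⋆_
    field
      finite : Finite G
      _⊹_ : G → G → G
      0# : G
      ⊟_ : G → G
      isAbelianGroup : IsAbelianGroup _≡_ _⊹_ 0# ⊟_

    abelianGroup : AbelianGroup _ _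
    abelianGroup = record { isAbelianGroup = isAbelianGroup }

    open Finite finite public
    open IsAbelianGroup isAbelianGroup public using (assoc; comm; identityˡ; identityʳ; inverseˡ; inverseʳ)
    module GP = Algebra.Properties.AbelianGroup abelianGroup
    module CP = Algebra.Properties.CommutativeSemigroup (AbelianGroup.commutativeSemigroup abelianGroup)
    module Mult = Algebra.Properties.Monoid.Mult (AbelianGroup.monoid abelianGroup)

    _⋆_ : ℕ → G → G
    n ⋆ x = n Mult.× x

    field
      torsion : ∀ x → p ⋆ x ≡ 0#

  module Elementary {p : ℕ} {G : Set} (E : ElementaryAbelian p G) where
    open ElementaryAbelian E public

    infixl 6 _⊝_
    _⊝_ : G → G → G
    x ⊝ y = x ⊹ (⊟ y)

    n⋆0 : ∀ n → n ⋆ 0# ≡ 0#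
    n⋆0 ℕ.zero = refl
    n⋆0 (suc n) = trans (identityˡ _) (n⋆0 n)

    add-sub : ∀ x y → (x ⊹ y) ⊝ y ≡ x
    add-sub x y = trans (assoc x y (⊟ y)) (trans (cong (x ⊹_) (inverseʳ y)) (identityʳ x))

    sub-add : ∀ x y → (x ⊝ y) ⊹ y ≡ x
    sub-add x y = trans (assoc x (⊟ y) y) (trans (cong (x ⊹_) (inverseˡ y)) (identityʳ x))

    +-swap- : ∀ a b c → b ⊹ (a ⊝ c) ≡ (a ⊹ b) ⊝ c
    +-swap- a b c = trans (sym (assoc b a (⊟ c))) (cong (_⊝ c) (comm b a))

    +-cancel- : ∀ a b → b ⊹ (a ⊝ b) ≡ a
    +-cancel- a b = trans (+-swap- a b b) (add-sub a b)

    transfer : ∀ x y e → (y ⊹ e) ⊹ (x ⊝ e) ≡ x ⊹ y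
    transfer x y e = trans (assoc y e (x ⊝ e)) (trans (cong (y ⊹_) (+-cancel- x e)) (comm y x))

    ⊝⊝ : ∀ c a b → c ⊝ (a ⊝ b) ≡ (c ⊝ a) ⊹ b
    ⊝⊝ c a b = trans (cong (c ⊹_) (trans (sym (GP.⁻¹-∙-comm a (⊟ b))) (cong ((⊟ a) ⊹_) (GP.⁻¹-involutive b)))) (sym (assoc c (⊟ a) b))

    ⊝⊹ : ∀ c a b → c ⊝ (a ⊹ b) ≡ (c ⊝ a) ⊝ b
    ⊝⊹ c a b = trans (cong (c ⊹_) (sym (GP.⁻¹-∙-comm a b))) (sym (assoc c (⊟ a) (⊟ b)))

    ⊹⊝⊹ : ∀ a b c d → (a ⊹ b) ⊝ (c ⊹ d) ≡ (a ⊝ c) ⊹ (b ⊝ d)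
    ⊹⊝⊹ a b c d = trans (cong ((a ⊹ b) ⊹_) (sym (GP.⁻¹-∙-comm c d))) (CP.interchange a b (⊟ c) (⊟ d))

    ⊹-cancelˡ : ∀ a {b c} → a ⊹ b ≡ a ⊹ c → b ≡ c
    ⊹-cancelˡ a {b} {c} e = trans (sym (add-sub b a)) (trans (cong (_⊝ a) (trans (comm b a) (trans e (comm a c)))) (add-sub c a))

    sum-shift : ∀ e (f : G → ℤ) → sum (λ x → f (x ⊹ e)) ≡ sum f
    sum-shift e f = reindex finite finite (_⊹ e) (_⊝ e) (λ y → sub-add y e) (λ x → add-sub x e) f

    sum-unshift : ∀ e (f : G → ℤ) → sum (λ x → f (x ⊝ e)) ≡ sum f
    sum-unshift e f = reindex finite finite (_⊝ e) (_⊹ e) (λ x → add-sub x e) (λ y → sub-add y e) f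

    card-unshift : ∀ e A → card (λ x → A (x ⊝ e)) ≡ card A
    card-unshift e A = sum-unshift e (λ x → ⟦ A x ⟧)

    record Subgroup : Set where
      field
        mem : G → Bool
        0∈ : mem 0# ≡ true
        +∈ : ∀ {x y} → mem x ≡ true → mem y ≡ true → mem (x ⊹ y) ≡ true

      ⋆∈ : ∀ n {x} → mem x ≡ true → mem (n ⋆ x) ≡ true
      ⋆∈ ℕ.zero h = 0∈
      ⋆∈ (suc n) h = +∈ h (⋆∈ n h)

    module Primal (pr : Prime p) where

      p′ : ℕ
      p′ = ℕ.pred p

      p≡ : p ≡ suc p′
      p≡ = sym (ℕ.suc-pred p {{prime⇒nonZero pr}})

      -- Torsion turns negation into repeated addition, so that a set closed under addition is
      -- closed under subtraction as well.
      ⊟-⋆ : ∀ x → ⊟ x ≡ p′ ⋆ x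
      ⊟-⋆ x = sym (GP.inverseʳ-unique x (p′ ⋆ x) (trans (cong (_⋆ x) (sym p≡)) (torsion x)))

      multiple : ∀ x a → (a ℕ.* p) ⋆ x ≡ 0#
      multiple x a = trans (sym (Mult.×-assocˡ x a p)) (trans (cong (a ⋆_) (torsion x)) (n⋆0 a))

      -- Bézout for `p` and `d`. In the second case 1 + bd is a multiple of p, so the inverse is -b,
      -- represented by (p - 1)b.
      unit : ∀ d → 0 ℕ.< d → d ℕ.< p → ∃ λ b → ∀ x → b ⋆ d ⋆ x ≡ x
      unit d 0<d d<p with coprime-Bézout (prime⇒coprime pr {{ℕ.>-nonZero 0<d}} d<p)
      ... | -+ a b eq = b , λ x → trans (Mult.×-assocˡ x b d) (trans (cong (_⋆ x) (sym eq))
              (trans (cong (x ⊹_) (multiple x a)) (identityʳ x)))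
      ... | +- a b eq = p′ ℕ.* b , λ x → trans (sym (Mult.×-assocˡ (d ⋆ x) p′ b)) (trans (sym (⊟-⋆ (b ⋆ d ⋆ x)))
              (sym (GP.inverseˡ-unique x (b ⋆ d ⋆ x) (trans (cong (x ⊹_) (Mult.×-assocˡ x b d)) (trans (cong (_⋆ x) eq) (multiple x a))))))

      module _ (K : Subgroup) where
        open Subgroup K

        ⊟∈ : ∀ {x} → mem x ≡ true → mem (⊟ x) ≡ true
        ⊟∈ {x} h = subst (λ y → mem y ≡ true) (sym (⊟-⋆ x)) (⋆∈ p′ h)

        ⊝∈ : ∀ {x y} → mem x ≡ true → mem y ≡ true → mem (x ⊝ y) ≡ true
        ⊝∈ hx hy = +∈ hx (⊟∈ hy)

        ⋆∈⁻¹ : ∀ d {x} → 0 ℕ.< d → d ℕ.< p → mem (d ⋆ x) ≡ true → mem x ≡ true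
        ⋆∈⁻¹ d {x} 0<d d<p h with unit d 0<d d<p
        ... | b , inverse = subst (λ y → mem y ≡ true) (inverse x) (⋆∈ b h)

        -- The difference of the two memberships is (j - i)v, and j - i is invertible modulo p.
        descend : ∀ {v x i j} → i ℕ.< j → j ℕ.< p → mem (x ⊝ (i ⋆ v)) ≡ true → mem (x ⊝ (j ⋆ v)) ≡ true → mem v ≡ true
        descend {v} {x} {i} {j} i<j j<p hi hj = ⋆∈⁻¹ (j ℕ.∸ i) (ℕ.m<n⇒0<n∸m i<j) (ℕ.≤-<-trans (ℕ.m∸n≤m j i) j<p)
          (subst (λ y → mem y ≡ true) e (⊝∈ hi hj))
          where
          e : (x ⊝ (i ⋆ v)) ⊝ (x ⊝ (j ⋆ v)) ≡ (j ℕ.∸ i) ⋆ v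
          e = begin
            (x ⊝ (i ⋆ v)) ⊝ (x ⊝ (j ⋆ v))                  ≡⟨ ⊝⊝ _ x (j ⋆ v) ⟩
            ((x ⊝ (i ⋆ v)) ⊝ x) ⊹ (j ⋆ v)                  ≡⟨ cong (λ k → ((x ⊝ (i ⋆ v)) ⊝ x) ⊹ (k ⋆ v)) (sym (ℕ.m∸n+n≡m (ℕ.<⇒≤ i<j))) ⟩
            ((x ⊝ (i ⋆ v)) ⊝ x) ⊹ ((j ℕ.∸ i ℕ.+ i) ⋆ v)    ≡⟨ cong₂ _⊹_ (GP.xyx⁻¹≈y x (⊟ (i ⋆ v))) (Mult.×-homo-+ v (j ℕ.∸ i) i) ⟩
            (⊟ (i ⋆ v)) ⊹ ((j ℕ.∸ i) ⋆ v ⊹ i ⋆ v)          ≡⟨ trans (comm _ _) (add-sub _ _) ⟩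
            (j ℕ.∸ i) ⋆ v ∎
            where open ≡-Reasoning

        translates-distinct : ∀ {v x} → mem v ≡ false → (s t : Fin p) →
          mem (x ⊝ (toℕ s ⋆ v)) ≡ true → mem (x ⊝ (toℕ t ⋆ v)) ≡ true → s ≡ t
        translates-distinct {v} {x} v∉ s t hs ht with ℕ.<-cmp (toℕ s) (toℕ t)
        ... | tri≈ _ e _ = Fin.toℕ-injective e
        ... | tri< lt _ _ = ⊥-elim (true≢false (descend lt (Fin.toℕ<n t) hs ht) v∉)
        ... | tri> _ _ gt = ⊥-elim (true≢false (descend gt (Fin.toℕ<n s) ht hs) v∉)

        -- The translates of the smaller subgroup by 0, v, ..., (p - 1)v are disjoint and stay
        -- inside `V`.
        proper-index : (V : Subgroup) → (∀ x → mem x ≡ true → Subgroup.mem V x ≡ true) →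
          ∀ v → Subgroup.mem V v ≡ true → mem v ≡ false → + p * card mem ≤ card (Subgroup.mem V)
        proper-index V sub v v∈V v∉ = subst (_≤ card (Subgroup.mem V)) total (∑-mono elems bound)
          where
          module Fp = Finite (finFinite p)
          module V = Subgroup V
          total : sum (λ x → Fp.card (λ t → mem (x ⊝ (toℕ t ⋆ v)))) ≡ + p * card mem
          total = trans (∑-swap elems Fp.elems _) (trans (∑-cong Fp.elems (λ t → card-unshift (toℕ t ⋆ v) mem)) (trans (∑-const Fp.elems (card mem)) (cong (_* card mem) (size-Fin p))))
          bound : ∀ x → Fp.card (λ t → mem (x ⊝ (toℕ t ⋆ v))) ≤ ⟦ V.mem x ⟧
          bound x with V.mem x in eq
          ... | true = Fp.card≤1 (translates-distinct v∉)
          ... | false = ℤ.≤-reflexive (Fp.card-empty (λ t → ¬true⇒false (λ h → true≢false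
                (subst (λ y → V.mem y ≡ true) (sub-add x (toℕ t ⋆ v)) (V.+∈ (sub _ h) (V.⋆∈ (toℕ t) v∈V))) eq)))

      -- Dyson's e-transform: elements of B move into A without enlarging A + B.
      module Transform (A B : G → Bool) (e : G) where

        A′ B′ : G → Bool
        A′ x = A x ∨ B (x ⊝ e)
        B′ x = B x ∧ A (x ⊹ e)

        card-transform : card A′ + card B′ ≡ card A + card B
        card-transform = begin
          card A′ + card B′                              ≡⟨ cong (λ z → card A′ + z) (sym (card-unshift e B′)) ⟩
          card A′ + card (λ x → B (x ⊝ e) ∧ A (x ⊝ e ⊹ e)) ≡⟨ cong (λ z → card A′ + z) (card-cong (λ x → trans (cong (λ y → B (x ⊝ e) ∧ A y) (sub-add x e)) (∧-comm (B (x ⊝ e)) (A x)))) ⟩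
          card A′ + card (λ x → A x ∧ B (x ⊝ e))         ≡⟨ card-∪∩ A (λ x → B (x ⊝ e)) ⟩
          card A + card (λ x → B (x ⊝ e))                ≡⟨ cong (λ z → card A + z) (card-unshift e B) ⟩
          card A + card B                                ∎
          where open ≡-Reasoning

        transform-⊆ : ∀ {C : G → Bool} → (∀ a b → A a ≡ true → B b ≡ true → C (a ⊹ b) ≡ true) →
          ∀ a b → A′ a ≡ true → B′ b ≡ true → C (a ⊹ b) ≡ true
        transform-⊆ {C} A+B⊆C a b ha hb with ∨-elim {A a} ha
        ... | inj₁ h = A+B⊆C a b h (∧-elimˡ hb)
        ... | inj₂ h = subst (λ x → C x ≡ true) (transfer a b e) (A+B⊆C (b ⊹ e) (a ⊝ e) (∧-elimʳ {B b} hb) h)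

      -- Induction on a bound `k` for |B|. The transforms by e = x - b with x in A keep b in B, so B
      -- never becomes empty. Once none of them shrinks B, A is invariant under B - b, and the point
      -- `z` of the coset that C misses makes the stabiliser of A a proper subgroup of `V`.
      kneser-coset : (V : Subgroup) (let open Subgroup V) → ∀ k (A B C : G → Bool) {x₀ y₀ z a b} →
        (∀ x → A x ≡ true → mem (x ⊝ x₀) ≡ true) → (∀ y → B y ≡ true → mem (y ⊝ y₀) ≡ true) →
        A a ≡ true → B b ≡ true → (∀ x y → A x ≡ true → B y ≡ true → C (x ⊹ y) ≡ true) →
        mem (z ⊝ (x₀ ⊹ y₀)) ≡ true → C z ≡ false → card B ≤ + k →
        + p * card A + + p * card B ≤ + p * card C + card mem
      kneser-coset V ℕ.zero A B C A⊆ B⊆ a∈ b∈ A+B⊆C z∈ z∉ B≤k = ⊥-elim (0≰-1 (≤⇒0≤ (ℤ.≤-trans (card≥1 _ b∈) B≤k)) refl)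
      kneser-coset V (suc k) A B C {x₀} {y₀} {z} {a} {b} A⊆ B⊆ a∈ b∈ A+B⊆C z∈ z∉ B≤k
        with search (λ x → A x ∧ not (every finite (λ y → B y ⇒ A (y ⊹ (x ⊝ b)))))
      ... | inj₁ (x , hx) = 0≤⇒≤ _ (≤⇒0≤ IH) (lem (+ p) (card A′) (card B′) (card A) (card B) (card C) (card mem) card-transform)
        where
        open Subgroup V
        e = x ⊝ b
        open Transform A B e
        x∈ : A x ≡ true
        x∈ = ∧-elimˡ hx
        w = every-false finite (not-elim (∧-elimʳ {A x} hx))
        y = proj₁ w
        y∈ : B y ≡ true
        y∈ = ⇒-falseˡ (proj₂ w)
        y∉B′ : B′ y ≡ false
        y∉B′ = ¬true⇒false (λ h → true≢false (∧-elimʳ {B y} h) (⇒-falseʳ {B y} (proj₂ w)))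
        smaller : card B′ + 1ℤ ≤ card B
        smaller = card-strict y (λ _ → ∧-elimˡ) y∈ y∉B′
        A′⊆ : ∀ v → A′ v ≡ true → mem (v ⊝ x₀) ≡ true
        A′⊆ v h with ∨-elim {A v} h
        ... | inj₁ h′ = A⊆ v h′
        ... | inj₂ h′ = subst (λ u → mem u ≡ true) eq (+∈ (⊝∈ V (B⊆ _ h′) (B⊆ _ b∈)) (A⊆ x x∈))
          where
          eq : ((v ⊝ (x ⊝ b)) ⊝ y₀) ⊝ (b ⊝ y₀) ⊹ (x ⊝ x₀) ≡ v ⊝ x₀
          eq = begin
            ((v ⊝ (x ⊝ b)) ⊝ y₀) ⊝ (b ⊝ y₀) ⊹ (x ⊝ x₀) ≡⟨ cong (_⊹ (x ⊝ x₀)) (trans (⊝⊝ _ b y₀) (trans (cong (_⊹ y₀) (trans (assoc _ _ _) (trans (cong ((v ⊝ (x ⊝ b)) ⊹_) (comm _ _)) (sym (assoc _ _ _))))) (sub-add _ y₀))) ⟩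
            ((v ⊝ (x ⊝ b)) ⊝ b) ⊹ (x ⊝ x₀)             ≡⟨ cong (λ u → (u ⊝ b) ⊹ (x ⊝ x₀)) (⊝⊝ v x b) ⟩
            (((v ⊝ x) ⊹ b) ⊝ b) ⊹ (x ⊝ x₀)             ≡⟨ cong (_⊹ (x ⊝ x₀)) (add-sub (v ⊝ x) b) ⟩
            (v ⊝ x) ⊹ (x ⊝ x₀)                         ≡⟨ sym (assoc _ x (⊟ x₀)) ⟩
            ((v ⊝ x) ⊹ x) ⊝ x₀                         ≡⟨ cong (_⊝ x₀) (sub-add v x) ⟩
            v ⊝ x₀ ∎
            where open ≡-Reasoning
        IH : + p * card A′ + + p * card B′ ≤ + p * card C + card mem
        IH = kneser-coset V k A′ B′ C A′⊆ (λ v h → B⊆ v (∧-elimˡ h)) (∨-introˡ a∈)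
               (∧-intro b∈ (subst (λ v → A v ≡ true) (sym (+-cancel- x b)) x∈))
               (transform-⊆ {C} A+B⊆C) z∈ z∉
               (0≤⇒≤ _ (≤⇒0≤ (ℤ.≤-trans smaller B≤k)) (arith (card B′) (+ k)))
          where
          arith : ∀ u v → (1ℤ + v) - (u + 1ℤ) ≡ v - u
          arith = solve-∀
        lem : ∀ p a′ b′ a b c v → a′ + b′ ≡ a + b → (p * c + v) - (p * a′ + p * b′) ≡ (p * c + v) - (p * a + p * b)
        lem p a′ b′ a b c v h = cong (λ s → (p * c + v) - s) (trans (sym (ℤ.*-distribˡ-+ p a′ b′)) (trans (cong (p *_) h) (ℤ.*-distribˡ-+ p a b)))
      ... | inj₂ stable = 0≤⇒≤ _ (0≤+ (0≤* (0≤+ℕ p) (≤⇒0≤ A≤C)) (0≤+ (0≤* (0≤+ℕ p) (≤⇒0≤ B≤K)) (≤⇒0≤ pK≤V))) (lem (+ p) (card A) (card B) (card C) (card K.mem) (card mem))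
        where
        open Subgroup V
        -- The stabiliser of A. It contains B - b, so |B| ≤ |K|, while |A| ≤ |C| comes from A + b.
        stab : Subgroup
        stab = record
          { mem = λ t → every finite (λ x → A x ⇒ A (x ⊹ t))
          ; 0∈ = every-intro finite (λ x → ⇒-intro (subst (λ v → A v ≡ true) (sym (identityʳ x))))
          ; +∈ = λ {s} {t} hs ht → every-intro finite (λ x → ⇒-intro (λ hx → subst (λ v → A v ≡ true) (assoc x s t)
                   (⇒-elim (every-elim finite ht (x ⊹ s)) (⇒-elim (every-elim finite hs x) hx))))
          }
        module K = Subgroup stab
        A≤C : card A ≤ card C
        A≤C = subst (_≤ card C) (card-unshift b A)
          (card-mono (λ x h → subst (λ v → C v ≡ true) (sub-add x b) (A+B⊆C _ b h b∈)))
        B≤K : card B ≤ card K.mem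
        B≤K = subst (_≤ card K.mem) (card-unshift (⊟ b) B) (card-mono (λ t h → every-intro finite (λ x → ⇒-intro (λ hx →
          subst (λ v → A v ≡ true) (eq x t)
            (⇒-elim (every-elim finite (¬false⇒true (λ f → true≢false (∧-intro hx (cong not f)) (stable x))) (t ⊝ (⊟ b))) h)))))
          where
          eq : ∀ x t → (t ⊝ (⊟ b)) ⊹ (x ⊝ b) ≡ x ⊹ t
          eq x t = trans (cong (λ s → (t ⊹ s) ⊹ (x ⊝ b)) (GP.⁻¹-involutive b)) (transfer x t b)
        K⊆V : ∀ t → K.mem t ≡ true → mem t ≡ true
        K⊆V t h = subst (λ v → mem v ≡ true) eq (⊝∈ V (A⊆ _ (⇒-elim (every-elim finite h a) a∈)) (A⊆ a a∈))
          where
          eq : ((a ⊹ t) ⊝ x₀) ⊝ (a ⊝ x₀) ≡ t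
          eq = trans (⊝⊝ _ a x₀) (trans (cong (λ s → s ⊝ a ⊹ x₀) (sym (+-swap- a t x₀)))
                 (trans (cong (_⊹ x₀) (trans (assoc t _ _) (trans (cong (t ⊹_) (trans (comm _ _) (trans (sym (assoc _ a (⊟ x₀))) (cong (_⊝ x₀) (inverseˡ a))))) (trans (cong (t ⊹_) (identityˡ _)) refl)))) (sub-add t x₀)))
        -- If v stabilised A, then a + v = z - b would lie in A and z in A + B. Hence v witnesses
        -- that K is proper in `V`, and p|K| ≤ |V|.
        v = (z ⊝ b) ⊝ a
        v∈V : mem v ≡ true
        v∈V = subst (λ u → mem u ≡ true) eq (⊝∈ V z∈ (+∈ (A⊆ a a∈) (B⊆ b b∈)))
          where
          eq : (z ⊝ (x₀ ⊹ y₀)) ⊝ ((a ⊝ x₀) ⊹ (b ⊝ y₀)) ≡ v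
          eq = begin
            (z ⊝ (x₀ ⊹ y₀)) ⊝ ((a ⊝ x₀) ⊹ (b ⊝ y₀))  ≡⟨ cong ((z ⊝ (x₀ ⊹ y₀)) ⊝_) (sym (⊹⊝⊹ a b x₀ y₀)) ⟩
            (z ⊝ (x₀ ⊹ y₀)) ⊝ ((a ⊹ b) ⊝ (x₀ ⊹ y₀))  ≡⟨ ⊝⊝ _ (a ⊹ b) (x₀ ⊹ y₀) ⟩
            (z ⊝ (x₀ ⊹ y₀)) ⊝ (a ⊹ b) ⊹ (x₀ ⊹ y₀)    ≡⟨ trans (comm _ _) (+-swap- _ _ (a ⊹ b)) ⟩
            (z ⊝ (x₀ ⊹ y₀)) ⊹ (x₀ ⊹ y₀) ⊝ (a ⊹ b)    ≡⟨ cong (_⊝ (a ⊹ b)) (sub-add z (x₀ ⊹ y₀)) ⟩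
            z ⊝ (a ⊹ b)                              ≡⟨ cong (z ⊝_) (comm a b) ⟩
            z ⊝ (b ⊹ a)                              ≡⟨ ⊝⊹ z b a ⟩
            v ∎
            where open ≡-Reasoning
        v∉K : K.mem v ≡ false
        v∉K = ¬true⇒false (λ h → true≢false
          (subst (λ u → C u ≡ true) (sub-add z b) (A+B⊆C (z ⊝ b) b (subst (λ u → A u ≡ true) (+-cancel- (z ⊝ b) a) (⇒-elim (every-elim finite h a) a∈)) b∈)) z∉)
        pK≤V : + p * card K.mem ≤ card mem
        pK≤V = proper-index stab V K⊆V v v∈V v∉K
        lem : ∀ p a b c k v → p * (c - a) + (p * (k - b) + (v - p * k)) ≡ (p * c + v) - (p * a + p * b)
        lem = solve-∀

      whole : Subgroup
      whole = record { mem = λ _ → true ; 0∈ = refl ; +∈ = λ _ _ → refl }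

      kneser : (V : Subgroup) (let open Subgroup V) → ∀ (A B C : G → Bool) {x₀ y₀ z a b} →
        (∀ x → A x ≡ true → mem (x ⊝ x₀) ≡ true) → (∀ y → B y ≡ true → mem (y ⊝ y₀) ≡ true) →
        A a ≡ true → B b ≡ true → (∀ x y → A x ≡ true → B y ≡ true → C (x ⊹ y) ≡ true) →
        mem (z ⊝ (x₀ ⊹ y₀)) ≡ true → C z ≡ false →
        + p * card A + + p * card B ≤ + p * card C + card mem
      kneser V A B C A⊆ B⊆ a∈ b∈ A+B⊆C z∈ z∉ = kneser-coset V ∣ card B ∣ A B C A⊆ B⊆ a∈ b∈ A+B⊆C z∈ z∉
        (ℤ.≤-reflexive (sym (ℤ.0≤i⇒+∣i∣≡i (card≥0 B))))

      module _ (size≡p : size ≡ + p) where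

        -- With the whole group as subgroup, its order p cancels from the Kneser inequality. The
        -- missing point `z` takes the place of the usual minimum with p.
        cauchy-davenport : ∀ (A B C : G → Bool) {z a b} → A a ≡ true → B b ≡ true →
          (∀ x y → A x ≡ true → B y ≡ true → C (x ⊹ y) ≡ true) → C z ≡ false →
          card A + card B ≤ card C + 1ℤ
        cauchy-davenport A B C {z} a∈ b∈ A+B⊆C z∉ = *-cancel-≤ {+ p} 1≤p
          (0≤⇒≤ _ (≤⇒0≤ (subst (λ s → + p * card A + + p * card B ≤ + p * card C + s) size≡p
             (kneser whole A B C {0#} {0#} (λ _ _ → refl) (λ _ _ → refl) a∈ b∈ A+B⊆C refl z∉)))
             (lem (+ p) (card A) (card B) (card C)))
          where
          1≤p : 1ℤ ≤ + p
          1≤p = subst (λ n → 1ℤ ≤ + n) (sym p≡) (+≤+ (ℕ.s≤s ℕ.z≤n))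
          lem : ∀ p a b c → (p * c + p) - (p * a + p * b) ≡ p * (c + 1ℤ) - p * (a + b)
          lem = solve-∀

        another : ∀ {B : G → Bool} b → B b ≡ true → + 2 ≤ card B → ∃ λ b′ → B b′ ≡ true × b′ ≢ b
        another {B} b b∈ h with search (λ x → B x ∧ not (does (x ≟ b)))
        ... | inj₁ (x , hx) = x , ∧-elimˡ hx , no-does (x ≟ b) (not-elim (∧-elimʳ {B x} hx))
        ... | inj₂ f = ⊥-elim (0≰-1 (≤⇒0≤ (ℤ.≤-trans h (card≤1 (λ x y hx hy → trans (only x hx) (sym (only y hy)))))) refl)
          where
          only : ∀ x → B x ≡ true → x ≡ b
          only x hx = yes-does (x ≟ b) (¬false⇒true (λ e → true≢false (∧-intro hx (cong not e)) (f x)))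

        -- The conclusion says that C is an arithmetic progression with difference d.  If no e-transform leaves between 2 and
        -- |B| - 1 elements in B, then |B| = 2 and the claim is immediate.
        vosper : ∀ k (A B C : G → Bool) {z} → + 2 ≤ card A → + 2 ≤ card B → card B ≤ + k →
          (∀ x y → A x ≡ true → B y ≡ true → C (x ⊹ y) ≡ true) → C z ≡ false →
          card C + 1ℤ ≤ card A + card B →
          ∃ λ d → d ≢ 0# × card (λ c → C c ∧ not (C (c ⊝ d))) ≤ 1ℤ
        vosper ℕ.zero A B C 2≤A 2≤B B≤k _ _ _ = ⊥-elim (absurd (ℤ.≤-trans 2≤B B≤k))
          where
          absurd : ¬ (+ 2 ≤ + 0)
          absurd (+≤+ ())
        vosper (suc k) A B C {z} 2≤A 2≤B B≤k A+B⊆C z∉ critical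
          with inhabited {B} (ℤ.≤-trans (+≤+ (ℕ.s≤s ℕ.z≤n)) 2≤B) | card B ℤ.≤? + 2
        ... | b₀ , b₀∈ | yes B≤2 = d , d≢0 , card≤
          where
          b′ = another b₀ b₀∈ 2≤B
          b₁ = proj₁ b′
          d = b₁ ⊝ b₀
          d≢0 : d ≢ 0#
          d≢0 e = proj₂ (proj₂ b′) (GP.x∙y⁻¹≈ε⇒x≈y b₁ b₀ e)
          -- A + b₁ leaves out at most |B| - 1 = 1 point of C. If c - d is outside C, then c is such
          -- a point, since c - b₁ in A would put c - d into A + b₀.
          rest : G → Bool
          rest c = C c ∧ not (A (c ⊝ b₁))
          A+b₁ : card A + card rest ≤ card C
          A+b₁ = subst (λ s → s + card rest ≤ card C) (card-unshift b₁ A)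
            (card-disjoint {λ c → A (c ⊝ b₁)} {rest}
              (λ c h → subst (λ x → C x ≡ true) (sub-add c b₁) (A+B⊆C _ b₁ h (proj₁ (proj₂ b′))))
              (λ c → ∧-elimˡ) (λ c h h′ → true≢false h (not-elim (∧-elimʳ {C c} h′))))
          starts⊆rest : ∀ c → C c ∧ not (C (c ⊝ d)) ≡ true → rest c ≡ true
          starts⊆rest c h = ∧-intro (∧-elimˡ h) (cong not (¬true⇒false (λ hA → true≢false
            (subst (λ x → C x ≡ true) (sym (⊝⊝ c b₁ b₀)) (A+B⊆C _ b₀ hA b₀∈)) (not-elim (∧-elimʳ {C c} h)))))
          card≤ : card (λ c → C c ∧ not (C (c ⊝ d))) ≤ 1ℤ
          card≤ = ℤ.≤-trans (card-mono starts⊆rest)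
            (0≤⇒≤ _ (0≤+ (≤⇒0≤ A+b₁) (0≤+ (≤⇒0≤ critical) (≤⇒0≤ B≤2))) (lem (card A) (card B) (card C) (card rest)))
            where
            lem : ∀ a b c r → (c - (a + r)) + (((a + b) - (c + 1ℤ)) + (+ 2 - b)) ≡ 1ℤ - r
            lem = solve-∀
        ... | b₀ , b₀∈ | no B≰2
          with search (λ a → A a ∧ (does (+ 2 ℤ.≤? card (B∩ a)) ∧ does (card (B∩ a) + 1ℤ ℤ.≤? card B)))
          where
          B∩ : G → G → Bool
          B∩ a = Transform.B′ A B (a ⊝ b₀)
        ... | inj₁ (a , h) = vosper k A′ B′ C (ℤ.≤-trans 2≤A (card-mono (λ _ → ∨-introˡ))) 2≤B′
                (0≤⇒≤ _ (≤⇒0≤ (ℤ.≤-trans smaller B≤k)) (arith (card B′) (+ k)))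
                (transform-⊆ {C} A+B⊆C) z∉ (subst (card C + 1ℤ ≤_) (sym card-transform) critical)
          where
          open Transform A B (a ⊝ b₀)
          2≤B′ : + 2 ≤ card B′
          2≤B′ = yes-does (_ ℤ.≤? _) (∧-elimˡ (∧-elimʳ {A a} h))
          smaller : card B′ + 1ℤ ≤ card B
          smaller = yes-does (_ ℤ.≤? _) (∧-elimʳ {does (+ 2 ℤ.≤? card B′)} (∧-elimʳ {A a} h))
          arith : ∀ u v → (1ℤ + v) - (u + 1ℤ) ≡ v - u
          arith = solve-∀
        ... | inj₂ none = ⊥-elim (B≰2 B≤2)
          where
          -- Now each transform keeps all of B (`a` in `X`) or only b₀ (`a` in `Y`). Sums from `Y`
          -- and `B*` avoid A + b₀, so Cauchy-Davenport inside `C*` gives |Y| ≤ 1. Then `X` is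
          -- nonempty, and X + B inside A + b₀ gives |B| ≤ |Y| + 1.
          X Y B* C* : G → Bool
          shifted : G → Bool
          shifted a = every finite (λ b → B b ⇒ A (b ⊹ (a ⊝ b₀)))
          X a = A a ∧ shifted a
          Y a = A a ∧ not (shifted a)
          B* b = B b ∧ not (does (b ≟ b₀))
          C* c = C c ∧ not (A (c ⊝ b₀))
          X+Y : card X + card Y ≡ card A
          X+Y = trans (sym (∑-+ elems _ _)) (∑-cong elems (λ x → split (A x) (shifted x)))
            where
            split : ∀ u v → ⟦ u ∧ v ⟧ + ⟦ u ∧ not v ⟧ ≡ ⟦ u ⟧
            split true v = ⟦not⟧ v
            split false v = refl
          B≤B*+1 : card B ≤ card B* + 1ℤ
          B≤B*+1 = subst (λ s → card B ≤ card B* + s) (card-singleton b₀)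
            (subst (card B ≤_) (∑-+ elems _ _) (∑-mono elems (λ x → split (B x) (does (x ≟ b₀)))))
            where
            split : ∀ u v → ⟦ u ⟧ ≤ ⟦ u ∧ not v ⟧ + ⟦ v ⟧
            split true true = ℤ.≤-refl
            split true false = ℤ.≤-refl
            split false v = subst (0ℤ ≤_) (sym (ℤ.+-identityˡ ⟦ v ⟧)) 0≤⟦ v ⟧
          A+b₀⊆C : ∀ c → A (c ⊝ b₀) ≡ true → C c ≡ true
          A+b₀⊆C c h = subst (λ x → C x ≡ true) (sub-add c b₀) (A+B⊆C _ b₀ h b₀∈)
          A+C* : card A + card C* ≤ card C
          A+C* = subst (λ s → s + card C* ≤ card C) (card-unshift b₀ A)
            (card-disjoint {λ c → A (c ⊝ b₀)} {C*} A+b₀⊆C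
              (λ c → ∧-elimˡ) (λ c h h′ → true≢false h (not-elim (∧-elimʳ {C c} h′))))
          Y⇒ : ∀ y b → Y y ≡ true → B* b ≡ true → A (b ⊹ (y ⊝ b₀)) ≡ false
          Y⇒ y b hy hb = ¬true⇒false (λ hA → no-does (b ≟ b₀) (not-elim (∧-elimʳ {B b} hb))
               (card<2 B∩≤1 b b₀ (∧-intro (∧-elimˡ hb) hA) (∧-intro b₀∈ (subst (λ x → A x ≡ true) (sym (+-cancel- y b₀)) (∧-elimˡ hy)))))
            where
            open Transform A B (y ⊝ b₀)
            w = every-false finite (not-elim (∧-elimʳ {A y} hy))
            smaller : card B′ + 1ℤ ≤ card B
            smaller = card-strict (proj₁ w) (λ _ → ∧-elimˡ) (⇒-falseˡ (proj₂ w))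
              (¬true⇒false (λ h → true≢false (∧-elimʳ {B (proj₁ w)} h) (⇒-falseʳ {B (proj₁ w)} (proj₂ w))))
            B∩≤1 : card B′ ≤ 1ℤ
            B∩≤1 with + 2 ℤ.≤? card B′
            ... | yes 2≤ = ⊥-elim (true≢false
                    (∧-intro (∧-elimˡ {A y} hy) (∧-intro (does-yes (+ 2 ℤ.≤? card B′) 2≤) (does-yes (card B′ + 1ℤ ℤ.≤? card B) smaller))) (none y))
            ... | no ≰ = 0≤⇒≤ _ (≤⇒0≤ (≰⇒1+≤ ≰)) (arith (card B′))
              where
              arith : ∀ u → + 2 - (1ℤ + u) ≡ 1ℤ - u
              arith = solve-∀
          Y≤1 : card Y ≤ 1ℤ
          Y≤1 with search Y
          ... | inj₂ f = subst (_≤ 1ℤ) (sym (card-empty f)) (0≤+ℕ 1)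
          ... | inj₁ (y , y∈) = 0≤⇒≤ _ (0≤+ (≤⇒0≤ cd) (0≤+ (≤⇒0≤ A+C*) (0≤+ (≤⇒0≤ critical) (≤⇒0≤ B≤B*+1))))
                  (lem (card Y) (card A) (card B) (card B*) (card C) (card C*))
            where
            b′ = another b₀ b₀∈ 2≤B
            cd : card Y + card B* ≤ card C* + 1ℤ
            cd = cauchy-davenport Y B* C* {z} {y} {proj₁ b′} y∈
              (∧-intro (proj₁ (proj₂ b′)) (cong not (does-no (proj₁ b′ ≟ b₀) (proj₂ (proj₂ b′)))))
              (λ u v hu hv → ∧-intro (A+B⊆C u v (∧-elimˡ hu) (∧-elimˡ hv))
                (cong not (subst (λ x → A x ≡ false) (+-swap- u v b₀) (Y⇒ u v hu hv))))
              (cong (_∧ not (A (z ⊝ b₀))) z∉)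
            lem : ∀ y a b b* c c* → ((c* + 1ℤ) - (y + b*)) + ((c - (a + c*)) + (((a + b) - (c + 1ℤ)) + ((b* + 1ℤ) - b))) ≡ 1ℤ - y
            lem = solve-∀
          1≤X : 1ℤ ≤ card X
          1≤X = 0≤⇒≤ _ (0≤+ (≤⇒0≤ Y≤1) (≤⇒0≤ 2≤A)) (trans (cong (λ a → (1ℤ - card Y) + (a - + 2)) (sym X+Y)) (lem (card X) (card Y)))
            where
            lem : ∀ x y → (1ℤ - y) + ((x + y) - + 2) ≡ x - 1ℤ
            lem = solve-∀
          B≤2 : card B ≤ + 2
          B≤2 = 0≤⇒≤ _ (0≤+ (≤⇒0≤ cd) (≤⇒0≤ Y≤1))
                  (trans (cong (λ a → ((a + 1ℤ) - (card X + card B)) + (1ℤ - card Y)) (sym X+Y)) (lem (card X) (card Y) (card B)))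
            where
            cd : card X + card B ≤ card A + 1ℤ
            cd = subst (λ s → card X + card B ≤ s + 1ℤ) (card-unshift b₀ A)
              (cauchy-davenport X B (λ c → A (c ⊝ b₀)) {z} (proj₂ (inhabited {X} 1≤X)) b₀∈
                (λ u v hu hv → subst (λ x → A x ≡ true) (+-swap- u v b₀) (⇒-elim (every-elim finite (∧-elimʳ {A u} hu) v) hv))
                (¬true⇒false (λ h → true≢false (A+b₀⊆C z h) z∉)))
            lem : ∀ x y b → ((x + y + 1ℤ) - (x + b)) + (1ℤ - y) ≡ + 2 - b
            lem = solve-∀

-- Level sets of the translation distance, and a lower bound for its weighted sum

module EnergyBound where

  open import Data.Integer using (ℤ; ∣_∣; +_; -[1+_]; +[1+_]; -_; _+_; _*_; _-_; _≤_; 0ℤ; 1ℤ; +≤+)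
  open FiniteSums
  open SumsetTheory

  <ᵇ-true : ∀ {m n} → m ℕ.< n → (m <ᵇ n) ≡ true
  <ᵇ-true {m} {n} h = does-yes (m ℕ.<? n) h

  <ᵇ-false : ∀ {m n} → n ℕ.≤ m → (m <ᵇ n) ≡ false
  <ᵇ-false {m} {n} h = does-no (m ℕ.<? n) (ℕ.≤⇒≯ h)

  true-<ᵇ : ∀ {m n} → (m <ᵇ n) ≡ true → m ℕ.< n
  true-<ᵇ {m} {n} e = yes-does (m ℕ.<? n) e

  false-<ᵇ : ∀ {m n} → (m <ᵇ n) ≡ false → n ℕ.≤ m
  false-<ᵇ {m} {n} e = ℕ.≮⇒≥ (no-does (m ℕ.<? n) e)

  -- The truncated layer-cake formula: it turns sums of values into sums of level-set sizes.
  layers : ∀ T n → ∑ (downFrom T) (λ t → ⟦ t <ᵇ n ⟧) ≡ + (n ⊓ T)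
  layers ℕ.zero n = cong +_ (sym (ℕ.⊓-zeroʳ n))
  layers (suc T) n with T ℕ.<? n
  ... | yes T<n rewrite <ᵇ-true T<n = begin
    1ℤ + ∑ (downFrom T) (λ t → ⟦ t <ᵇ n ⟧)  ≡⟨ cong (λ z → 1ℤ + z) (layers T n) ⟩
    + (suc (n ⊓ T))                         ≡⟨ cong (λ k → + (suc k)) (ℕ.m≥n⇒m⊓n≡n (ℕ.<⇒≤ T<n)) ⟩
    + (suc T)                               ≡⟨ cong +_ (sym (ℕ.m≥n⇒m⊓n≡n T<n)) ⟩
    + (n ⊓ suc T)                           ∎
    where open ≡-Reasoning
  ... | no T≮n rewrite <ᵇ-false (ℕ.≮⇒≥ T≮n) = trans (ℤ.+-identityˡ _) (trans (layers T n)
          (cong +_ (trans (ℕ.m≤n⇒m⊓n≡m (ℕ.≮⇒≥ T≮n)) (sym (ℕ.m≤n⇒m⊓n≡m (ℕ.m≤n⇒m≤1+n (ℕ.≮⇒≥ T≮n)))))))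

  size-downFrom : ∀ T → ∑ (downFrom T) (λ _ → 1ℤ) ≡ + T
  size-downFrom ℕ.zero = refl
  size-downFrom (suc T) = cong (λ z → 1ℤ + z) (size-downFrom T)

  -- Doubling compares level t with level 4t, so only every fourth level is sampled; by monotonicity
  -- the sample is the least of its block of four.
  sample-4 : (g : ℕ → ℤ) → (∀ {s t} → s ℕ.≤ t → g s ≤ g t) → ∀ T →
    + 4 * ∑ (downFrom T) (λ t → g (t ℕ.* 4)) ≤ ∑ (downFrom (T ℕ.* 4)) g
  sample-4 g mono ℕ.zero = ℤ.≤-refl
  sample-4 g mono (suc T) = 0≤⇒≤ _
      (0≤+ (≤⇒0≤ (mono {T ℕ.* 4} (ℕ.m≤n+m _ 1))) (0≤+ (≤⇒0≤ (mono {T ℕ.* 4} (ℕ.m≤n+m _ 2))) (0≤+ (≤⇒0≤ (mono {T ℕ.* 4} (ℕ.m≤n+m _ 3))) (≤⇒0≤ (sample-4 g mono T)))))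
      (lem (g (T ℕ.* 4)) (g (1 ℕ.+ T ℕ.* 4)) (g (2 ℕ.+ T ℕ.* 4)) (g (3 ℕ.+ T ℕ.* 4)) _ _)
    where
    lem : ∀ a b c d s r → (b - a) + ((c - a) + ((d - a) + (r - + 4 * s))) ≡ (d + (c + (b + (a + r)))) - + 4 * (a + s)
    lem = solve-∀

  module Energy {p : ℕ} {G : Set} (E : ElementaryAbelian p G) (size≡p : ElementaryAbelian.size E ≡ + p)
    (c : G → ℤ) (q : ℤ) where
    open Elementary E

    N sq : ℤ
    N = sum c
    sq = sum (λ j → c j * c j)

    corr dist : G → ℤ
    corr k = sum (λ j → c j * c (j ⊹ k))
    dist k = sum (λ j → (c j - c (j ⊹ k)) * (c j - c (j ⊹ k)))

    -- In the notation of the introduction dist = 2λ, W = Σ λ and S = 2 Σ b λ.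
    triples W S : ℤ
    triples = sum (λ k → c k * corr k)
    W = + p * sq - N * N
    S = sum (λ k → (q - + 2 * c k) * dist k)

    sum-const : ∀ k → sum (λ _ → k) ≡ + p * k
    sum-const k = trans (∑-const elems k) (cong (_* k) size≡p)

    sq-shift : ∀ k → sum (λ j → c (j ⊹ k) * c (j ⊹ k)) ≡ sq
    sq-shift k = sum-shift k (λ j → c j * c j)

    -- Expand the nonnegative double sum of (f i - f j)².
    cauchy-schwarz : ∀ (f : G → ℤ) → sum f * sum f ≤ + p * sum (λ x → f x * f x)
    cauchy-schwarz f = *-cancel-≤ {+ 2} (+≤+ (ℕ.s≤s ℕ.z≤n)) (0≤⇒≤ _
        (∑-nonneg elems {λ i → sum (λ j → (f i - f j) * (f i - f j))} (λ i → ∑-nonneg elems (λ j → 0≤sq (f i - f j)))) expand)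
      where
      open ≡-Reasoning
      F² = sum (λ x → f x * f x)
      sq-expand : ∀ a b → (a - b) * (a - b) ≡ a * a + (b * b + - (+ 2 * a) * b)
      sq-expand = solve-∀
      inner : ∀ i → sum (λ j → (f i - f j) * (f i - f j)) ≡ + p * (f i * f i) + (F² + - (+ 2 * f i) * sum f)
      inner i = begin
        sum (λ j → (f i - f j) * (f i - f j))                               ≡⟨ ∑-cong elems (λ j → sq-expand (f i) (f j)) ⟩
        sum (λ j → f i * f i + (f j * f j + - (+ 2 * f i) * f j))           ≡⟨ ∑-+ elems _ _ ⟩
        sum (λ _ → f i * f i) + sum (λ j → f j * f j + - (+ 2 * f i) * f j) ≡⟨ cong₂ _+_ (sum-const _) (trans (∑-+ elems _ _) (cong (λ z → F² + z) (∑-*ˡ elems (- (+ 2 * f i)) f))) ⟩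
        + p * (f i * f i) + (F² + - (+ 2 * f i) * sum f)                    ∎
      arrange : ∀ x s → - (+ 2 * x) * s ≡ (- (+ 2) * s) * x
      arrange = solve-∀
      final : ∀ p F s → p * F + (p * F + (- (+ 2) * s) * s) ≡ + 2 * (p * F) - + 2 * (s * s)
      final = solve-∀
      expand : sum (λ i → sum (λ j → (f i - f j) * (f i - f j))) ≡ + 2 * (+ p * F²) - + 2 * (sum f * sum f)
      expand = begin
        sum (λ i → sum (λ j → (f i - f j) * (f i - f j)))               ≡⟨ ∑-cong elems inner ⟩
        sum (λ i → + p * (f i * f i) + (F² + - (+ 2 * f i) * sum f))    ≡⟨ trans (∑-+ elems _ _) (cong₂ _+_ (∑-*ˡ elems (+ p) _) (∑-+ elems _ _)) ⟩
        + p * F² + (sum (λ _ → F²) + sum (λ i → - (+ 2 * f i) * sum f)) ≡⟨ cong (λ z → + p * F² + z) (cong₂ _+_ (sum-const F²) (trans (∑-cong elems (λ i → arrange (f i) (sum f))) (∑-*ˡ elems (- (+ 2) * sum f) f))) ⟩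
        + p * F² + (+ p * F² + (- (+ 2) * sum f) * sum f)               ≡⟨ final (+ p) F² (sum f) ⟩
        + 2 * (+ p * F²) - + 2 * (sum f * sum f)                        ∎

    0≤W : 0ℤ ≤ W
    0≤W = ≤⇒0≤ (cauchy-schwarz c)

    dist≥0 : ∀ k → 0ℤ ≤ dist k
    dist≥0 k = ∑-nonneg elems (λ j → 0≤sq (c j - c (j ⊹ k)))

    -- The sign ε = -1 evaluates `dist`; ε = 1 is the companion sum needed for `dist-max`.
    square-sum : ∀ k (ε : ℤ) → ε * ε ≡ 1ℤ →
      sum (λ j → (c j + ε * c (j ⊹ k)) * (c j + ε * c (j ⊹ k))) ≡ + 2 * sq + + 2 * ε * corr k
    square-sum k ε ε² = begin
      sum (λ j → (c j + ε * c (j ⊹ k)) * (c j + ε * c (j ⊹ k)))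
        ≡⟨ ∑-cong elems (λ j → expand (c j) (c (j ⊹ k))) ⟩
      sum (λ j → c j * c j + (c (j ⊹ k) * c (j ⊹ k) + + 2 * ε * (c j * c (j ⊹ k))))
        ≡⟨ trans (∑-+ elems _ _) (cong (λ z → sq + z) (trans (∑-+ elems _ _) (cong₂ _+_ (sq-shift k) (∑-*ˡ elems (+ 2 * ε) _)))) ⟩
      sq + (sq + + 2 * ε * corr k)
        ≡⟨ arrange sq (+ 2 * ε * corr k) ⟩
      + 2 * sq + + 2 * ε * corr k ∎
      where
      open ≡-Reasoning
      expand′ : ∀ x y ε → (x + ε * y) * (x + ε * y) ≡ x * x + ((ε * ε) * (y * y) + + 2 * ε * (x * y))
      expand′ = solve-∀
      expand : ∀ x y → (x + ε * y) * (x + ε * y) ≡ x * x + (y * y + + 2 * ε * (x * y))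
      expand x y = trans (expand′ x y ε) (cong (λ z → x * x + (z + + 2 * ε * (x * y))) (trans (cong (_* (y * y)) ε²) (ℤ.*-identityˡ (y * y))))
      arrange : ∀ s t → s + (s + t) ≡ + 2 * s + t
      arrange = solve-∀

    dist≡ : ∀ k → dist k ≡ + 2 * sq - + 2 * corr k
    dist≡ k = trans (∑-cong elems (λ j → cong (λ z → (c j + z) * (c j + z)) (sym (ℤ.-1*i≡-i (c (j ⊹ k)))))) (trans (square-sum k (- 1ℤ) refl) (lem sq (corr k)))
      where
      lem : ∀ s t → + 2 * s + + 2 * (- 1ℤ) * t ≡ + 2 * s - + 2 * t
      lem = solve-∀

    dist-0 : dist 0# ≡ 0ℤ
    dist-0 = trans (∑-cong elems (λ j → trans (cong (λ i → (c j - c i) * (c j - c i)) (identityʳ j)) (lem (c j)))) (∑-zero elems)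
      where
      lem : ∀ x → (x - x) * (x - x) ≡ 0ℤ
      lem = solve-∀

    dist-neg : ∀ k → dist (⊟ k) ≡ dist k
    dist-neg k = trans (sym (sum-shift k _)) (∑-cong elems (λ j → trans (cong (λ i → (c (j ⊹ k) - c i) * (c (j ⊹ k) - c i)) (add-sub j k)) (lem (c (j ⊹ k)) (c j))))
      where
      lem : ∀ x y → (x - y) * (x - y) ≡ (y - x) * (y - x)
      lem = solve-∀

    -- √dist is the ℓ² distance between `c` and its translate, hence a seminorm on translations. Its
    -- triangle inequality is used in this square-free form, which follows pointwise from (x - 2y +
    -- z)² ≥ 0.
    dist-sub : ∀ i j → dist (i ⊹ j) ≤ + 2 * dist i + + 2 * dist j
    dist-sub i j = subst (dist (i ⊹ j) ≤_) total (∑-mono elems bound)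
      where
      d = λ x y → (x - y) * (x - y)
      bound : ∀ t → d (c t) (c (t ⊹ (i ⊹ j))) ≤ + 2 * d (c t) (c (t ⊹ i)) + + 2 * d (c (t ⊹ i)) (c (t ⊹ i ⊹ j))
      bound t rewrite sym (assoc t i j) = 0≤⇒≤ _ (0≤sq (c t - + 2 * c (t ⊹ i) + c (t ⊹ i ⊹ j))) (lem (c t) (c (t ⊹ i)) (c (t ⊹ i ⊹ j)))
        where
        lem : ∀ x y z → (x - + 2 * y + z) * (x - + 2 * y + z) ≡ (+ 2 * ((x - y) * (x - y)) + + 2 * ((y - z) * (y - z))) - (x - z) * (x - z)
        lem = solve-∀
      total : sum (λ t → + 2 * d (c t) (c (t ⊹ i)) + + 2 * d (c (t ⊹ i)) (c (t ⊹ i ⊹ j))) ≡ + 2 * dist i + + 2 * dist j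
      total = trans (∑-+ elems _ _) (cong₂ _+_ (∑-*ˡ elems (+ 2) _)
        (trans (∑-*ˡ elems (+ 2) _) (cong (λ z → + 2 * z) (sum-shift i (λ t → d (c t) (c (t ⊹ j)))))))

    -- Cauchy-Schwarz for c j + c (j + k), whose total is 2N. Since p · `dist` has mean 2W by
    -- `dist-sum`, its maximum is at most twice its mean.
    dist-max : ∀ k → + p * dist k ≤ + 4 * W
    dist-max k = 0≤⇒≤ _ (≤⇒0≤ cs) (trans (cong₂ (λ u v → + p * u - v * v) total sum2) (trans (lem (+ p) sq (corr k) N) (cong (λ z → + 4 * W - + p * z) (sym (dist≡ k)))))
      where
      f = λ j → c j + 1ℤ * c (j ⊹ k)
      cs = cauchy-schwarz f
      total : sum (λ j → f j * f j) ≡ + 2 * sq + + 2 * 1ℤ * corr k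
      total = square-sum k 1ℤ refl
      sum2 : sum f ≡ N + N
      sum2 = trans (∑-+ elems _ _) (cong (λ z → N + z) (trans (∑-cong elems (λ j → ℤ.*-identityˡ (c (j ⊹ k)))) (sum-shift k c)))
      lem : ∀ p s t n → p * (+ 2 * s + + 2 * 1ℤ * t) - (n + n) * (n + n) ≡ + 4 * (p * s - n * n) - p * (+ 2 * s - + 2 * t)
      lem = solve-∀

    corr-sum : sum corr ≡ N * N
    corr-sum = begin
      sum (λ k → sum (λ j → c j * c (j ⊹ k))) ≡⟨ ∑-swap elems elems _ ⟩
      sum (λ j → sum (λ k → c j * c (j ⊹ k))) ≡⟨ ∑-cong elems (λ j → trans (∑-*ˡ elems (c j) _) (cong (c j *_) (trans (∑-cong elems (λ k → cong c (comm j k))) (sum-shift j c)))) ⟩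
      sum (λ j → c j * N)                     ≡⟨ ∑-*ʳ elems N c ⟩
      N * N                                   ∎
      where open ≡-Reasoning

    dist-sum : sum dist ≡ + 2 * W
    dist-sum = begin
      sum dist                             ≡⟨ ∑-cong elems dist≡ ⟩
      sum (λ k → + 2 * sq - + 2 * corr k)  ≡⟨ ∑-⊖ elems _ _ ⟩
      sum (λ _ → + 2 * sq) - sum (λ k → + 2 * corr k) ≡⟨ cong₂ _-_ (sum-const (+ 2 * sq)) (trans (∑-*ˡ elems (+ 2) corr) (cong (λ z → + 2 * z) corr-sum)) ⟩
      + p * (+ 2 * sq) - + 2 * (N * N)     ≡⟨ lem (+ p) sq (N * N) ⟩
      + 2 * W                              ∎
      where
      open ≡-Reasoning
      lem : ∀ p s m → p * (+ 2 * s) - + 2 * m ≡ + 2 * (p * s - m)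
      lem = solve-∀

    weight-sum : sum (λ k → q - + 2 * c k) ≡ + p * q - + 2 * N
    weight-sum = trans (∑-⊖ elems _ _) (cong₂ _-_ (sum-const q) (∑-*ˡ elems (+ 2) c))

    -- Only `sq` and `triples` depend on more than N, and both can be counted exactly once they are
    -- summed over all functionals.
    S≡ : S ≡ + 2 * (+ p * q - + 2 * N) * sq - + 2 * (q * (N * N) - + 2 * triples)
    S≡ = begin
      S ≡⟨ ∑-cong elems (λ k → trans (cong ((q - + 2 * c k) *_) (dist≡ k)) (expand q (c k) sq (corr k))) ⟩
      sum (λ k → (q - + 2 * c k) * (+ 2 * sq) + (- (+ 2 * q) * corr k + + 4 * (c k * corr k)))
        ≡⟨ trans (∑-+ elems _ _) (cong₂ _+_ (trans (∑-*ʳ elems (+ 2 * sq) _) (cong (_* (+ 2 * sq)) weight-sum))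
             (trans (∑-+ elems _ _) (cong₂ _+_ (trans (∑-*ˡ elems (- (+ 2 * q)) corr) (cong (- (+ 2 * q) *_) corr-sum)) (∑-*ˡ elems (+ 4) _)))) ⟩
      (+ p * q - + 2 * N) * (+ 2 * sq) + (- (+ 2 * q) * (N * N) + + 4 * triples)
        ≡⟨ lem (+ p) q N sq triples ⟩
      _ ∎
      where
      open ≡-Reasoning
      expand : ∀ q x s t → (q - + 2 * x) * (+ 2 * s - + 2 * t) ≡ (q - + 2 * x) * (+ 2 * s) + (- (+ 2 * q) * t + + 4 * (x * t))
      expand = solve-∀
      lem : ∀ p q n s t → (p * q - + 2 * n) * (+ 2 * s) + (- (+ 2 * q) * (n * n) + + 4 * t) ≡ + 2 * (p * q - + 2 * n) * s - + 2 * (q * (n * n) - + 2 * t)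
      lem = solve-∀

    module _ (c≥0 : ∀ i → 0ℤ ≤ c i) (2c≤q : ∀ i → + 2 * c i ≤ q) where

      b : G → ℤ
      b k = q - + 2 * c k

      b≥0 : ∀ k → 0ℤ ≤ b k
      b≥0 k = ≤⇒0≤ (2c≤q k)

      b≤q : ∀ k → b k ≤ q
      b≤q k = 0≤⇒≤ _ (0≤* (0≤+ℕ 2) (c≥0 k)) (lem q (c k))
        where
        lem : ∀ q x → + 2 * x ≡ q - (q - + 2 * x)
        lem = solve-∀

      S≥0 : 0ℤ ≤ S
      S≥0 = ∑-nonneg elems (λ k → 0≤* (b≥0 k) (dist≥0 k))

      -- The factor p puts the levels on the scale of W (mean 2W, maximum at most 4W); natural
      -- values allow the levels to be indexed by ℕ.
      Λ : G → ℕ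
      Λ k = ∣ + p * dist k ∣

      +Λ : ∀ k → + Λ k ≡ + p * dist k
      +Λ k = ℤ.0≤i⇒+∣i∣≡i (0≤* (0≤+ℕ p) (dist≥0 k))

      w : ℕ
      w = ∣ W ∣

      +w : + w ≡ W
      +w = ℤ.0≤i⇒+∣i∣≡i 0≤W

      ball : ℕ → G → Bool
      ball t k = not (t <ᵇ Λ k)

      ball-⇒ : ∀ {t k} → ball t k ≡ true → Λ k ℕ.≤ t
      ball-⇒ e = false-<ᵇ (not-elim e)

      ball-⇐ : ∀ {t k} → Λ k ℕ.≤ t → ball t k ≡ true
      ball-⇐ h = cong not (<ᵇ-false h)

      0∈ball : ∀ t → ball t 0# ≡ true
      0∈ball t = ball-⇐ {t} {0#} (subst (ℕ._≤ t) (sym (ℤ.+-injective (trans (+Λ 0#) (trans (cong (+ p *_) dist-0) (ℤ.*-zeroʳ (+ p)))))) ℕ.z≤n)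

      ball-neg : ∀ t k → ball t (⊟ k) ≡ ball t k
      ball-neg t k = cong (λ d → not (t <ᵇ ∣ + p * d ∣)) (dist-neg k)

      ball-+ : ∀ t i j → ball t i ≡ true → ball t j ≡ true → ball (t ℕ.* 4) (i ⊹ j) ≡ true
      ball-+ t i j hi hj = ball-⇐ {t ℕ.* 4} {i ⊹ j} (ℤ.drop‿+≤+ (subst (_≤ + (t ℕ.* 4)) (sym (+Λ (i ⊹ j)))
          (0≤⇒≤ _ (0≤+ (0≤* (0≤+ℕ p) (≤⇒0≤ (dist-sub i j))) (0≤+ (0≤* (0≤+ℕ 2) (≤⇒0≤ (bd i hi))) (0≤* (0≤+ℕ 2) (≤⇒0≤ (bd j hj)))))
            (trans (lem (+ p) (dist (i ⊹ j)) (dist i) (dist j) (+ t)) (cong (λ z → z - + p * dist (i ⊹ j)) (sym (ℤ.pos-* t 4)))))))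
        where
        bd : ∀ k → ball t k ≡ true → + p * dist k ≤ + t
        bd k h = subst (_≤ + t) (+Λ k) (+≤+ (ball-⇒ {t} {k} h))
        lem : ∀ p d x y t → p * ((+ 2 * x + + 2 * y) - d) + (+ 2 * (t - p * x) + + 2 * (t - p * y)) ≡ t * + 4 - p * d
        lem = solve-∀

      -- The weight `b` outside the ball of level t. Summed over t < w it is a lower bound for pS,
      -- by truncating Λ at w.
      outer : ℕ → ℤ
      outer t = sum (λ k → ⟦ t <ᵇ Λ k ⟧ * b k)

      outer≥0 : ∀ t → 0ℤ ≤ outer t
      outer≥0 t = ∑-nonneg elems (λ k → 0≤* 0≤⟦ t <ᵇ Λ k ⟧ (b≥0 k))

      -- The total weight is pq - 2N, and each element of the ball carries at most q of it.
      outer≥ : ∀ t → (+ p * q - + 2 * N) - q * card (ball t) ≤ outer t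
      outer≥ t = subst (_≤ outer t) (trans (∑-⊖ elems _ _) (cong₂ _-_ weight-sum (∑-*ˡ elems q _))) (∑-mono elems bound)
        where
        bound : ∀ k → b k - q * ⟦ ball t k ⟧ ≤ ⟦ t <ᵇ Λ k ⟧ * b k
        bound k with t <ᵇ Λ k
        ... | true = ℤ.≤-reflexive (lem (b k) q)
          where
          lem : ∀ b q → b - q * 0ℤ ≡ 1ℤ * b
          lem = solve-∀
        ... | false = 0≤⇒≤ _ (≤⇒0≤ (b≤q k)) (lem (b k) q)
          where
          lem : ∀ b q → q - b ≡ 0ℤ * b - (b - q * 1ℤ)
          lem = solve-∀

      outer-sum : ∑ (downFrom w) outer ≤ + p * S
      outer-sum = subst (_≤ + p * S) (sym eq) (subst (sum (λ k → + (Λ k ⊓ w) * b k) ≤_) total (∑-mono elems bound))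
        where
        eq : ∑ (downFrom w) outer ≡ sum (λ k → + (Λ k ⊓ w) * b k)
        eq = trans (∑-swap (downFrom w) elems _) (∑-cong elems (λ k → trans (∑-*ʳ (downFrom w) (b k) _) (cong (_* b k) (layers w (Λ k)))))
        bound : ∀ k → + (Λ k ⊓ w) * b k ≤ + p * (b k * dist k)
        bound k = 0≤⇒≤ _ (0≤* (≤⇒0≤ (+≤+ (ℕ.m⊓n≤m (Λ k) w))) (b≥0 k)) (trans (cong (λ z → (z - + (Λ k ⊓ w)) * b k) (+Λ k)) (lem (+ p) (dist k) (+ (Λ k ⊓ w)) (b k)))
          where
          lem : ∀ p d m b → (p * d - m) * b ≡ p * (b * d) - m * b
          lem = solve-∀
        total : sum (λ k → + p * (b k * dist k)) ≡ + p * S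
        total = ∑-*ˡ elems (+ p) _

      -- As Λ k ≤ 4W, the index k lies in exactly 4W - Λ k of the balls with t < 4w, and these
      -- counts add up to 4pW - 2pW.
      ball-sum : + 4 * ∑ (downFrom w) (λ t → card (ball (t ℕ.* 4))) ≤ + 2 * + p * W
      ball-sum = ℤ.≤-trans (sample-4 (λ t → card (ball t)) mono w) (ℤ.≤-reflexive eq)
        where
        open ≡-Reasoning
        mono : ∀ {s t} → s ℕ.≤ t → card (ball s) ≤ card (ball t)
        mono {s} {t} s≤t = card-mono (λ k h → ball-⇐ {t} {k} (ℕ.≤-trans (ball-⇒ {s} {k} h) s≤t))
        Λ≤ : ∀ k → Λ k ℕ.≤ w ℕ.* 4
        Λ≤ k = ℤ.drop‿+≤+ (subst (_≤ + (w ℕ.* 4)) (sym (+Λ k)) (subst (+ p * dist k ≤_) (trans (cong (λ z → + 4 * z) (sym +w)) (trans (ℤ.*-comm (+ 4) (+ w)) (sym (ℤ.pos-* w 4)))) (dist-max k)))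
        column : ∀ k → ∑ (downFrom (w ℕ.* 4)) (λ t → ⟦ ball t k ⟧) ≡ + 4 * W - + p * dist k
        column k = begin
          ∑ (downFrom (w ℕ.* 4)) (λ t → ⟦ ball t k ⟧)            ≡⟨ ∑-cong (downFrom (w ℕ.* 4)) (λ t → ⟦not⟧≡1- (t <ᵇ Λ k)) ⟩
          ∑ (downFrom (w ℕ.* 4)) (λ t → 1ℤ - ⟦ t <ᵇ Λ k ⟧)       ≡⟨ ∑-⊖ (downFrom (w ℕ.* 4)) _ _ ⟩
          ∑ (downFrom (w ℕ.* 4)) (λ t → 1ℤ) - ∑ (downFrom (w ℕ.* 4)) (λ t → ⟦ t <ᵇ Λ k ⟧) ≡⟨ cong₂ _-_ (size-downFrom (w ℕ.* 4)) (trans (layers (w ℕ.* 4) (Λ k)) (cong +_ (ℕ.m≤n⇒m⊓n≡m (Λ≤ k)))) ⟩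
          + (w ℕ.* 4) - + Λ k                                    ≡⟨ cong₂ _-_ (trans (ℤ.pos-* w 4) (trans (ℤ.*-comm (+ w) (+ 4)) (cong (λ z → + 4 * z) +w))) (+Λ k) ⟩
          + 4 * W - + p * dist k                                 ∎
        eq : ∑ (downFrom (w ℕ.* 4)) (λ t → card (ball t)) ≡ + 2 * + p * W
        eq = begin
          ∑ (downFrom (w ℕ.* 4)) (λ t → card (ball t))      ≡⟨ ∑-swap (downFrom (w ℕ.* 4)) elems _ ⟩
          sum (λ k → ∑ (downFrom (w ℕ.* 4)) (λ t → ⟦ ball t k ⟧)) ≡⟨ ∑-cong elems column ⟩
          sum (λ k → + 4 * W - + p * dist k)                ≡⟨ ∑-⊖ elems _ _ ⟩
          sum (λ _ → + 4 * W) - sum (λ k → + p * dist k)    ≡⟨ cong₂ _-_ (sum-const (+ 4 * W)) (trans (∑-*ˡ elems (+ p) dist) (cong (+ p *_) dist-sum)) ⟩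
          + p * (+ 4 * W) - + p * (+ 2 * W)                 ≡⟨ lem (+ p) W ⟩
          + 2 * + p * W                                     ∎
          where
          lem : ∀ p w → p * (+ 4 * w) - p * (+ 2 * w) ≡ + 2 * p * w
          lem = solve-∀

      -- The hypothesis is summed over the levels t < w. By `ball-sum` the balls of level 4t have at
      -- most p/2 elements on average, whence the factor 2α - pβ.
      integrate : ∀ α β → 0ℤ ≤ β → (∀ t → α - β * card (ball (t ℕ.* 4)) ≤ + 2 * outer t) →
        (+ 2 * α - + p * β) * W ≤ + 4 * + p * S
      integrate α β β≥0 h = *-cancel-≤ {+ 2} (+≤+ (ℕ.s≤s ℕ.z≤n))
        (0≤⇒≤ _ (0≤+ (0≤* (0≤+ℕ 4) (≤⇒0≤ summed)) (0≤+ (0≤* (0≤+ℕ 8) (≤⇒0≤ outer-sum)) (0≤* β≥0 (≤⇒0≤ ball-sum))))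
          (lem α β (+ p) W S (∑ (downFrom w) outer) _))
        where
        summed : W * α - β * ∑ (downFrom w) (λ t → card (ball (t ℕ.* 4))) ≤ + 2 * ∑ (downFrom w) outer
        summed = subst₂ _≤_ (trans (∑-⊖ (downFrom w) _ _) (cong₂ _-_ (trans (∑-const (downFrom w) α) (cong (_* α) (trans (size-downFrom w) +w))) (∑-*ˡ (downFrom w) β _)))
          (∑-*ˡ (downFrom w) (+ 2) outer) (∑-mono (downFrom w) h)
        lem : ∀ α β p w s o n → + 4 * (+ 2 * o - (w * α - β * n)) + (+ 8 * (p * s - o) + β * (+ 2 * p * w - + 4 * n))
          ≡ + 2 * (+ 4 * p * s) - + 2 * ((+ 2 * α - p * β) * w)
        lem = solve-∀

      module _ (pr : Prime p) where
        open Primal pr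

        -- The ball of level t added to itself lies in the ball of level 4t, so Cauchy-Davenport
        -- applies unless the latter is everything.
        doubling : ∀ t → card (ball (t ℕ.* 4)) ≡ + p ⊎ + 2 * card (ball t) ≤ card (ball (t ℕ.* 4)) + 1ℤ
        doubling t with search (λ k → not (ball (t ℕ.* 4) k))
        ... | inj₁ (z , hz) = inj₂ (subst (_≤ card (ball (t ℕ.* 4)) + 1ℤ) (lem (card (ball t)))
                (cauchy-davenport size≡p (ball t) (ball t) (ball (t ℕ.* 4)) {z} (0∈ball t) (0∈ball t) (ball-+ t) (not-elim hz)))
          where
          lem : ∀ x → x + x ≡ + 2 * x
          lem = solve-∀
        ... | inj₂ f = inj₁ (trans (∑-cong elems (λ k → cong ⟦_⟧ (¬false⇒true (λ e → true≢false (cong not e) (f k))))) size≡p)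

        energy-bound : 0ℤ ≤ q → (+ p - 1ℤ) * q ≤ + 4 * N →
          (+ 3 * + p * q - + 8 * N - + 2 * q) * W ≤ + 4 * + p * S
        energy-bound q≥0 large = subst (λ z → z * W ≤ + 4 * + p * S) (lem (+ p) q N)
          -- These α and β result from twice `outer≥` after 2|ball t| is replaced by |ball (4t)| +
          -- 1. If the larger ball is full, `large` makes the left side nonpositive.
          (integrate (+ 2 * (+ p * q - + 2 * N) - q) q q≥0 step)
          where
          lem : ∀ p q n → + 2 * (+ 2 * (p * q - + 2 * n) - q) - p * q ≡ + 3 * p * q - + 8 * n - + 2 * q
          lem = solve-∀
          step : ∀ t → + 2 * (+ p * q - + 2 * N) - q - q * card (ball (t ℕ.* 4)) ≤ + 2 * outer t
          step t with doubling t
          ... | inj₁ full rewrite full = 0≤⇒≤ _ (0≤+ (≤⇒0≤ large) (0≤* (0≤+ℕ 2) (outer≥0 t))) (lem₁ (+ p) q N (outer t))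
            where
            lem₁ : ∀ p q n o → (+ 4 * n - (p - 1ℤ) * q) + + 2 * o ≡ + 2 * o - (+ 2 * (p * q - + 2 * n) - q - q * p)
            lem₁ = solve-∀
          ... | inj₂ h = 0≤⇒≤ _ (0≤+ (0≤* (0≤+ℕ 2) (≤⇒0≤ (outer≥ t))) (0≤* q≥0 (≤⇒0≤ h))) (lem₂ (+ p) q N (outer t) (card (ball t)) (card (ball (t ℕ.* 4))))
            where
            lem₂ : ∀ p q n o x y → + 2 * (o - ((p * q - + 2 * n) - q * x)) + q * ((y + 1ℤ) - + 2 * x) ≡ + 2 * o - (+ 2 * (p * q - + 2 * n) - q - q * y)
            lem₂ = solve-∀

        -- For p = 11 the linear bound above is too weak; it is saved by the parity of the balls.
        energy-bound-11 : p ≡ 11 → (∀ t → ∃ λ x → card (ball t) ≡ 1ℤ + + 2 * x) → 0ℤ ≤ q → + 3 * q ≤ N → N ≤ + 4 * q →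
          + 7 * (+ 4 * q - N) * W ≤ + 4 * + p * S
        energy-bound-11 refl odd q≥0 3q≤N N≤4q = subst (λ z → z * W ≤ + 4 * + p * S) (lem q N)
          -- The line takes the value 0 at |ball (4t)| = 9 and 4(4q - N) at 5. Below 9, doubling and
          -- parity leave |ball t| = 1 or 3. The value 3 forces |ball (4t)| ≥ 5, where the line
          -- matches `outer≥` exactly; for the value 1 the margin is 4(N - 3q).
          (integrate (+ 9 * (+ 4 * q - N)) (+ 4 * q - N) (≤⇒0≤ N≤4q) step)
          where
          lem : ∀ q n → + 2 * (+ 9 * (+ 4 * q - n)) - + 11 * (+ 4 * q - n) ≡ + 7 * (+ 4 * q - n)
          lem = solve-∀
          step : ∀ t → + 9 * (+ 4 * q - N) - (+ 4 * q - N) * card (ball (t ℕ.* 4)) ≤ + 2 * outer t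
          step t with + 9 ℤ.≤? card (ball (t ℕ.* 4)) | doubling t | odd t
          ... | yes 9≤ | _ | _ = 0≤⇒≤ _ (0≤+ (0≤* (≤⇒0≤ N≤4q) (≤⇒0≤ 9≤)) (0≤* (0≤+ℕ 2) (outer≥0 t))) (lem₁ q N (card (ball (t ℕ.* 4))) (outer t))
            where
            lem₁ : ∀ q n m o → (+ 4 * q - n) * (m - + 9) + + 2 * o ≡ + 2 * o - (+ 9 * (+ 4 * q - n) - (+ 4 * q - n) * m)
            lem₁ = solve-∀
          ... | no 9≰ | inj₁ full | _ = ⊥-elim (9≰ (subst (+ 9 ≤_) (sym full) (+≤+ (ℕ.m≤m+n 9 2))))
          ... | no 9≰ | inj₂ h | x , hx = go x hx
            where
            n = card (ball t)
            m = card (ball (t ℕ.* 4))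
            n≤4 : + 2 * n ≤ + 9
            n≤4 = 0≤⇒≤ _ (0≤+ (≤⇒0≤ h) (≤⇒0≤ (≰⇒1+≤ 9≰))) (arith n m)
              where
              arith : ∀ n m → ((m + 1ℤ) - + 2 * n) + (+ 9 - (1ℤ + m)) ≡ + 9 - + 2 * n
              arith = solve-∀
            n≥1 : 1ℤ ≤ n
            n≥1 = card≥1 0# (0∈ball t)
            go : ∀ x → n ≡ 1ℤ + + 2 * x → + 9 * (+ 4 * q - N) - (+ 4 * q - N) * m ≤ + 2 * outer t
            go (+ 0) e = 0≤⇒≤ _ (0≤+ (0≤* (0≤+ℕ 2) (≤⇒0≤ (outer≥ t))) (0≤+ (0≤* (≤⇒0≤ N≤4q) (≤⇒0≤ h)) (0≤* (0≤+ℕ 4) (≤⇒0≤ 3q≤N))))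
                          (trans (cong (λ n → + 2 * (outer t - ((+ 11 * q - + 2 * N) - q * n)) + ((+ 4 * q - N) * ((m + 1ℤ) - + 2 * n) + + 4 * (N - + 3 * q))) e) (arith q N (outer t) m))
              where
              arith : ∀ q n o m → + 2 * (o - ((+ 11 * q - + 2 * n) - q * 1ℤ)) + ((+ 4 * q - n) * ((m + 1ℤ) - + 2 * 1ℤ) + + 4 * (n - + 3 * q)) ≡ + 2 * o - (+ 9 * (+ 4 * q - n) - (+ 4 * q - n) * m)
              arith = solve-∀
            go (+ 1) e = 0≤⇒≤ _ (0≤+ (0≤* (0≤+ℕ 2) (≤⇒0≤ (outer≥ t))) (0≤* (≤⇒0≤ N≤4q) (≤⇒0≤ h)))
                          (trans (cong (λ n → + 2 * (outer t - ((+ 11 * q - + 2 * N) - q * n)) + (+ 4 * q - N) * ((m + 1ℤ) - + 2 * n)) e) (arith q N (outer t) m))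
              where
              arith : ∀ q n o m → + 2 * (o - ((+ 11 * q - + 2 * n) - q * + 3)) + (+ 4 * q - n) * ((m + 1ℤ) - + 2 * + 3) ≡ + 2 * o - (+ 9 * (+ 4 * q - n) - (+ 4 * q - n) * m)
              arith = solve-∀
            go +[1+ suc x ] e = ⊥-elim (absurd (subst (λ n → + 2 * n ≤ + 9) (trans e (arith (+ x))) n≤4))
              where
              arith : ∀ x → 1ℤ + + 2 * (+ 2 + x) ≡ + 5 + + 2 * x
              arith = solve-∀
              absurd : ¬ (+ 2 * (+ 5 + + 2 * + x) ≤ + 9)
              absurd k = 0≰-1 (0≤+ (≤⇒0≤ k) (0≤* (0≤+ℕ 4) (0≤+ℕ x))) (arith′ (+ x))
                where
                arith′ : ∀ x → (+ 9 - + 2 * (+ 5 + + 2 * x)) + + 4 * x ≡ - 1ℤ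
                arith′ = solve-∀
            go -[1+ x ] e = ⊥-elim (0≰-1 (0≤+ (≤⇒0≤ (subst (1ℤ ≤_) e n≥1)) (0≤+ (0≤* (0≤+ℕ 2) (0≤+ℕ x)) (0≤+ℕ 1))) (arith (+ x)))
              where
              arith : ∀ x → ((1ℤ + + 2 * (- (1ℤ + x))) - 1ℤ) + (+ 2 * x + 1ℤ) ≡ - 1ℤ
              arith = solve-∀

-- Vectors over the prime field and linear functionals

module PrimeFieldVectors where

  open import Defs
  open import Data.Integer using (ℤ; +_; _+_; _*_; 1ℤ)
  open FiniteSums
  open SumsetTheory

  module Field (p : ℕ) .{{_ : NonZero p}} where

    F : Set
    F = 𝔽 p

    infixl 6 _⊞_
    _⊞_ : F → F → F
    _⊞_ = _+𝔽_ p

    infixl 7 _⊠_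
    _⊠_ : F → F → F
    _⊠_ = _*𝔽_ p

    ι : ℕ → F
    ι k = k mod p

    toℕ-ι : ∀ k → toℕ (ι k) ≡ k % p
    toℕ-ι k = Fin.toℕ-fromℕ< (m%n<n k p)

    ι-≡ : ∀ {j k} → j % p ≡ k % p → ι j ≡ ι k
    ι-≡ {j} {k} e = Fin.toℕ-injective (trans (toℕ-ι j) (trans e (sym (toℕ-ι k))))

    ι-toℕ : ∀ a → ι (toℕ a) ≡ a
    ι-toℕ a = Fin.toℕ-injective (trans (toℕ-ι (toℕ a)) (m<n⇒m%n≡m (Fin.toℕ<n a)))

    ι-+ : ∀ j k → ι j ⊞ ι k ≡ ι (j ℕ.+ k)
    ι-+ j k = ι-≡ (trans (cong₂ (λ x y → (x ℕ.+ y) % p) (toℕ-ι j) (toℕ-ι k)) (sym (%-distribˡ-+ j k p)))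

    ι-* : ∀ j k → ι j ⊠ ι k ≡ ι (j ℕ.* k)
    ι-* j k = ι-≡ (trans (cong₂ (λ x y → (x ℕ.* y) % p) (toℕ-ι j) (toℕ-ι k)) (sym (%-distribˡ-* j k p)))

    ι-p* : ∀ k → ι (p ℕ.* k) ≡ ι 0
    ι-p* k = ι-≡ (trans (cong (_% p) (ℕ.*-comm p k)) (trans (m*n%n≡0 k p) (sym (m*n%n≡0 0 p))))

    ⊞-assoc : ∀ a b c → (a ⊞ b) ⊞ c ≡ a ⊞ (b ⊞ c)
    ⊞-assoc a b c = trans (cong (λ z → (a ⊞ b) ⊞ z) (sym (ι-toℕ c))) (trans (ι-+ (toℕ a ℕ.+ toℕ b) (toℕ c))
      (trans (cong ι (ℕ.+-assoc (toℕ a) (toℕ b) (toℕ c))) (trans (sym (ι-+ (toℕ a) (toℕ b ℕ.+ toℕ c))) (cong (_⊞ (b ⊞ c)) (ι-toℕ a)))))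

    ⊞-comm : ∀ a b → a ⊞ b ≡ b ⊞ a
    ⊞-comm a b = cong ι (ℕ.+-comm (toℕ a) (toℕ b))

    ⊠-comm : ∀ a b → a ⊠ b ≡ b ⊠ a
    ⊠-comm a b = cong ι (ℕ.*-comm (toℕ a) (toℕ b))

    ⊞-identityˡ : ∀ a → ι 0 ⊞ a ≡ a
    ⊞-identityˡ a = trans (cong (ι 0 ⊞_) (sym (ι-toℕ a))) (trans (ι-+ 0 (toℕ a)) (ι-toℕ a))

    ⊞-identityʳ : ∀ a → a ⊞ ι 0 ≡ a
    ⊞-identityʳ a = trans (⊞-comm a (ι 0)) (⊞-identityˡ a)

    neg : F → F
    neg a = ι (p ℕ.∸ toℕ a)

    ⊞-inverseʳ : ∀ a → a ⊞ neg a ≡ ι 0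
    ⊞-inverseʳ a = trans (cong (_⊞ neg a) (sym (ι-toℕ a))) (trans (ι-+ (toℕ a) (p ℕ.∸ toℕ a))
      (trans (cong ι (trans (ℕ.m+[n∸m]≡n (ℕ.<⇒≤ (Fin.toℕ<n a))) (sym (ℕ.*-identityʳ p)))) (ι-p* 1)))

    ⊞-inverseˡ : ∀ a → neg a ⊞ a ≡ ι 0
    ⊞-inverseˡ a = trans (⊞-comm (neg a) a) (⊞-inverseʳ a)

    ⊠-distribˡ : ∀ a b c → a ⊠ (b ⊞ c) ≡ a ⊠ b ⊞ a ⊠ c
    ⊠-distribˡ a b c = trans (cong (_⊠ (b ⊞ c)) (sym (ι-toℕ a))) (trans (ι-* (toℕ a) (toℕ b ℕ.+ toℕ c))
      (trans (cong ι (ℕ.*-distribˡ-+ (toℕ a) (toℕ b) (toℕ c))) (sym (ι-+ (toℕ a ℕ.* toℕ b) (toℕ a ℕ.* toℕ c)))))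

    ⊠-zeroˡ : ∀ a → ι 0 ⊠ a ≡ ι 0
    ⊠-zeroˡ a = trans (cong (ι 0 ⊠_) (sym (ι-toℕ a))) (ι-* 0 (toℕ a))

    ⊠-ι : ∀ k a → ι k ⊠ a ≡ ι (k ℕ.* toℕ a)
    ⊠-ι k a = trans (cong (ι k ⊠_) (sym (ι-toℕ a))) (ι-* k (toℕ a))

    fieldAbelian : IsAbelianGroup _≡_ _⊞_ (ι 0) neg
    fieldAbelian = record
      { isGroup = record
        { isMonoid = record
          { isSemigroup = record
            { isMagma = record { isEquivalence = isEquivalence ; ∙-cong = cong₂ _⊞_ }
            ; assoc = ⊞-assoc }
          ; identity = ⊞-identityˡ , ⊞-identityʳ }
        ; inverse = ⊞-inverseˡ , ⊞-inverseʳ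
        ; ⁻¹-cong = cong neg }
      ; comm = ⊞-comm }

    fieldAbelianGroup : AbelianGroup _ _
    fieldAbelianGroup = record { isAbelianGroup = fieldAbelian }

    module FM = Algebra.Properties.Monoid.Mult (AbelianGroup.monoid fieldAbelianGroup)

    ×-ι : ∀ n a → n FM.× a ≡ ι (n ℕ.* toℕ a)
    ×-ι ℕ.zero a = refl
    ×-ι (suc n) a = trans (cong (a ⊞_) (×-ι n a)) (trans (cong (_⊞ ι (n ℕ.* toℕ a)) (sym (ι-toℕ a))) (ι-+ (toℕ a) (n ℕ.* toℕ a)))

    fieldGroup : ElementaryAbelian p F
    fieldGroup = record
      { finite = finFinite p
      ; isAbelianGroup = fieldAbelian
      ; torsion = λ a → trans (×-ι p a) (ι-p* (toℕ a)) }

    module 𝔾 = Elementary fieldGroup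

    infixl 6 _⊞ⱽ_
    _⊞ⱽ_ : ∀ {n} → Vecp p n → Vecp p n → Vecp p n
    _⊞ⱽ_ = _⊕_ p

    vecAbelian : ∀ n → IsAbelianGroup _≡_ (_⊞ⱽ_ {n}) (zeroV p n) (Vec.map neg)
    vecAbelian n = record
      { isGroup = record
        { isMonoid = record
          { isSemigroup = record
            { isMagma = record { isEquivalence = isEquivalence ; ∙-cong = cong₂ _⊞ⱽ_ }
            ; assoc = Vec.zipWith-assoc ⊞-assoc }
          ; identity = Vec.zipWith-identityˡ ⊞-identityˡ , Vec.zipWith-identityʳ ⊞-identityʳ }
        ; inverse = Vec.zipWith-inverseˡ ⊞-inverseˡ , Vec.zipWith-inverseʳ ⊞-inverseʳ
        ; ⁻¹-cong = cong (Vec.map neg) }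
      ; comm = Vec.zipWith-comm ⊞-comm }

    vecAbelianGroup : ℕ → AbelianGroup _ _
    vecAbelianGroup n = record { isAbelianGroup = vecAbelian n }

    module VM n = Algebra.Properties.Monoid.Mult (AbelianGroup.monoid (vecAbelianGroup n))

    ×-∷ : ∀ {n} k a (v : Vecp p n) → VM._×_ (suc n) k (a ∷ v) ≡ (k FM.× a) ∷ VM._×_ n k v
    ×-∷ ℕ.zero a v = refl
    ×-∷ (suc k) a v = cong ((a ∷ v) ⊞ⱽ_) (×-∷ k a v)

    ×-ℕ· : ∀ {n} k (v : Vecp p n) → VM._×_ n k v ≡ _ℕ·_ p k v
    ×-ℕ· ℕ.zero [] = refl
    ×-ℕ· (suc k) [] = cong ([] ⊞ⱽ_) (×-ℕ· k [])
    ×-ℕ· k (a ∷ v) = trans (×-∷ k a v) (cong₂ _∷_ (×-ι k a) (×-ℕ· k v))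

    ℕ·-torsion : ∀ {n} (v : Vecp p n) → _ℕ·_ p p v ≡ zeroV p n
    ℕ·-torsion [] = refl
    ℕ·-torsion (a ∷ v) = cong₂ _∷_ (ι-p* (toℕ a)) (ℕ·-torsion v)

    _≟ⱽ_ : ∀ {n} (u v : Vecp p n) → Dec (u ≡ v)
    _≟ⱽ_ = Vec.≡-dec Fin._≟_

    ∑-allVecs-suc : ∀ n (f : Vecp p (suc n) → ℤ) → ∑ (allVecs p (suc n)) f ≡ ∑ (allFin p) (λ a → ∑ (allVecs p n) (λ v → f (a ∷ v)))
    ∑-allVecs-suc n f = trans (∑-concatMap (λ x → List.map (x ∷_) (allVecs p n)) (allFin p) f) (∑-cong (allFin p) (λ a → ∑-map (a ∷_) (allVecs p n) f))

    vecFinite : ∀ n → Finite (Vecp p n)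
    vecFinite n = record { elems = allVecs p n ; _≟_ = _≟ⱽ_ ; once = once n }
      where
      once : ∀ n (v : Vecp p n) → ∑ (allVecs p n) (λ u → ⟦ does (u ≟ⱽ v) ⟧) ≡ 1ℤ
      once ℕ.zero [] = refl
      once (suc n) (b ∷ v) = trans (∑-allVecs-suc n (λ u → ⟦ does (u ≟ⱽ (b ∷ v)) ⟧)) (trans (∑-cong (allFin p) (λ a → ∑-cong (allVecs p n) (λ u → split a u)))
        (trans (∑-∑-* (allFin p) (allVecs p n) (λ a → ⟦ does (a Fin.≟ b) ⟧) (λ u → ⟦ does (u ≟ⱽ v) ⟧)) (cong₂ _*_ (Finite.once (finFinite p) b) (once n v))))
        where
        split : ∀ a u → ⟦ does ((a ∷ u) ≟ⱽ (b ∷ v)) ⟧ ≡ ⟦ does (a Fin.≟ b) ⟧ * ⟦ does (u ≟ⱽ v) ⟧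
        split a u with a Fin.≟ b | u ≟ⱽ v
        ... | yes _ | yes _ = refl
        ... | yes _ | no _ = refl
        ... | no _ | yes _ = refl
        ... | no _ | no _ = refl

    vecGroup : ∀ n → ElementaryAbelian p (Vecp p n)
    vecGroup n = record
      { finite = vecFinite n
      ; isAbelianGroup = vecAbelian n
      ; torsion = λ v → trans (×-ℕ· p v) (ℕ·-torsion v) }

    module 𝕍 {n} = Elementary (vecGroup n)

    vec-size : ∀ n → 𝕍.size {n} ≡ + (p ^ n)
    vec-size ℕ.zero = refl
    vec-size (suc n) = trans (∑-allVecs-suc n (λ _ → 1ℤ)) (trans (∑-cong (allFin p) (λ _ → vec-size n))
      (trans (∑-const (allFin p) (+ (p ^ n))) (trans (cong (_* + (p ^ n)) (size-Fin p)) (sym (ℤ.pos-* p (p ^ n))))))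

    infix 7 _∙_
    _∙_ : ∀ {n} → Vecp p n → Vecp p n → F
    [] ∙ [] = ι 0
    (a ∷ u) ∙ (b ∷ v) = a ⊠ b ⊞ u ∙ v

    ∙-comm : ∀ {n} (u v : Vecp p n) → u ∙ v ≡ v ∙ u
    ∙-comm [] [] = refl
    ∙-comm (a ∷ u) (b ∷ v) = cong₂ _⊞_ (⊠-comm a b) (∙-comm u v)

    ∙-⊞ : ∀ {n} (u v w : Vecp p n) → u ∙ (v ⊞ⱽ w) ≡ u ∙ v ⊞ u ∙ w
    ∙-⊞ [] [] [] = sym (⊞-identityˡ (ι 0))
    ∙-⊞ (a ∷ u) (b ∷ v) (c ∷ w) = trans (cong₂ _⊞_ (⊠-distribˡ a b c) (∙-⊞ u v w)) (𝔾.CP.interchange (a ⊠ b) (a ⊠ c) (u ∙ v) (u ∙ w))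

    0∙ : ∀ {n} (v : Vecp p n) → zeroV p n ∙ v ≡ ι 0
    0∙ [] = refl
    0∙ (a ∷ v) = trans (cong₂ _⊞_ (⊠-zeroˡ a) (0∙ v)) (⊞-identityˡ (ι 0))

    ∙0 : ∀ {n} (v : Vecp p n) → v ∙ zeroV p n ≡ ι 0
    ∙0 v = trans (∙-comm v _) (0∙ v)

    ∙-⋆ : ∀ {n} (u : Vecp p n) k v → u ∙ (k 𝕍.⋆ v) ≡ k 𝔾.⋆ (u ∙ v)
    ∙-⋆ u ℕ.zero v = ∙0 u
    ∙-⋆ u (suc k) v = trans (∙-⊞ u v (k 𝕍.⋆ v)) (cong (u ∙ v ⊞_) (∙-⋆ u k v))

    ∙-⊝ : ∀ {n} (u v w : Vecp p n) → u ∙ (v 𝕍.⊝ w) ≡ (u ∙ v) 𝔾.⊝ (u ∙ w)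
    ∙-⊝ u v w = trans (sym (𝔾.add-sub _ (u ∙ w))) (cong (𝔾._⊝ (u ∙ w)) (trans (sym (∙-⊞ u (v 𝕍.⊝ w) w)) (cong (u ∙_) (𝕍.sub-add v w))))

    toℕ⋆1 : ∀ a → toℕ a 𝔾.⋆ ι 1 ≡ a
    toℕ⋆1 a = trans (×-ι (toℕ a) (ι 1)) (trans (sym (⊠-ι (toℕ a) (ι 1)))
      (trans (ι-* (toℕ a) 1) (trans (cong ι (ℕ.*-identityʳ (toℕ a))) (ι-toℕ a))))

    module _ (pr : Prime p) where

      private module 𝔾P = 𝔾.Primal pr

      toℕ>0 : ∀ a → a ≢ ι 0 → 0 ℕ.< toℕ a
      toℕ>0 a a≢0 = ℕ.n≢0⇒n>0 (λ e → a≢0 (trans (sym (ι-toℕ a)) (cong ι e)))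

      -- Invert the first nonzero coordinate and put 0 elsewhere. Multiples of this vector reach
      -- every value of the functional.
      dual : ∀ {n} (v : Vecp p n) → v ≢ zeroV p n → ∃ λ w → v ∙ w ≡ ι 1
      dual [] h = ⊥-elim (h refl)
      dual (a ∷ v) h with a Fin.≟ ι 0
      ... | yes refl with dual v (λ e → h (cong (ι 0 ∷_) e))
      ...   | w , e = ι 0 ∷ w , trans (cong₂ _⊞_ (⊠-zeroˡ (ι 0)) e) (⊞-identityˡ (ι 1))
      dual {suc n} (a ∷ v) h | no a≢0 with 𝔾P.unit (toℕ a) (toℕ>0 a a≢0) (Fin.toℕ<n a)
      ... | b , inverse = ι b ∷ zeroV p n , trans (cong₂ _⊞_ ab≡1 (∙0 v)) (⊞-identityʳ (ι 1))
        where
        ab≡1 : a ⊠ ι b ≡ ι 1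
        ab≡1 = trans (⊠-comm a (ι b)) (trans (⊠-ι b a) (trans (sym (×-ι b a)) (trans (cong (b 𝔾.⋆_) (sym (toℕ⋆1 a))) (inverse (ι 1)))))

      -- Translation by i times the dual vector carries the kernel onto the fibre over i, and p
      -- fibres of equal size partition the space.
      fibre-card : ∀ {n} (v : Vecp p (suc n)) → v ≢ zeroV p (suc n) → ∀ i →
        𝕍.card (λ x → does (v ∙ x Fin.≟ i)) ≡ + (p ^ n)
      fibre-card {n} v v≢0 i = trans (shift i) (*-cancel-≡ (1≤+ℕ (ℕ.>-nonZero⁻¹ p {{prime⇒nonZero pr}})) total)
        where
        w = proj₁ (dual v v≢0)
        ker : Vecp p (suc n) → Bool
        ker x = does (v ∙ x Fin.≟ ι 0)
        shift : ∀ i → 𝕍.card (λ x → does (v ∙ x Fin.≟ i)) ≡ 𝕍.card ker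
        shift i = trans (𝕍.card-cong (λ x → does-⇔ (v ∙ x Fin.≟ i) (v ∙ (x 𝕍.⊝ (toℕ i 𝕍.⋆ w)) Fin.≟ ι 0)
              (λ e → trans (image x) (trans (cong (𝔾._⊝ i) e) (𝔾.inverseʳ i)))
              (λ e → 𝔾.GP.x∙y⁻¹≈ε⇒x≈y _ _ (trans (sym (image x)) e))))
            (𝕍.card-unshift (toℕ i 𝕍.⋆ w) ker)
          where
          image : ∀ x → v ∙ (x 𝕍.⊝ (toℕ i 𝕍.⋆ w)) ≡ (v ∙ x) 𝔾.⊝ i
          image x = trans (∙-⊝ v x _) (cong ((v ∙ x) 𝔾.⊝_) (trans (∙-⋆ v (toℕ i) w) (trans (cong (toℕ i 𝔾.⋆_) (proj₂ (dual v v≢0))) (toℕ⋆1 i))))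
        total : + p * 𝕍.card ker ≡ + p * + (p ^ n)
        total = begin
          + p * 𝕍.card ker                                        ≡⟨ sym (trans (∑-const 𝔾.elems (𝕍.card ker)) (cong (_* 𝕍.card ker) (size-Fin p))) ⟩
          𝔾.sum (λ _ → 𝕍.card ker)                                ≡⟨ ∑-cong 𝔾.elems (λ i → sym (shift i)) ⟩
          𝔾.sum (λ i → 𝕍.sum (λ x → ⟦ does (v ∙ x Fin.≟ i) ⟧))     ≡⟨ ∑-swap 𝔾.elems (𝕍.elems {suc n}) _ ⟩
          𝕍.sum {suc n} (λ x → 𝔾.sum (λ i → ⟦ does (v ∙ x Fin.≟ i) ⟧))     ≡⟨ ∑-cong (𝕍.elems {suc n}) (λ x → trans (∑-cong 𝔾.elems (λ i → cong ⟦_⟧ (does-⇔ (v ∙ x Fin.≟ i) (i Fin.≟ v ∙ x) sym sym))) (𝔾.once (v ∙ x))) ⟩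
          𝕍.size {suc n}                                                  ≡⟨ trans (vec-size (suc n)) (ℤ.pos-* p (p ^ n)) ⟩
          + p * + (p ^ n) ∎
          where open ≡-Reasoning

-- Second and third moments of the slice sizes, summed over all functionals

module FibreStatistics where

  open import Defs
  open import Data.Integer using (ℤ; +_; -_; _+_; _*_; _-_; _≤_; 0ℤ; 1ℤ)
  open FiniteSums
  open SumsetTheory
  open EnergyBound
  open PrimeFieldVectors

  -- κ₁ S - κ₂ W as an affine function of the square sum s and the triple count t of the weights.
  module Linear where
    u : ℤ → ℤ → ℤ → ℤ → ℤ → ℤ
    u κ₁ κ₂ p q n = κ₁ * (+ 2 * (p * q - + 2 * n)) - κ₂ * p

    v : ℤ → ℤ
    v κ₁ = + 4 * κ₁

    w : ℤ → ℤ → ℤ → ℤ → ℤ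
    w κ₁ κ₂ q n = κ₂ * (n * n) - κ₁ * (+ 2 * (q * (n * n)))

    form total : ℤ → ℤ → ℤ → ℤ → ℤ → ℤ → ℤ → ℤ
    form κ₁ κ₂ p q n s t = u κ₁ κ₂ p q n * s + (v κ₁ * t + w κ₁ κ₂ q n)
    total κ₁ κ₂ p q n s t = u κ₁ κ₂ p q n * s + (v κ₁ * t + p * q * w κ₁ κ₂ q n)

    form-≡ : ∀ κ₁ κ₂ p q n s t → κ₁ * (+ 2 * (p * q - + 2 * n) * s - + 2 * (q * (n * n) - + 2 * t)) - κ₂ * (p * s - n * n)
      ≡ form κ₁ κ₂ p q n s t
    form-≡ = expanded
      where
      expanded : ∀ κ₁ κ₂ p q n s t → κ₁ * (+ 2 * (p * q - + 2 * n) * s - + 2 * (q * (n * n) - + 2 * t)) - κ₂ * (p * s - n * n)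
        ≡ (κ₁ * (+ 2 * (p * q - + 2 * n)) - κ₂ * p) * s + (+ 4 * κ₁ * t + (κ₂ * (n * n) - κ₁ * (+ 2 * (q * (n * n)))))
      expanded = solve-∀

    -- The total over all functionals minus the value at the zero functional. Both parts of the
    -- difference contain (p - 1)n, which `averaging` cancels.
    balance : ∀ κ₁ κ₂ p q n → total κ₁ κ₂ p q n (n * n * q + n * (p * q - q)) (n * n * n * q) - form κ₁ κ₂ p q n (n * n) (n * n * n)
      ≡ (p - 1ℤ) * n * (+ 2 * κ₁ * (q * (p * q - + 3 * n))) - (p - 1ℤ) * n * (κ₂ * (p * q - n))
    balance = expanded
      where
      expanded : ∀ κ₁ κ₂ p q n →
        (κ₁ * (+ 2 * (p * q - + 2 * n)) - κ₂ * p) * (n * n * q + n * (p * q - q)) + (+ 4 * κ₁ * (n * n * n * q) + p * q * (κ₂ * (n * n) - κ₁ * (+ 2 * (q * (n * n)))))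
        - ((κ₁ * (+ 2 * (p * q - + 2 * n)) - κ₂ * p) * (n * n) + (+ 4 * κ₁ * (n * n * n) + (κ₂ * (n * n) - κ₁ * (+ 2 * (q * (n * n))))))
        ≡ (p - 1ℤ) * n * (+ 2 * κ₁ * (q * (p * q - + 3 * n))) - (p - 1ℤ) * n * (κ₂ * (p * q - n))
      expanded = solve-∀

  module Fibres (p : ℕ) .{{_ : NonZero p}} (pr : Prime p) (n : ℕ) (A : Vecp p (suc n) → Bool)
    (sum-free : ∀ x y z → A x ≡ true → A y ≡ true → A z ≡ true → z ≢ _⊕_ p x y) where

    open Field p
    module V = Elementary (vecGroup (suc n))

    q N : ℤ
    q = + (p ^ n)
    N = V.card A

    V-size : V.size ≡ + p * q
    V-size = trans (vec-size (suc n)) (ℤ.pos-* p (p ^ n))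

    1≤p : 1ℤ ≤ + p
    1≤p = 1≤+ℕ (ℕ.>-nonZero⁻¹ p {{prime⇒nonZero pr}})

    0≤q : 0ℤ ≤ q
    0≤q = 0≤+ℕ (p ^ n)

    Vᵖ : Set
    Vᵖ = Vecp p (suc n)

    0ⱽ : Vᵖ
    0ⱽ = zeroV p (suc n)

    a : Vᵖ → ℤ
    a x = ⟦ A x ⟧

    on : Vᵖ → F → Vᵖ → Bool
    on ξ i x = does (ξ ∙ x Fin.≟ i)

    fibre : Vᵖ → F → Vᵖ → Bool
    fibre ξ i x = A x ∧ on ξ i x

    c : Vᵖ → F → ℤ
    c ξ i = V.card (fibre ξ i)

    c-sum : ∀ ξ i → c ξ i ≡ V.sum (λ x → a x * ⟦ on ξ i x ⟧)
    c-sum ξ i = ∑-cong V.elems (λ x → ⟦∧⟧ (A x) (on ξ i x))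

    -- `c ξ` is the push-forward of the indicator of A along ξ; this is the change of variables.
    push : ∀ ξ (h : F → ℤ) → 𝔾.sum (λ i → c ξ i * h i) ≡ V.sum (λ x → a x * h (ξ ∙ x))
    push ξ h = begin
      𝔾.sum (λ i → c ξ i * h i)                                      ≡⟨ ∑-cong 𝔾.elems (λ i → trans (cong (_* h i) (c-sum ξ i)) (sym (∑-*ʳ V.elems (h i) _))) ⟩
      𝔾.sum (λ i → V.sum (λ x → a x * ⟦ on ξ i x ⟧ * h i))            ≡⟨ ∑-swap 𝔾.elems V.elems _ ⟩
      V.sum (λ x → 𝔾.sum (λ i → a x * ⟦ on ξ i x ⟧ * h i))            ≡⟨ ∑-cong V.elems (λ x → trans (∑-cong 𝔾.elems (λ i → arrange x i)) (trans (∑-*ˡ 𝔾.elems (a x) _) (cong (a x *_) (𝔾.pick (ξ ∙ x) h)))) ⟩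
      V.sum (λ x → a x * h (ξ ∙ x))                                  ∎
      where
      open ≡-Reasoning
      arrange : ∀ x i → a x * ⟦ on ξ i x ⟧ * h i ≡ a x * (⟦ does (i Fin.≟ ξ ∙ x) ⟧ * h i)
      arrange x i = trans (ℤ.*-assoc (a x) _ (h i)) (cong (λ b → a x * (⟦ b ⟧ * h i)) (does-⇔ (ξ ∙ x Fin.≟ i) (i Fin.≟ ξ ∙ x) sym sym))

    c-total : ∀ ξ → 𝔾.sum (c ξ) ≡ N
    c-total ξ = trans (∑-cong 𝔾.elems (λ i → sym (ℤ.*-identityʳ (c ξ i)))) (trans (push ξ (λ _ → 1ℤ)) (∑-cong V.elems (λ x → ℤ.*-identityʳ (a x))))

    module E ξ = Energy fieldGroup (size-Fin p) (c ξ) q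

    EN≡N : ∀ ξ → E.N ξ ≡ N
    EN≡N = c-total

    -- Here the vectors are fixed and the functional varies: the functionals that agree on u and v
    -- form the hyperplane orthogonal to u - v, or the whole space if u = v.
    agree : Vᵖ → Vᵖ → ℤ
    agree u v = V.sum (λ ξ → ⟦ does (ξ ∙ u Fin.≟ ξ ∙ v) ⟧)

    agree-same : ∀ u → agree u u ≡ + p * q
    agree-same u = trans (∑-cong V.elems (λ ξ → cong ⟦_⟧ (does-yes (ξ ∙ u Fin.≟ ξ ∙ u) refl))) V-size

    agree-diff : ∀ u v → u ≢ v → agree u v ≡ q
    agree-diff u v u≢v = trans (∑-cong V.elems (λ ξ → cong ⟦_⟧ (does-⇔ (ξ ∙ u Fin.≟ ξ ∙ v) (((u V.⊝ v) ∙ ξ) Fin.≟ ι 0)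
        (λ e → trans (eq ξ) (trans (cong (𝔾._⊝ (ξ ∙ v)) e) (𝔾.inverseʳ (ξ ∙ v))))
        (λ e → 𝔾.GP.x∙y⁻¹≈ε⇒x≈y _ _ (trans (sym (eq ξ)) e)))))
      (fibre-card pr (u V.⊝ v) (λ e → u≢v (V.GP.x∙y⁻¹≈ε⇒x≈y u v e)) (ι 0))
      where
      eq : ∀ ξ → (u V.⊝ v) ∙ ξ ≡ (ξ ∙ u) 𝔾.⊝ (ξ ∙ v)
      eq ξ = trans (∙-comm (u V.⊝ v) ξ) (∙-⊝ ξ u v)

    sq-expand : ∀ ξ → E.sq ξ ≡ V.sum (λ x → V.sum (λ y → a x * (a y * ⟦ does (ξ ∙ y Fin.≟ ξ ∙ x) ⟧)))
    sq-expand ξ = trans (push ξ (c ξ)) (∑-cong V.elems (λ x → trans (cong (a x *_) (c-sum ξ (ξ ∙ x))) (sym (∑-*ˡ V.elems (a x) _))))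

    triples-expand : ∀ ξ → E.triples ξ ≡
      V.sum (λ x → V.sum (λ y → V.sum (λ z → a x * (a y * (a z * ⟦ does (ξ ∙ z Fin.≟ ξ ∙ y ⊞ ξ ∙ x) ⟧)))))
    triples-expand ξ = trans (push ξ (E.corr ξ)) (∑-cong V.elems (λ x → trans (cong (a x *_) (trans (push ξ (λ j → c ξ (j ⊞ ξ ∙ x)))
        (∑-cong V.elems (λ y → trans (cong (a y *_) (c-sum ξ _)) (sym (∑-*ˡ V.elems (a y) _))))))
      (trans (sym (∑-*ˡ V.elems (a x) _)) (∑-cong V.elems (λ y → sym (∑-*ˡ V.elems (a x) _))))))

    a² : ∀ x → a x * a x ≡ a x
    a² x with A x
    ... | true = refl
    ... | false = refl

    -- Each pair in A × A is counted by q functionals, and each of the N diagonal pairs by pq - q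
    -- more.
    sq-total : V.sum E.sq ≡ N * N * q + N * (+ p * q - q)
    sq-total = begin
      V.sum E.sq
        ≡⟨ trans (∑-cong V.elems sq-expand) (trans (∑-swap V.elems V.elems _) (∑-cong V.elems (λ x → ∑-swap V.elems V.elems _))) ⟩
      V.sum (λ x → V.sum (λ y → V.sum (λ ξ → a x * (a y * ⟦ does (ξ ∙ y Fin.≟ ξ ∙ x) ⟧))))
        ≡⟨ ∑-cong V.elems (λ x → ∑-cong V.elems (λ y → trans (∑-*ˡ V.elems (a x) _) (cong (a x *_) (∑-*ˡ V.elems (a y) _)))) ⟩
      V.sum (λ x → V.sum (λ y → a x * (a y * agree y x)))
        ≡⟨ ∑-cong V.elems (λ x → trans (∑-cong V.elems (λ y → split x y)) (trans (∑-+ V.elems _ _) (cong₂ _+_ (∑-*ˡ V.elems (a x * q) a) (V.pick x (λ y → a x * a y * (+ p * q - q)))))) ⟩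
      V.sum (λ x → a x * q * N + a x * a x * (+ p * q - q))
        ≡⟨ trans (∑-+ V.elems _ _) (cong₂ _+_ (trans (∑-cong V.elems (λ x → ℤ.*-assoc (a x) q N)) (∑-*ʳ V.elems (q * N) a))
             (trans (∑-cong V.elems (λ x → cong (_* (+ p * q - q)) (a² x))) (∑-*ʳ V.elems (+ p * q - q) a))) ⟩
      N * (q * N) + N * (+ p * q - q)
        ≡⟨ cong (_+ N * (+ p * q - q)) (arrange N q) ⟩
      N * N * q + N * (+ p * q - q) ∎
      where
      open ≡-Reasoning
      arrange : ∀ n q → n * (q * n) ≡ n * n * q
      arrange = solve-∀
      split : ∀ x y → a x * (a y * agree y x) ≡ a x * q * a y + ⟦ does (y V.≟ x) ⟧ * (a x * a y * (+ p * q - q))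
      split x y with y V.≟ x
      ... | yes refl = trans (cong (λ s → a x * (a x * s)) (agree-same x)) (lem (a x) (+ p * q) q)
        where
        lem : ∀ a s q → a * (a * s) ≡ a * q * a + 1ℤ * (a * a * (s - q))
        lem = solve-∀
      ... | no y≢x = trans (cong (λ s → a x * (a y * s)) (agree-diff y x y≢x)) (lem (a x) (a y) (+ p * q) q)
        where
        lem : ∀ a b s q → a * (b * q) ≡ a * q * b + 0ℤ * (a * b * (s - q))
        lem = solve-∀

    -- Sum-freeness enters the averaging here: z never equals y + x, so each of the N³ triples is
    -- counted by exactly q functionals.
    triples-total : V.sum E.triples ≡ N * N * N * q
    triples-total = begin
      V.sum E.triples
        ≡⟨ trans (∑-cong V.elems triples-expand) (trans (∑-swap V.elems V.elems _) (∑-cong V.elems (λ x → trans (∑-swap V.elems V.elems _) (∑-cong V.elems (λ y → ∑-swap V.elems V.elems _))))) ⟩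
      V.sum (λ x → V.sum (λ y → V.sum (λ z → V.sum (λ ξ → a x * (a y * (a z * ⟦ does (ξ ∙ z Fin.≟ ξ ∙ y ⊞ ξ ∙ x) ⟧))))))
        ≡⟨ ∑-cong V.elems (λ x → ∑-cong V.elems (λ y → ∑-cong V.elems (λ z → value x y z))) ⟩
      V.sum (λ x → V.sum (λ y → V.sum (λ z → a x * (a y * (a z * q)))))
        ≡⟨ ∑-cong V.elems (λ x → ∑-cong V.elems (λ y → trans (∑-*ˡ V.elems (a x) _) (cong (a x *_) (trans (∑-*ˡ V.elems (a y) _) (cong (a y *_) (∑-*ʳ V.elems q a)))))) ⟩
      V.sum (λ x → V.sum (λ y → a x * (a y * (N * q))))
        ≡⟨ ∑-cong V.elems (λ x → trans (∑-*ˡ V.elems (a x) _) (cong (a x *_) (∑-*ʳ V.elems (N * q) a))) ⟩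
      V.sum (λ x → a x * (N * (N * q)))
        ≡⟨ ∑-*ʳ V.elems (N * (N * q)) a ⟩
      N * (N * (N * q))
        ≡⟨ arrange N q ⟩
      N * N * N * q ∎
      where
      open ≡-Reasoning
      arrange : ∀ n q → n * (n * (n * q)) ≡ n * n * n * q
      arrange = solve-∀
      vanish : ∀ {x y z} s → A x ∧ (A y ∧ A z) ≡ false → a x * (a y * (a z * s)) ≡ 0ℤ
      vanish {x} {y} {z} s e = trans (lem (a x) (a y) (a z) s) (trans (cong (_* s) (trans (cong (a x *_) (sym (⟦∧⟧ (A y) (A z)))) (trans (sym (⟦∧⟧ (A x) (A y ∧ A z))) (cong ⟦_⟧ e)))) (ℤ.*-zeroˡ s))
        where
        lem : ∀ a b c s → a * (b * (c * s)) ≡ a * (b * c) * s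
        lem = solve-∀
      value : ∀ x y z → V.sum (λ ξ → a x * (a y * (a z * ⟦ does (ξ ∙ z Fin.≟ ξ ∙ y ⊞ ξ ∙ x) ⟧))) ≡ a x * (a y * (a z * q))
      value x y z with A x ∧ (A y ∧ A z) in eq
      ... | false = trans (∑-cong V.elems (λ ξ → vanish {x} {y} {z} _ eq)) (trans (∑-zero V.elems) (sym (vanish {x} {y} {z} q eq)))
      ... | true = trans (∑-*ˡ V.elems (a x) _) (cong (a x *_) (trans (∑-*ˡ V.elems (a y) _) (cong (a y *_) (trans (∑-*ˡ V.elems (a z) _) (cong (a z *_)
            (trans (∑-cong V.elems (λ ξ → cong (λ t → ⟦ does (ξ ∙ z Fin.≟ t) ⟧) (sym (∙-⊞ ξ y x)))) (agree-diff z (y ⊞ⱽ x) z≢)))))))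
        where
        z≢ : z ≢ y ⊞ⱽ x
        z≢ = sum-free y x z (∧-elimˡ (∧-elimʳ {A x} eq)) (∧-elimˡ eq) (∧-elimʳ {A y} (∧-elimʳ {A x} eq))

    sq-0 : E.sq 0ⱽ ≡ N * N
    sq-0 = trans (sq-expand 0ⱽ) (trans (∑-cong V.elems (λ x → ∑-cong V.elems (λ y → cong (a x *_) (trans (cong (λ b → a y * ⟦ b ⟧) (does-yes (_ Fin.≟ _) (trans (0∙ y) (sym (0∙ x))))) (ℤ.*-identityʳ (a y))))))
      (∑-∑-* V.elems V.elems a a))

    triples-0 : E.triples 0ⱽ ≡ N * N * N
    triples-0 = trans (triples-expand 0ⱽ) (trans (∑-cong V.elems (λ x → ∑-cong V.elems (λ y → trans (∑-cong V.elems (λ z →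
        trans (cong (λ b → a x * (a y * (a z * ⟦ b ⟧))) (does-yes (_ Fin.≟ _) (zero-sum x y z))) (arrange (a x) (a y) (a z)))) (∑-*ˡ V.elems (a x * a y) a))))
      (trans (∑-cong V.elems (λ x → trans (∑-cong V.elems (λ y → arrange′ (a x) (a y) N)) (∑-*ˡ V.elems (a x * N) a))) (trans (∑-cong V.elems (λ x → ℤ.*-assoc (a x) N N)) (trans (∑-*ʳ V.elems (N * N) a) (sym (ℤ.*-assoc N N N))))))
      where
      zero-sum : ∀ x y z → 0ⱽ ∙ z ≡ 0ⱽ ∙ y ⊞ 0ⱽ ∙ x
      zero-sum x y z = trans (0∙ z) (sym (trans (cong₂ _⊞_ (0∙ y) (0∙ x)) (⊞-identityˡ (ι 0))))
      arrange : ∀ x y z → x * (y * (z * 1ℤ)) ≡ x * y * z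
      arrange = solve-∀
      arrange′ : ∀ x y n → x * y * n ≡ x * n * y
      arrange′ = solve-∀

    -- The terms κ₁S - κ₂W at ξ ≠ 0 are nonnegative, so their sum over all ξ is at least the term at
    -- ξ = 0. Both sides are known exactly from the moments.
    averaging : ∀ κ₁ κ₂ → + 2 ≤ + p → 1ℤ ≤ N → (∀ ξ → ξ ≢ 0ⱽ → κ₂ * E.W ξ ≤ κ₁ * E.S ξ) →
      κ₂ * (+ p * q - N) ≤ + 2 * κ₁ * (q * (+ p * q - + 3 * N))
    averaging κ₁ κ₂ 2≤p 1≤N bound = *-cancel-≤ {(+ p - 1ℤ) * N} {κ₂ * (+ p * q - N)} {+ 2 * κ₁ * (q * (+ p * q - + 3 * N))} (0≤⇒≤ _ (0≤+ (0≤* (≤⇒0≤ 2≤p) (0≤+ (≤⇒0≤ 1≤N) (0≤+ℕ 1))) (≤⇒0≤ 1≤N)) (unit-lem (+ p) N)) (0≤⇒≤ _ (≤⇒0≤ main) final)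
      where
      unit-lem : ∀ p n → (p - + 2) * (n - 1ℤ + 1ℤ) + (n - 1ℤ) ≡ (p - 1ℤ) * n - 1ℤ
      unit-lem = solve-∀
      h : ℤ → ℤ → ℤ
      h s t = Linear.form κ₁ κ₂ (+ p) q N s t
      h≡ : ∀ ξ → κ₁ * E.S ξ - κ₂ * E.W ξ ≡ h (E.sq ξ) (E.triples ξ)
      h≡ ξ = trans (cong (λ s → κ₁ * s - κ₂ * E.W ξ) (E.S≡ ξ)) (trans (cong (λ n → κ₁ * (+ 2 * (+ p * q - + 2 * n) * E.sq ξ - + 2 * (q * (n * n) - + 2 * E.triples ξ)) - κ₂ * (+ p * E.sq ξ - n * n)) (EN≡N ξ))
        (Linear.form-≡ κ₁ κ₂ (+ p) q N (E.sq ξ) (E.triples ξ)))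
      main : h (E.sq 0ⱽ) (E.triples 0ⱽ) ≤ V.sum (λ ξ → h (E.sq ξ) (E.triples ξ))
      main = V.term≤sum 0ⱽ {λ ξ → h (E.sq ξ) (E.triples ξ)} (λ ξ ξ≢0 → subst (0ℤ ≤_) (h≡ ξ) (≤⇒0≤ (bound ξ ξ≢0)))
      h-total : V.sum (λ ξ → h (E.sq ξ) (E.triples ξ)) ≡ Linear.total κ₁ κ₂ (+ p) q N (N * N * q + N * (+ p * q - q)) (N * N * N * q)
      h-total = trans (∑-+ V.elems (λ ξ → Linear.u κ₁ κ₂ (+ p) q N * E.sq ξ) (λ ξ → Linear.v κ₁ * E.triples ξ + Linear.w κ₁ κ₂ q N))
        (cong₂ _+_ (trans (∑-*ˡ V.elems (Linear.u κ₁ κ₂ (+ p) q N) E.sq) (cong (Linear.u κ₁ κ₂ (+ p) q N *_) sq-total))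
        (trans (∑-+ V.elems (λ ξ → Linear.v κ₁ * E.triples ξ) (λ _ → Linear.w κ₁ κ₂ q N)) (cong₂ _+_ (trans (∑-*ˡ V.elems (Linear.v κ₁) E.triples) (cong (Linear.v κ₁ *_) triples-total)) (trans (∑-const V.elems (Linear.w κ₁ κ₂ q N)) (cong (_* Linear.w κ₁ κ₂ q N) V-size)))))
      final : V.sum (λ ξ → h (E.sq ξ) (E.triples ξ)) - h (E.sq 0ⱽ) (E.triples 0ⱽ) ≡ (+ p - 1ℤ) * N * (+ 2 * κ₁ * (q * (+ p * q - + 3 * N))) - (+ p - 1ℤ) * N * (κ₂ * (+ p * q - N))
      final = trans (cong₂ _-_ h-total (cong₂ h sq-0 triples-0)) (Linear.balance κ₁ κ₂ (+ p) q N)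

-- Existence of a slice that fills more than half of its hyperplane

module HeavyFibres where

  open import Defs
  open import Data.Integer using (ℤ; +_; -_; _+_; _*_; _-_; _≤_; 0ℤ; 1ℤ; +≤+)
  open FiniteSums
  open SumsetTheory
  open EnergyBound
  open PrimeFieldVectors
  open FibreStatistics

  -- The nonzero residues pair off as k and -k, represented by 1, ..., 5; only 0 is left alone.
  odd-11 : ∀ {p} .{{_ : NonZero p}} → p ≡ 11 → (C : Fin p → Bool) → C (Field.ι p 0) ≡ true → (∀ k → C (Field.neg p k) ≡ C k) →
    ∃ λ x → Finite.card (finFinite p) C ≡ 1ℤ + + 2 * x
  odd-11 refl C C0 symm = ⟦ C 1F ⟧ + ⟦ C 2F ⟧ + ⟦ C 3F ⟧ + ⟦ C 4F ⟧ + ⟦ C 5F ⟧ , trans eq (lem ⟦ C 1F ⟧ ⟦ C 2F ⟧ ⟦ C 3F ⟧ ⟦ C 4F ⟧ ⟦ C 5F ⟧)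
    where
    eq : Finite.card (finFinite 11) C ≡ 1ℤ + (⟦ C 1F ⟧ + (⟦ C 2F ⟧ + (⟦ C 3F ⟧ + (⟦ C 4F ⟧ + (⟦ C 5F ⟧ + (⟦ C 5F ⟧ + (⟦ C 4F ⟧ + (⟦ C 3F ⟧ + (⟦ C 2F ⟧ + (⟦ C 1F ⟧ + 0ℤ))))))))))
    eq rewrite C0 | symm 1F | symm 2F | symm 3F | symm 4F | symm 5F = refl
    lem : ∀ a b c d e → 1ℤ + (a + (b + (c + (d + (e + (e + (d + (c + (b + (a + 0ℤ)))))))))) ≡ 1ℤ + + 2 * (a + b + c + d + e)
    lem = solve-∀

  prime≡2[3] : ∀ {p} → Prime p → p % 3 ≡ 2 → p ≡ 2 ⊎ p ≡ 5 ⊎ p ≡ 11 ⊎ 17 ℕ.≤ p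
  prime≡2[3] {2} _ _ = inj₁ refl
  prime≡2[3] {5} _ _ = inj₂ (inj₁ refl)
  prime≡2[3] {8} pr _ = ⊥-elim (from-no (prime? 8) pr)
  prime≡2[3] {11} _ _ = inj₂ (inj₂ (inj₁ refl))
  prime≡2[3] {14} pr _ = ⊥-elim (from-no (prime? 14) pr)
  prime≡2[3] {suc (suc (suc (suc (suc (suc (suc (suc (suc (suc (suc (suc (suc (suc (suc (suc (suc p))))))))))))))))} _ _ =
    inj₂ (inj₂ (inj₂ (ℕ.m≤m+n 17 p)))

  -- `dense` is the density hypothesis multiplied by 6p, with 3m = p + 1 substituted.
  module Deficit (p q n : ℤ) (1≤q : 1ℤ ≤ q) (1≤p : 1ℤ ≤ p) (dense : (+ 2 * (p * p) - p + + 6) * q ≤ + 6 * p * n) where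

    0≤q : 0ℤ ≤ q
    0≤q = ℤ.≤-trans (0≤+ℕ 1) 1≤q

    0≤p : 0ℤ ≤ p
    0≤p = ℤ.≤-trans (0≤+ℕ 1) 1≤p

    positive : 0ℤ ≤ n → 1ℤ ≤ n
    positive 0≤n with 1ℤ ℤ.≤? n
    ... | yes h = h
    ... | no h = ⊥-elim (0≰-1 (0≤+ (≤⇒0≤ dense) (0≤+ (0≤* (0≤* (0≤+ℕ 6) 0≤p) (≤⇒0≤ (≰⇒1+≤ h)))
        (0≤+ (0≤* (0≤+ (0≤* (0≤* (0≤+ℕ 2) 0≤p) (≤⇒0≤ 1≤p)) (0≤+ 0≤p (0≤+ℕ 6))) (≤⇒0≤ 1≤q))
          (0≤+ (0≤* (0≤* (0≤+ℕ 2) 0≤p) (≤⇒0≤ 1≤p)) (0≤+ 0≤p (0≤+ℕ 5)))))) (lem p q n))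
      where
      lem : ∀ p q n → (+ 6 * p * n - (+ 2 * (p * p) - p + + 6) * q) + (+ 6 * p * (1ℤ - (1ℤ + n))
        + ((+ 2 * p * (p - 1ℤ) + (p + + 6)) * (q - 1ℤ) + (+ 2 * p * (p - 1ℤ) + (p + + 5)))) ≡ - 1ℤ
      lem = solve-∀

    large : (p - 1ℤ) * q ≤ + 4 * n
    large = *-cancel-≤ {+ 6 * p} {(p - 1ℤ) * q} {+ 4 * n} (0≤⇒≤ _ (0≤+ (0≤* (0≤+ℕ 6) (≤⇒0≤ 1≤p)) (0≤+ℕ 5)) (lem₁ p))
      (0≤⇒≤ _ (0≤+ (0≤* (0≤+ℕ 4) (≤⇒0≤ dense)) (0≤* (0≤+ (0≤* (0≤+ℕ 2) (0≤* 0≤p 0≤p)) (0≤+ (0≤* (0≤+ℕ 2) 0≤p) (0≤+ℕ 24))) 0≤q)) (lem₂ p q n))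
      where
      lem₁ : ∀ p → + 6 * (p - 1ℤ) + + 5 ≡ + 6 * p - 1ℤ
      lem₁ = solve-∀
      lem₂ : ∀ p q n → + 4 * (+ 6 * p * n - (+ 2 * (p * p) - p + + 6) * q) + (+ 2 * (p * p) + (+ 2 * p + + 24)) * q
        ≡ + 6 * p * (+ 4 * n) - + 6 * p * ((p - 1ℤ) * q)
      lem₂ = solve-∀

    module _ (3n≤pq : + 3 * n ≤ p * q) where

      0≤d : 0ℤ ≤ p * q - + 3 * n
      0≤d = ≤⇒0≤ 3n≤pq

      -- With d = pq - 3n the negated inequality is ((p - 6)q + 8d)(2pq + d) ≤ 72pqd. Its leading
      -- part is 2pq((p - 6)q - 28d), where 28 = 36 - 8, and all the remaining terms help.
      contradiction-17 : + 17 ≤ p → ¬ ((+ 3 * p * q - + 8 * n - + 2 * q) * (p * q - n) ≤ + 2 * (+ 4 * p) * (q * (p * q - + 3 * n)))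
      contradiction-17 17≤p h = 0≰-1
          (0≤+ (0≤* (0≤+ℕ 9) (≤⇒0≤ h)) (0≤+ (0≤* (0≤* (0≤+ℕ 2) (0≤* 0≤p 0≤q)) (≤⇒0≤ gap))
            (0≤+ (0≤* 0≤d (0≤+ (0≤* (0≤+ 0≤p-17 (0≤+ℕ 11)) 0≤q) (0≤* (0≤+ℕ 8) 0≤d)))
              (0≤+ (0≤* (0≤* (0≤+ℕ 2) 0≤p) (≤⇒0≤ 1≤q)) (0≤+ (0≤* (0≤+ℕ 2) (≤⇒0≤ 1≤p)) (0≤+ℕ 1))))))
          (final p q n)
        where
        0≤p-17 : 0ℤ ≤ p - + 17
        0≤p-17 = ≤⇒0≤ 17≤p
        -- The number 34 is 2 · 17: the density gives 34d ≤ 2pd ≤ (p - 6)q, and 28 < 34 leaves room.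
        gap : 1ℤ ≤ (p - + 6) * q - + 28 * (p * q - + 3 * n)
        gap = *-cancel-≤ {+ 34} (+≤+ (ℕ.s≤s ℕ.z≤n)) (0≤⇒≤ _
            (0≤+ (0≤* (0≤+ℕ 28) (0≤+ (≤⇒0≤ dense) (0≤* (0≤* (0≤+ℕ 2) 0≤p-17) 0≤d)))
              (0≤+ (0≤* (0≤* (0≤+ℕ 6) 0≤p-17) 0≤q) (0≤+ (0≤* (0≤+ℕ 66) (≤⇒0≤ 1≤q)) (0≤+ℕ 32)))) (lem p q n))
          where
          lem : ∀ p q n → + 28 * ((+ 6 * p * n - (+ 2 * (p * p) - p + + 6) * q) + + 2 * (p - + 17) * (p * q - + 3 * n))
            + (+ 6 * (p - + 17) * q + (+ 66 * (q - 1ℤ) + + 32))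
            ≡ + 34 * ((p - + 6) * q - + 28 * (p * q - + 3 * n)) - + 34 * 1ℤ
          lem = solve-∀
        final : ∀ p q n → + 9 * (+ 2 * (+ 4 * p) * (q * (p * q - + 3 * n)) - (+ 3 * p * q - + 8 * n - + 2 * q) * (p * q - n))
          + (+ 2 * (p * q) * ((p - + 6) * q - + 28 * (p * q - + 3 * n) - 1ℤ)
          + ((p * q - + 3 * n) * ((p - + 17 + + 11) * q + + 8 * (p * q - + 3 * n))
          + (+ 2 * p * (q - 1ℤ) + (+ 2 * (p - 1ℤ) + + 1)))) ≡ - 1ℤ
        final = solve-∀

      contradiction-2 : p ≡ + 2 → ⊥
      contradiction-2 p≡ = 0≰-1 (0≤+ (0≤* (0≤+ℕ 4) 0≤d) (0≤+ (≤⇒0≤ dense) (0≤+ (0≤* (0≤+ℕ 4) (≤⇒0≤ 1≤q)) (0≤+ℕ 3))))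
          (trans (cong (λ p → + 4 * (p * q - + 3 * n) + ((+ 6 * p * n - (+ 2 * (p * p) - p + + 6) * q) + (+ 4 * (q - 1ℤ) + + 3))) p≡) (lem q n))
        where
        lem : ∀ q n → + 4 * (+ 2 * q - + 3 * n) + ((+ 6 * + 2 * n - (+ 2 * (+ 2 * + 2) - + 2 + + 6) * q) + (+ 4 * (q - 1ℤ) + + 3)) ≡ - 1ℤ
        lem = solve-∀

      contradiction-5 : p ≡ + 5 → ⊥
      contradiction-5 p≡ = 0≰-1 (0≤+ (0≤* (0≤+ℕ 10) 0≤d) (0≤+ (≤⇒0≤ dense) (≤⇒0≤ 1≤q)))
          (trans (cong (λ p → + 10 * (p * q - + 3 * n) + ((+ 6 * p * n - (+ 2 * (p * p) - p + + 6) * q) + (q - 1ℤ))) p≡) (lem q n))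
        where
        lem : ∀ q n → + 10 * (+ 5 * q - + 3 * n) + ((+ 6 * + 5 * n - (+ 2 * (+ 5 * + 5) - + 5 + + 6) * q) + (q - 1ℤ)) ≡ - 1ℤ
        lem = solve-∀

      lower-11 : p ≡ + 11 → + 3 * q ≤ n
      lower-11 p≡ = *-cancel-≤ {+ 66} (+≤+ (ℕ.s≤s ℕ.z≤n)) (0≤⇒≤ _ (0≤+ (≤⇒0≤ dense) (0≤* (0≤+ℕ 39) 0≤q))
          (trans (cong (λ p → (+ 6 * p * n - (+ 2 * (p * p) - p + + 6) * q) + + 39 * q) p≡) (lem q n)))
        where
        lem : ∀ q n → (+ 6 * + 11 * n - (+ 2 * (+ 11 * + 11) - + 11 + + 6) * q) + + 39 * q ≡ + 66 * n - + 66 * (+ 3 * q)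
        lem = solve-∀

      upper-11 : p ≡ + 11 → n ≤ + 4 * q
      upper-11 p≡ = *-cancel-≤ {+ 3} (+≤+ (ℕ.s≤s ℕ.z≤n)) (0≤⇒≤ _ (0≤+ 0≤d 0≤q)
          (trans (cong (λ p → (p * q - + 3 * n) + q) p≡) (lem q n)))
        where
        lem : ∀ q n → (+ 11 * q - + 3 * n) + q ≡ + 3 * (+ 4 * q) - + 3 * n
        lem = solve-∀

      -- Since pq - n ≥ 7q, a factor q cancels, and what is left says 49q ≤ 215d for d = 11q - 3n.
      -- The density says 22d ≤ 5q, and 215 · 5 < 49 · 22.
      contradiction-11 : p ≡ + 11 → ¬ (+ 7 * (+ 4 * q - n) * (p * q - n) ≤ + 2 * (+ 4 * p) * (q * (p * q - + 3 * n)))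
      contradiction-11 p≡ h = 0≰-1
          (0≤+ (0≤* (0≤+ℕ 22) 49q≤215d) (0≤+ (0≤* (0≤+ℕ 215) (≤⇒0≤ dense)) (0≤+ (0≤* (0≤+ℕ 3) (≤⇒0≤ 1≤q)) (0≤+ℕ 2))))
          (trans (cong (λ p → + 22 * (+ 215 * (p * q - + 3 * n) - + 49 * q) + (+ 215 * (+ 6 * p * n - (+ 2 * (p * p) - p + + 6) * q) + (+ 3 * (q - 1ℤ) + + 2))) p≡) (final q n))
        where
        7q≤ : + 7 * q ≤ p * q - n
        7q≤ = *-cancel-≤ {+ 3} (+≤+ (ℕ.s≤s ℕ.z≤n)) (0≤⇒≤ _ (0≤+ 0≤d 0≤q)
            (trans (cong (λ p → (p * q - + 3 * n) + q) p≡) (trans (lem q n) (cong (λ p → + 3 * (p * q - n) - + 3 * (+ 7 * q)) (sym p≡)))))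
          where
          lem : ∀ q n → (+ 11 * q - + 3 * n) + q ≡ + 3 * (+ 11 * q - n) - + 3 * (+ 7 * q)
          lem = solve-∀
        linear : + 49 * (+ 4 * q - n) ≤ + 88 * (p * q - + 3 * n)
        linear = *-cancel-≤ {q} {+ 49 * (+ 4 * q - n)} {+ 88 * (p * q - + 3 * n)} 1≤q
            (0≤⇒≤ _ (0≤+ (≤⇒0≤ h) (0≤* (0≤* (0≤+ℕ 7) (≤⇒0≤ (upper-11 p≡))) (≤⇒0≤ 7q≤)))
              (trans (cong (λ r → (+ 2 * (+ 4 * r) * (q * (p * q - + 3 * n)) - + 7 * (+ 4 * q - n) * (p * q - n)) + + 7 * (+ 4 * q - n) * (p * q - n - + 7 * q)) p≡)
                (lem q (+ 4 * q - n) (p * q - n) (p * q - + 3 * n))))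
          where
          lem : ∀ q s t d → (+ 2 * (+ 4 * + 11) * (q * d) - + 7 * s * t) + + 7 * s * (t - + 7 * q) ≡ q * (+ 88 * d) - q * (+ 49 * s)
          lem = solve-∀
        49q≤215d : 0ℤ ≤ + 215 * (p * q - + 3 * n) - + 49 * q
        49q≤215d = subst (0ℤ ≤_) (trans (cong (λ p → + 3 * (+ 88 * (p * q - + 3 * n) - + 49 * (+ 4 * q - n))) p≡)
              (trans (lem q n) (cong (λ p → + 215 * (p * q - + 3 * n) - + 49 * q) (sym p≡))))
            (0≤* (0≤+ℕ 3) (≤⇒0≤ linear))
          where
          lem : ∀ q n → + 3 * (+ 88 * (+ 11 * q - + 3 * n) - + 49 * (+ 4 * q - n)) ≡ + 215 * (+ 11 * q - + 3 * n) - + 49 * q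
          lem = solve-∀
        final : ∀ q n → + 22 * (+ 215 * (+ 11 * q - + 3 * n) - + 49 * q) + (+ 215 * (+ 6 * + 11 * n - (+ 2 * (+ 11 * + 11) - + 11 + + 6) * q) + (+ 3 * (q - 1ℤ) + + 2)) ≡ - 1ℤ
        final = solve-∀

  module HeavyFibre (p : ℕ) .{{_ : NonZero p}} (pr : Prime p) (n : ℕ) (A : Vecp p (suc n) → Bool)
    (sum-free : ∀ x y z → A x ≡ true → A y ≡ true → A z ≡ true → z ≢ _⊕_ p x y) where

    open Field p
    open Fibres p pr n A sum-free

    module _ (p≡2 : p % 3 ≡ 2) (dense : (+ 2 * (+ p * + p) - + p + + 6) * q ≤ + 6 * + p * N) where
      1≤q : 1ℤ ≤ q
      1≤q = 1≤+ℕ (ℕ.m^n>0 p {{prime⇒nonZero pr}} n)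

      2≤p : + 2 ≤ + p
      2≤p = +≤+ (ℕ.nonTrivial⇒n>1 p {{prime⇒nonTrivial pr}})

      module D = Deficit (+ p) q N 1≤q 1≤p dense

      1≤N : 1ℤ ≤ N
      1≤N = D.positive (V.card≥0 A)

      module _ (light : ∀ ξ → ξ ≢ 0ⱽ → ∀ i → + 2 * c ξ i ≤ q) where

        c≥0 : ∀ ξ i → 0ℤ ≤ c ξ i
        c≥0 ξ i = V.card≥0 (fibre ξ i)

        -- The choice κ₁ = 1, κ₂ = 0 of `averaging`: only S ≥ 0 is put in.
        3N≤pq : + 3 * N ≤ + p * q
        3N≤pq = ℤ.0≤i-j⇒j≤i (*-cancel-≤ {q} {0ℤ} {+ p * q - + 3 * N} 1≤q (*-cancel-≤ {+ 2} {q * 0ℤ} {q * (+ p * q - + 3 * N)} (+≤+ (ℕ.s≤s ℕ.z≤n))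
          (subst₂ _≤_ (lemˡ q (+ p * q - N)) (lemʳ (q * (+ p * q - + 3 * N)))
            (averaging 1ℤ 0ℤ 2≤p 1≤N (λ ξ ξ≢0 → 0≤⇒≤ (E.S ξ) (E.S≥0 ξ (c≥0 ξ) (light ξ ξ≢0)) (lem (E.S ξ) (E.W ξ)))))))
          where
          lemˡ : ∀ q x → 0ℤ * x ≡ + 2 * (q * 0ℤ)
          lemˡ = solve-∀
          lemʳ : ∀ x → + 2 * 1ℤ * x ≡ + 2 * x
          lemʳ = solve-∀
          lem : ∀ s w → s ≡ 1ℤ * s - 0ℤ * w
          lem = solve-∀

        case-17 : + 17 ≤ + p → ⊥
        case-17 17≤p = D.contradiction-17 3N≤pq 17≤p (averaging (+ 4 * + p) (+ 3 * + p * q - + 8 * N - + 2 * q) 2≤p 1≤N bound)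
          where
          bound : ∀ ξ → ξ ≢ 0ⱽ → (+ 3 * + p * q - + 8 * N - + 2 * q) * E.W ξ ≤ + 4 * + p * E.S ξ
          bound ξ ξ≢0 = subst (λ m → (+ 3 * + p * q - + 8 * m - + 2 * q) * E.W ξ ≤ + 4 * + p * E.S ξ) (EN≡N ξ)
            (E.energy-bound ξ (c≥0 ξ) (light ξ ξ≢0) pr 0≤q (subst (λ m → (+ p - 1ℤ) * q ≤ + 4 * m) (sym (EN≡N ξ)) D.large))

        case-11 : + p ≡ + 11 → ⊥
        case-11 e = D.contradiction-11 3N≤pq e (averaging (+ 4 * + p) (+ 7 * (+ 4 * q - N)) 2≤p 1≤N bound)
          where
          bound : ∀ ξ → ξ ≢ 0ⱽ → + 7 * (+ 4 * q - N) * E.W ξ ≤ + 4 * + p * E.S ξ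
          bound ξ ξ≢0 = subst (λ m → + 7 * (+ 4 * q - m) * E.W ξ ≤ + 4 * + p * E.S ξ) (EN≡N ξ)
            (E.energy-bound-11 ξ (c≥0 ξ) (light ξ ξ≢0) pr (ℤ.+-injective e)
              (λ t → odd-11 (ℤ.+-injective e) (E.ball ξ (c≥0 ξ) (light ξ ξ≢0) t) (E.0∈ball ξ (c≥0 ξ) (light ξ ξ≢0) t) (E.ball-neg ξ (c≥0 ξ) (light ξ ξ≢0) t))
              0≤q (subst (+ 3 * q ≤_) (sym (EN≡N ξ)) (D.lower-11 3N≤pq e)) (subst (_≤ + 4 * q) (sym (EN≡N ξ)) (D.upper-11 3N≤pq e)))

        absurd : p ≡ 2 ⊎ p ≡ 5 ⊎ p ≡ 11 ⊎ 17 ℕ.≤ p → ⊥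
        absurd = [ (λ e → D.contradiction-2 3N≤pq (cong +_ e)) , [ (λ e → D.contradiction-5 3N≤pq (cong +_ e)) ,
          [ (λ e → case-11 (cong +_ e)) , (λ 17≤p → case-17 (+≤+ 17≤p)) ]′ ]′ ]′

      heavy : ∃ λ ξ → ξ ≢ 0ⱽ × ∃ λ i → q + 1ℤ ≤ + 2 * c ξ i
      heavy with V.search (λ ξ → not (does (ξ V.≟ 0ⱽ)) ∧ not (every 𝔾.finite (λ i → does (+ 2 * c ξ i ℤ.≤? q))))
      ... | inj₁ (ξ , h) = ξ , no-does (ξ V.≟ 0ⱽ) (not-elim (∧-elimˡ h)) , proj₁ w ,
              subst (_≤ + 2 * c ξ (proj₁ w)) (ℤ.+-comm 1ℤ q) (≰⇒1+≤ (no-does (_ ℤ.≤? q) (proj₂ w)))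
        where
        w = every-false 𝔾.finite (not-elim (∧-elimʳ {not (does (ξ V.≟ 0ⱽ))} h))
      ... | inj₂ none = ⊥-elim (absurd (λ ξ ξ≢0 i → yes-does (_ ℤ.≤? q) (every-elim 𝔾.finite (all ξ ξ≢0) i)) (prime≡2[3] pr p≡2))
        where
        all : ∀ ξ → ξ ≢ 0ⱽ → every 𝔾.finite (λ i → does (+ 2 * c ξ i ℤ.≤? q)) ≡ true
        all ξ ξ≢0 = ¬false⇒true (λ e → true≢false (∧-intro (cong not (does-no (ξ V.≟ 0ⱽ) ξ≢0)) (cong not e)) (none ξ))

-- Inequalities between the slices over i, j and i + j

module FibreSumsets where

  open import Defs
  open import Data.Integer using (+_; -_; _+_; _*_; _-_; _≤_; 1ℤ)
  open FiniteSums
  open SumsetTheory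
  open PrimeFieldVectors
  open FibreStatistics

  module FibreSums (p : ℕ) .{{_ : NonZero p}} (pr : Prime p) (n : ℕ) (A : Vecp p (suc n) → Bool)
    (sum-free : ∀ x y z → A x ≡ true → A y ≡ true → A z ≡ true → z ≢ _⊕_ p x y) where

    open Field p
    open Fibres p pr n A sum-free
    private module VP = V.Primal pr

    module _ (ξ : Vᵖ) (ξ≢0 : ξ ≢ 0ⱽ) where

      on-card : ∀ i → V.card (on ξ i) ≡ q
      on-card = fibre-card pr ξ ξ≢0

      fibre-∈ : ∀ {i x} → fibre ξ i x ≡ true → A x ≡ true
      fibre-∈ = ∧-elimˡ

      fibre-on : ∀ {i x} → fibre ξ i x ≡ true → ξ ∙ x ≡ i
      fibre-on {i} {x} h = yes-does (ξ ∙ x Fin.≟ i) (∧-elimʳ {A x} h)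

      -- Fix z in the slice over i + j. The reflection x ↦ z - x sends the slice over j into the
      -- hyperplane over i, where by sum-freeness it misses A.
      fibre-pair : ∀ i j → 1ℤ ≤ c ξ (i ⊞ j) → c ξ i + c ξ j ≤ q
      fibre-pair i j h = subst₂ _≤_ (cong (λ t → c ξ i + t) reflected) (on-card i)
          (V.card-disjoint {fibre ξ i} {λ x → fibre ξ j (z V.⊝ x)} {on ξ i} (λ x → ∧-elimʳ {A x}) onto disjoint)
        where
        w = V.inhabited {fibre ξ (i ⊞ j)} h
        z = proj₁ w
        reflect : ∀ x → z V.⊝ (z V.⊝ x) ≡ x
        reflect x = trans (V.⊝⊝ z z x) (trans (cong (_⊞ⱽ x) (V.inverseʳ z)) (V.identityˡ x))
        reflected : V.card (λ x → fibre ξ j (z V.⊝ x)) ≡ c ξ j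
        reflected = reindex V.finite V.finite (z V.⊝_) (z V.⊝_) reflect reflect (λ x → ⟦ fibre ξ j x ⟧)
        onto : ∀ x → fibre ξ j (z V.⊝ x) ≡ true → on ξ i x ≡ true
        onto x hx = does-yes (ξ ∙ x Fin.≟ i) (𝔾.⊹-cancelˡ j (trans (⊞-comm j (ξ ∙ x)) (trans (cong (ξ ∙ x ⊞_) (sym (fibre-on hx)))
          (trans (sym (∙-⊞ ξ x (z V.⊝ x))) (trans (cong (ξ ∙_) (V.+-cancel- z x)) (trans (fibre-on {i ⊞ j} (proj₂ w)) (⊞-comm i j)))))))
        disjoint : ∀ x → fibre ξ i x ≡ true → fibre ξ j (z V.⊝ x) ≡ true → ⊥
        disjoint x hx hy = sum-free x (z V.⊝ x) z (fibre-∈ {i} hx) (fibre-∈ {j} hy) (fibre-∈ {i ⊞ j} (proj₂ w)) (sym (V.+-cancel- z x))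

      kernel : V.Subgroup
      kernel = record
        { mem = on ξ (ι 0)
        ; 0∈ = does-yes (_ Fin.≟ _) (∙0 ξ)
        ; +∈ = λ {x} {y} hx hy → does-yes (_ Fin.≟ _) (trans (∙-⊞ ξ x y)
            (trans (cong₂ _⊞_ (yes-does (ξ ∙ x Fin.≟ ι 0) hx) (yes-does (ξ ∙ y Fin.≟ ι 0) hy)) (⊞-identityˡ (ι 0))))
        }

      -- Kneser in cosets of the kernel of ξ, with `C` the complement of A in the hyperplane over i
      -- + j. A point of A in that hyperplane is the point that `C` misses.
      fibre-kneser : ∀ i j → 1ℤ ≤ c ξ i → 1ℤ ≤ c ξ j → 1ℤ ≤ c ξ (i ⊞ j) →
        + p * (c ξ i + c ξ j + c ξ (i ⊞ j)) ≤ (+ p + 1ℤ) * q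
      fibre-kneser i j hi hj hk = 0≤⇒≤ _ (≤⇒0≤ bound) (trans (cong₂ (λ s t → (+ p * s + t) - (+ p * c ξ i + + p * c ξ j)) C-card (on-card (ι 0)))
          (lem (+ p) q (c ξ i) (c ξ j) (c ξ (i ⊞ j))))
        where
        C : Vᵖ → Bool
        C x = on ξ (i ⊞ j) x ∧ not (A x)
        C-card : V.card C ≡ q - c ξ (i ⊞ j)
        C-card = trans (∑-cong V.elems (λ x → split (on ξ (i ⊞ j) x) (A x))) (trans (∑-⊖ V.elems _ _) (cong (λ t → t - c ξ (i ⊞ j)) (on-card (i ⊞ j))))
          where
          split : ∀ u v → ⟦ u ∧ not v ⟧ ≡ ⟦ u ⟧ - ⟦ v ∧ u ⟧
          split true true = refl
          split true false = refl
          split false true = refl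
          split false false = refl
        x₀ = V.inhabited {fibre ξ i} hi
        y₀ = V.inhabited {fibre ξ j} hj
        z₀ = V.inhabited {fibre ξ (i ⊞ j)} hk
        difference : ∀ {k x y} → ξ ∙ x ≡ k → ξ ∙ y ≡ k → on ξ (ι 0) (x V.⊝ y) ≡ true
        difference {k} {x} {y} ex ey = does-yes (_ Fin.≟ _) (trans (∙-⊝ ξ x y) (trans (cong₂ 𝔾._⊝_ ex ey) (𝔾.inverseʳ k)))
        lift-sum : ∀ {x y} → fibre ξ i x ≡ true → fibre ξ j y ≡ true → ξ ∙ (x ⊞ⱽ y) ≡ i ⊞ j
        lift-sum {x} {y} hx hy = trans (∙-⊞ ξ x y) (cong₂ _⊞_ (fibre-on hx) (fibre-on hy))
        bound : + p * c ξ i + + p * c ξ j ≤ + p * V.card C + V.card (on ξ (ι 0))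
        bound = VP.kneser kernel (fibre ξ i) (fibre ξ j) C {proj₁ x₀} {proj₁ y₀} {proj₁ z₀}
          (λ x h → difference (fibre-on h) (fibre-on (proj₂ x₀)))
          (λ y h → difference (fibre-on h) (fibre-on (proj₂ y₀)))
          (proj₂ x₀) (proj₂ y₀)
          (λ x y hx hy → ∧-intro (does-yes (_ Fin.≟ _) (lift-sum hx hy))
            (cong not (¬true⇒false (λ h → sum-free x y (x ⊞ⱽ y) (fibre-∈ {i} hx) (fibre-∈ {j} hy) h refl))))
          (difference (fibre-on (proj₂ z₀)) (lift-sum (proj₂ x₀) (proj₂ y₀)))
          (¬true⇒false (λ h → true≢false (fibre-∈ {i ⊞ j} (proj₂ z₀)) (not-elim (∧-elimʳ {on ξ (i ⊞ j) (proj₁ z₀)} h))))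
        lem : ∀ p q a b c → (p * (q - c) + q) - (p * a + p * b) ≡ (p + 1ℤ) * q - p * (a + b + c)
        lem = solve-∀

-- The set of non-empty slices: its size and its sum-freeness

module SupportStructure where

  open import Data.Integer using (ℤ; +_; -_; _+_; _*_; _-_; _≤_; 0ℤ; 1ℤ; +≤+; -≤+)
  open FiniteSums
  open SumsetTheory
  open EnergyBound

  ∑-downFrom-≤ : ∀ T {f : ℕ → ℤ} {k} → (∀ t → t ℕ.< T → f t ≤ k) → ∑ (downFrom T) f ≤ + T * k
  ∑-downFrom-≤ ℕ.zero {k = k} h = ℤ.≤-reflexive (sym (ℤ.*-zeroˡ k))
  ∑-downFrom-≤ (suc T) {f} {k} h = subst (f T + ∑ (downFrom T) f ≤_) (lem (+ T) k)
      (ℤ.+-mono-≤ (h T ℕ.≤-refl) (∑-downFrom-≤ T (λ t t<T → h t (ℕ.m≤n⇒m≤1+n t<T))))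
    where
    lem : ∀ t k → k + t * k ≡ (1ℤ + t) * k
    lem = solve-∀

  maximum : ∀ {X : Set} (F : Finite X) (f : X → ℕ) B → (∀ x → f x ℕ.≤ B) → X → ∃ λ a → ∀ x → f x ℕ.≤ f a
  maximum {X} F f B f≤B a = climb B a (ℕ.m≤m+n B (f a))
    where
    climb : ∀ k a → B ℕ.≤ k ℕ.+ f a → ∃ λ a → ∀ x → f x ℕ.≤ f a
    climb k a h with Finite.search F (λ x → f a <ᵇ f x)
    ... | inj₂ none = a , λ x → false-<ᵇ (none x)
    climb ℕ.zero a h | inj₁ (x , e) = ⊥-elim (ℕ.<⇒≱ (true-<ᵇ {f a} {f x} e) (ℕ.≤-trans (f≤B x) h))
    climb (suc k) a h | inj₁ (x , e) = climb k x (ℕ.≤-trans h (ℕ.≤-trans (ℕ.≤-reflexive (sym (ℕ.+-suc k (f a)))) (ℕ.+-monoʳ-≤ k (true-<ᵇ {f a} {f x} e))))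

  -- Here p = 3m - 1, and a configuration of weights bounded by r + D has total R + X, split at height r;
  -- s is the size of the support and P the number of pairs in it.
  module SupportArithmetic (m s P R X r D : ℤ) (0≤r : 0ℤ ≤ r) (1≤D : 1ℤ ≤ D)
    (X≤ : + 2 * X ≤ D * (+ 3 * m - s)) (R≤ : R ≤ s * r) (P≥ : + 2 * s - (+ 3 * m - 1ℤ) ≤ P)
    (R≤′ : + 2 * (+ 3 * m - 1ℤ) * R ≤ + 2 * s * (+ 3 * m - 1ℤ) * r - P * ((+ 3 * m - 1ℤ) * r - (+ 2 * r + D)))
    (1≤m : 1ℤ ≤ m)
    (dense : (+ 2 * (+ 3 * m - 1ℤ) * m - (+ 3 * m - 1ℤ) + + 2) * (+ 2 * r + D) ≤ + 2 * (+ 3 * m - 1ℤ) * (R + X)) where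

    0≤D : 0ℤ ≤ D
    0≤D = ℤ.≤-trans (0≤+ℕ 1) 1≤D

    0≤p : 0ℤ ≤ + 3 * m - 1ℤ
    0≤p = subst (0ℤ ≤_) (lem m) (0≤+ (0≤* (0≤+ℕ 3) (≤⇒0≤ 1≤m)) (0≤+ℕ 2))
      where
      lem : ∀ m → + 3 * (m - 1ℤ) + + 2 ≡ + 3 * m - 1ℤ
      lem = solve-∀

    -- Compare coefficients in R + X ≤ sr + D(3m - s)/2 with (m - 1/2)(2r + D): the upper bound on s
    -- serves r, the lower bound serves D, and the term 1/p of the density makes the conflict
    -- strict.
    small : m + 1ℤ ≤ s → s ≤ + 2 * m - 1ℤ → ⊥
    small m<s s<2m = 0≰-1
        (0≤+ (≤⇒0≤ dense) (0≤+ (0≤* (0≤* (0≤+ℕ 2) 0≤p) (≤⇒0≤ R≤)) (0≤+ (0≤* 0≤p (≤⇒0≤ X≤)) (0≤+ (0≤* (0≤* (0≤* (0≤+ℕ 2) 0≤p) 0≤r) (≤⇒0≤ s<2m))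
          (0≤+ (0≤* (0≤* 0≤p 0≤D) (≤⇒0≤ m<s)) (0≤+ (0≤* (0≤+ℕ 4) 0≤r) (0≤+ (0≤* (0≤+ℕ 2) (≤⇒0≤ 1≤D)) (0≤+ℕ 1))))))))
        (lem m s R X r D)
      where
      lem : ∀ m s R X r D →
        (+ 2 * (+ 3 * m - 1ℤ) * (R + X) - (+ 2 * (+ 3 * m - 1ℤ) * m - (+ 3 * m - 1ℤ) + + 2) * (+ 2 * r + D))
        + (+ 2 * (+ 3 * m - 1ℤ) * (s * r - R) + ((+ 3 * m - 1ℤ) * (D * (+ 3 * m - s) - + 2 * X)
        + (+ 2 * (+ 3 * m - 1ℤ) * r * (+ 2 * m - 1ℤ - s) + ((+ 3 * m - 1ℤ) * D * (s - (m + 1ℤ)) + (+ 4 * r + (+ 2 * (D - 1ℤ) + + 1)))))) ≡ - 1ℤ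
      lem = solve-∀

    module Large (2m≤s : + 2 * m ≤ s) (s<p : s ≤ + 3 * m - + 2) where

      0≤v : 0ℤ ≤ s - + 2 * m
      0≤v = ≤⇒0≤ 2m≤s

      0≤w-v : 0ℤ ≤ + 3 * m - + 2 - s
      0≤w-v = ≤⇒0≤ s<p

      0≤w : 0ℤ ≤ m - + 2
      0≤w = subst (0ℤ ≤_) (lem m s) (0≤+ 0≤v 0≤w-v)
        where
        lem : ∀ m s → (s - + 2 * m) + (+ 3 * m - + 2 - s) ≡ m - + 2
        lem = solve-∀

      -- For s ≥ 2m the estimate R ≤ sr exceeds the share of r in the density, but here r is so
      -- small compared with D that the loss is absorbed.
      low : (+ 3 * m - 1ℤ) * r ≤ + 2 * r + D → ⊥
      low pr≤Q = 0≰-1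
          (0≤+ (≤⇒0≤ dense) (0≤+ (0≤* (0≤* (0≤+ℕ 2) 0≤p) (≤⇒0≤ R≤)) (0≤+ (0≤* 0≤p (≤⇒0≤ X≤)) (0≤+ (0≤* (0≤* 0≤p (0≤+ 0≤v (0≤+ 0≤w (0≤+ℕ 1)))) (≤⇒0≤ pr≤Q))
            (0≤+ (0≤* (0≤* 0≤p 0≤r) (0≤+ (0≤* (0≤+ℕ 3) (0≤* 0≤w 0≤w)) (0≤+ (0≤* (0≤+ℕ 6) 0≤w) (0≤+ (0≤* (0≤+ℕ 3) (0≤* 0≤w 0≤v)) (0≤+ 0≤v (0≤+ℕ 1))))))
              (0≤+ (0≤* (0≤+ℕ 4) 0≤r) (0≤+ (0≤* (0≤+ℕ 2) (≤⇒0≤ 1≤D)) (0≤+ℕ 1))))))))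
          (lem m s R X r D)
        where
        lem : ∀ m s R X r D →
          (+ 2 * (+ 3 * m - 1ℤ) * (R + X) - (+ 2 * (+ 3 * m - 1ℤ) * m - (+ 3 * m - 1ℤ) + + 2) * (+ 2 * r + D))
          + (+ 2 * (+ 3 * m - 1ℤ) * (s * r - R) + ((+ 3 * m - 1ℤ) * (D * (+ 3 * m - s) - + 2 * X)
          + ((+ 3 * m - 1ℤ) * ((s - + 2 * m) + ((m - + 2) + + 1)) * ((+ 2 * r + D) - (+ 3 * m - 1ℤ) * r)
          + ((+ 3 * m - 1ℤ) * r * (+ 3 * ((m - + 2) * (m - + 2)) + (+ 6 * (m - + 2) + (+ 3 * ((m - + 2) * (s - + 2 * m)) + ((s - + 2 * m) + + 1))))
          + (+ 4 * r + (+ 2 * (D - 1ℤ) + + 1)))))) ≡ - 1ℤ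
        lem = solve-∀

      -- Here the estimate R ≤ sr is replaced by `R≤′`: each of the P pairs saves pr - Q, where Q =
      -- 2r + D, and there are at least 2s - p pairs.
      high : + 2 * r + D ≤ (+ 3 * m - 1ℤ) * r → ⊥
      high Q≤pr = 0≰-1
          (0≤+ (≤⇒0≤ dense) (0≤+ (≤⇒0≤ R≤′) (0≤+ (0≤* (≤⇒0≤ P≥) (≤⇒0≤ Q≤pr)) (0≤+ (0≤* 0≤p (≤⇒0≤ X≤))
            (0≤+ (0≤* 0≤r (0≤+ (0≤* (0≤+ℕ 3) (0≤* 0≤w 0≤w)) (0≤+ (0≤* (0≤+ℕ 2) 0≤w) (0≤+ (0≤* (0≤+ℕ 4) 0≤w-v) (0≤+ℕ 3)))))
              (0≤+ (0≤* 0≤D (0≤+ (0≤* (0≤+ℕ 3) (0≤* 0≤w 0≤w)) (0≤+ (0≤* (0≤+ℕ 7) 0≤w) (0≤+ (0≤* (0≤+ℕ 3) (0≤* 0≤w 0≤v)) (0≤* (0≤+ℕ 3) 0≤v)))))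
                (0≤+ (0≤* (0≤+ℕ 4) (≤⇒0≤ 1≤D)) (0≤+ℕ 3))))))))
          (lem m s P R X r D)
        where
        lem : ∀ m s P R X r D →
          (+ 2 * (+ 3 * m - 1ℤ) * (R + X) - (+ 2 * (+ 3 * m - 1ℤ) * m - (+ 3 * m - 1ℤ) + + 2) * (+ 2 * r + D))
          + ((+ 2 * s * (+ 3 * m - 1ℤ) * r - P * ((+ 3 * m - 1ℤ) * r - (+ 2 * r + D)) - + 2 * (+ 3 * m - 1ℤ) * R)
          + ((P - (+ 2 * s - (+ 3 * m - 1ℤ))) * ((+ 3 * m - 1ℤ) * r - (+ 2 * r + D))
          + ((+ 3 * m - 1ℤ) * (D * (+ 3 * m - s) - + 2 * X)
          + (r * (+ 3 * ((m - + 2) * (m - + 2)) + (+ 2 * (m - + 2) + (+ 4 * (+ 3 * m - + 2 - s) + + 3)))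
          + (D * (+ 3 * ((m - + 2) * (m - + 2)) + (+ 7 * (m - + 2) + (+ 3 * ((m - + 2) * (s - + 2 * m)) + + 3 * (s - + 2 * m))))
          + (+ 4 * (D - 1ℤ) + + 3)))))) ≡ - 1ℤ
        lem = solve-∀

    support≤m : s ≤ + 3 * m - + 2 → s ≤ m
    support≤m s<p with s ℤ.≤? m | s ℤ.≤? + 2 * m - 1ℤ | ℤ.≤-total ((+ 3 * m - 1ℤ) * r) (+ 2 * r + D)
    ... | yes h | _ | _ = h
    ... | no h | yes h₂ | _ = ⊥-elim (small (subst (_≤ s) (ℤ.+-comm 1ℤ m) (≰⇒1+≤ h)) h₂)
    ... | no _ | no h₂ | inj₁ l = ⊥-elim (Large.low (subst (_≤ s) (lem m) (≰⇒1+≤ h₂)) s<p l)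
      where
      lem : ∀ m → 1ℤ + (+ 2 * m - 1ℤ) ≡ + 2 * m
      lem = solve-∀
    ... | no _ | no h₂ | inj₂ l = ⊥-elim (Large.high (subst (_≤ s) (lem m) (≰⇒1+≤ h₂)) s<p l)
      where
      lem : ∀ m → 1ℤ + (+ 2 * m - 1ℤ) ≡ + 2 * m
      lem = solve-∀

  module Weights {p : ℕ} {G : Set} (E : ElementaryAbelian p G) (pr : Prime p) (size≡p : ElementaryAbelian.size E ≡ + p)
    (c : G → ℕ) (Q : ℕ) (m : ℤ) (3m≡p+1 : + 3 * m ≡ + p + 1ℤ) (1≤m : 1ℤ ≤ m) where

    open Elementary E
    open Primal pr using (cauchy-davenport)

    -- From here on the slices enter only through their sizes `c`, subject to the inequalities for
    -- i, j and i + j, the bound Q and the density.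
    module Bounded
      (pair : ∀ i j → 1ℤ ≤ + c (i ⊹ j) → + c i + + c j ≤ + Q)
      (kneser-weights : ∀ i j → 1ℤ ≤ + c i → 1ℤ ≤ + c j → 1ℤ ≤ + c (i ⊹ j) → + p * (+ c i + + c j + + c (i ⊹ j)) ≤ (+ p + 1ℤ) * + Q)
      (c≤Q : ∀ i → c i ℕ.≤ Q)
      (dense : (+ 2 * + p * m - + p + + 2) * + Q ≤ + 2 * + p * sum (λ i → + c i))
      where

      supp : G → Bool
      supp i = 0 <ᵇ c i

      supp-⇒ : ∀ {i} → supp i ≡ true → 1ℤ ≤ + c i
      supp-⇒ {i} h = +≤+ (true-<ᵇ {0} {c i} h)

      supp-⇐ : ∀ {i} → 1ℤ ≤ + c i → supp i ≡ true
      supp-⇐ (+≤+ h) = <ᵇ-true h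

      s : ℤ
      s = card supp

      N : ℤ
      N = sum (λ i → + c i)

      p≡3m-1 : + p ≡ + 3 * m - 1ℤ
      p≡3m-1 = trans (lem (+ p)) (cong (_- 1ℤ) (sym 3m≡p+1))
        where
        lem : ∀ p → p ≡ p + 1ℤ - 1ℤ
        lem = solve-∀

      heavy-pair : ∀ i j → + Q + 1ℤ ≤ + c i + + c j → supp (i ⊹ j) ≡ false
      heavy-pair i j h = ¬true⇒false (λ e → 1+≰ (ℤ.≤-trans (subst (_≤ + c i + + c j) (ℤ.+-comm (+ Q) 1ℤ) h) (pair i j (supp-⇒ {i ⊹ j} e))))

      module Peak (i₀ : G) (max : ∀ i → c i ℕ.≤ c i₀) (heavy : + Q + 1ℤ ≤ + 2 * + c i₀) where

        -- A weight above r exceeds Q when added to the peak M. The gap D = 2M - Q is positive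
        -- because the peak is heavy.
        M r D : ℕ
        M = c i₀
        r = Q ∸ M
        D = M ∸ r

        Q≡r+M : Q ≡ r ℕ.+ M
        Q≡r+M = sym (ℕ.m∸n+n≡m (c≤Q i₀))

        r<M : r ℕ.< M
        r<M = ℕ.+-cancelʳ-< M r M (ℕ.≤-trans (ℕ.≤-reflexive (cong suc (sym Q≡r+M))) (ℤ.drop‿+≤+ (subst₂ _≤_ (ℤ.+-comm (+ Q) 1ℤ) (lem (+ M)) heavy)))
          where
          lem : ∀ x → + 2 * x ≡ x + x
          lem = solve-∀

        M≡r+D : M ≡ r ℕ.+ D
        M≡r+D = sym (ℕ.m+[n∸m]≡n (ℕ.<⇒≤ r<M))

        Qℤ : + Q ≡ + 2 * + r + + D
        Qℤ = trans (cong +_ (trans Q≡r+M (cong (r ℕ.+_) M≡r+D))) (lem (+ r) (+ D))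
          where
          lem : ∀ r D → r + (r + D) ≡ + 2 * r + D
          lem = solve-∀

        Mℤ : + M ≡ + r + + D
        Mℤ = cong +_ M≡r+D

        R X P : ℤ
        R = sum (λ i → + (c i ⊓ r))
        X = sum (λ i → + (c i ∸ r))
        P = card (λ j → supp j ∧ supp (j ⊹ i₀))

        N≡R+X : N ≡ R + X
        N≡R+X = trans (∑-cong elems (λ i → cong +_ (sym (trans (cong (ℕ._+ (c i ∸ r)) (ℕ.⊓-comm (c i) r)) (ℕ.m⊓n+n∸m≡n r (c i)))))) (∑-+ elems _ _)

        excess≤D : ∀ i → c i ∸ r ℕ.≤ D
        excess≤D i = ℕ.∸-monoˡ-≤ r (max i)

        -- These are the level sets c i > r + u and c i ≥ M - u. For u < D the second family is the
        -- first in reverse order, so either one accounts for X.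
        upper lower : ℕ → G → Bool
        upper u i = u <ᵇ (c i ∸ r)
        lower u i = not (u <ᵇ (M ∸ c i))

        upper-sum : ∑ (downFrom D) (λ u → card (upper u)) ≡ X
        upper-sum = trans (∑-swap (downFrom D) elems _) (∑-cong elems (λ i → trans (layers D (c i ∸ r)) (cong +_ (ℕ.m≤n⇒m⊓n≡m (excess≤D i)))))

        lower-sum : X ≤ ∑ (downFrom D) (λ u → card (lower u))
        lower-sum = subst (X ≤_) (sym (∑-swap (downFrom D) elems _)) (∑-mono elems (λ i → subst (+ (c i ∸ r) ≤_) (sym (column i)) (bound i)))
          where
          column : ∀ i → ∑ (downFrom D) (λ u → ⟦ lower u i ⟧) ≡ + D - + ((M ∸ c i) ⊓ D)
          column i = trans (∑-cong (downFrom D) (λ u → ⟦not⟧≡1- (u <ᵇ (M ∸ c i)))) (trans (∑-⊖ (downFrom D) _ _) (cong₂ _-_ (size-downFrom D) (layers D (M ∸ c i))))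
          bound : ∀ i → + (c i ∸ r) ≤ + D - + ((M ∸ c i) ⊓ D)
          bound i = 0≤⇒≤ _ (≤⇒0≤ (+≤+ nat)) (lem (+ (c i ∸ r)) (+ ((M ∸ c i) ⊓ D)) (+ D))
            where
            lem : ∀ x y d → d - (x + y) ≡ d - y - x
            lem = solve-∀
            nat : c i ∸ r ℕ.+ (M ∸ c i) ⊓ D ℕ.≤ D
            nat with ℕ.≤-total r (c i)
            ... | inj₂ c≤r rewrite ℕ.m≤n⇒m∸n≡0 c≤r = ℕ.m⊓n≤n (M ∸ c i) D
            ... | inj₁ r≤c = ℕ.≤-trans (ℕ.+-monoʳ-≤ (c i ∸ r) (ℕ.m⊓n≤m (M ∸ c i) D)) (ℕ.≤-reflexive (trans (ℕ.+-comm (c i ∸ r) (M ∸ c i))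
                  (trans (sym (ℕ.+-∸-assoc (M ∸ c i) r≤c)) (cong (_∸ r) (ℕ.m∸n+n≡m (max i))))))

        -- The two thresholds add up to Q, and one of them is strict, so sums of such indices leave
        -- the support. Cauchy-Davenport applies because the complement of the support misses i₀.
        level : ∀ u → u ℕ.< D → card (upper u) + card (lower u) ≤ + 3 * m - s
        level u u<D = 0≤⇒≤ _ (≤⇒0≤ cd) (trans (cong (λ t → (t + 1ℤ) - (card (upper u) + card (lower u))) empty-card)
            (trans (lem₁ (+ p) s (card (upper u) + card (lower u))) (cong (λ t → t - s - (card (upper u) + card (lower u))) (sym 3m≡p+1))))
          where
          lem₁ : ∀ p s x → (p - s + 1ℤ) - x ≡ p + 1ℤ - s - x
          lem₁ = solve-∀
          empty : G → Bool
          empty i = not (supp i)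
          empty-card : card empty ≡ + p - s
          empty-card = trans (lem s (card empty)) (cong (_- s) (trans (card-not supp) size≡p))
            where
            lem : ∀ s e → e ≡ s + e - s
            lem = solve-∀
          M>0 : 0 ℕ.< M
          M>0 = ℕ.≤-<-trans ℕ.z≤n r<M
          cd : card (upper u) + card (lower u) ≤ card empty + 1ℤ
          cd = cauchy-davenport size≡p (upper u) (lower u) empty {i₀} {i₀} {i₀} (<ᵇ-true u<D)
            (cong not (<ᵇ-false (ℕ.≤-trans (ℕ.≤-reflexive (ℕ.n∸n≡0 M)) ℕ.z≤n)))
            (λ i j hi hj → cong not (heavy-pair i j (subst (_≤ + c i + + c j) (ℤ.+-comm 1ℤ (+ Q)) (+≤+ (total i j hi hj)))))
            (cong not (<ᵇ-true M>0))
            where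
            total : ∀ i j → upper u i ≡ true → lower u j ≡ true → suc Q ℕ.≤ c i ℕ.+ c j
            total i j hi hj = ℕ.≤-trans (ℕ.≤-reflexive (cong suc Q≡r+M)) (ℕ.≤-trans (ℕ.+-monoʳ-≤ (suc r) cj) (ℕ.≤-trans (ℕ.≤-reflexive rearrange) (ℕ.+-monoˡ-≤ (c j) ci)))
              where
              cj : M ℕ.≤ u ℕ.+ c j
              cj = ℕ.≤-trans (ℕ.m≤n+m∸n M (c j)) (ℕ.≤-trans (ℕ.+-monoʳ-≤ (c j) (false-<ᵇ {u} (not-elim hj))) (ℕ.≤-reflexive (ℕ.+-comm (c j) u)))
              u<c∸r : u ℕ.< c i ∸ r
              u<c∸r = true-<ᵇ {u} hi
              ci : suc r ℕ.+ u ℕ.≤ c i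
              ci = subst (ℕ._≤ c i) (cong suc (ℕ.+-comm u r))
                (ℕ.m≤o∸n⇒m+n≤o (suc u) (ℕ.<⇒≤ (ℕ.m∸n≢0⇒n<m (λ e → ℕ.n≮0 (subst (u ℕ.<_) e u<c∸r)))) u<c∸r)
              rearrange : suc r ℕ.+ (u ℕ.+ c j) ≡ suc r ℕ.+ u ℕ.+ c j
              rearrange = sym (ℕ.+-assoc (suc r) u (c j))

        X≤ : + 2 * X ≤ + D * (+ 3 * m - s)
        X≤ = 0≤⇒≤ _ (0≤+ (≤⇒0≤ lower-sum) (≤⇒0≤ (∑-downFrom-≤ D level)))
            (trans (cong (λ t → (∑ (downFrom D) (λ u → card (lower u)) - X) + (+ D * (+ 3 * m - s) - t)) (trans (∑-+ (downFrom D) _ _) (cong (_+ ∑ (downFrom D) (λ u → card (lower u))) upper-sum)))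
              (lem X (∑ (downFrom D) (λ u → card (lower u))) (+ D * (+ 3 * m - s))))
          where
          lem : ∀ x l k → (l - x) + (k - (x + l)) ≡ k - + 2 * x
          lem = solve-∀

        R≤ : R ≤ s * + r
        R≤ = subst (R ≤_) (∑-*ʳ elems (+ r) _) (∑-mono elems bound)
          where
          bound : ∀ i → + (c i ⊓ r) ≤ ⟦ supp i ⟧ * + r
          bound i with c i
          ... | ℕ.zero = ℤ.≤-reflexive (sym (ℤ.*-zeroˡ (+ r)))
          ... | suc k = subst (+ (suc k ⊓ r) ≤_) (sym (ℤ.*-identityˡ (+ r))) (+≤+ (ℕ.m⊓n≤n (suc k) r))

        shifted-supp : card (λ j → supp (j ⊹ i₀)) ≡ s
        shifted-supp = sum-shift i₀ (λ j → ⟦ supp j ⟧)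

        P≥ : + 2 * s - + p ≤ P
        P≥ = subst (_≤ P) total (∑-mono elems (λ j → bound (supp j) (supp (j ⊹ i₀))))
          where
          bound : ∀ u v → ⟦ u ⟧ + ⟦ v ⟧ - 1ℤ ≤ ⟦ u ∧ v ⟧
          bound true true = ℤ.≤-refl
          bound true false = ℤ.≤-refl
          bound false true = ℤ.≤-refl
          bound false false = -≤+
          total : sum (λ j → ⟦ supp j ⟧ + ⟦ supp (j ⊹ i₀) ⟧ - 1ℤ) ≡ + 2 * s - + p
          total = trans (∑-⊖ elems _ _) (cong₂ _-_ (trans (∑-+ elems _ _) (trans (cong (λ t → s + t) shifted-supp) (lem s))) size≡p)
            where
            lem : ∀ s → s + s ≡ + 2 * s
            lem = solve-∀

        -- If j and j + i₀ both lie in the support, the Kneser bound with the peak in the middle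
        -- gives p(c j + c (j + i₀)) ≤ pr + Q in place of the trivial 2pr. Summing over j counts
        -- every index twice.
        R≤′ : + 2 * + p * R ≤ + 2 * s * + p * + r - P * (+ p * + r - (+ 2 * + r + + D))
        R≤′ = subst₂ _≤_ left right (∑-mono elems bound)
          where
          left : sum (λ j → + p * (+ (c j ⊓ r) + + (c (j ⊹ i₀) ⊓ r))) ≡ + 2 * + p * R
          left = trans (∑-*ˡ elems (+ p) _) (trans (cong (+ p *_) (trans (∑-+ elems _ _) (cong (λ t → R + t) (sum-shift i₀ (λ j → + (c j ⊓ r)))))) (lem (+ p) R))
            where
            lem : ∀ p x → p * (x + x) ≡ + 2 * p * x
            lem = solve-∀
          right : sum (λ j → (⟦ supp j ⟧ + ⟦ supp (j ⊹ i₀) ⟧) * (+ p * + r) - ⟦ supp j ∧ supp (j ⊹ i₀) ⟧ * (+ p * + r - (+ 2 * + r + + D)))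
            ≡ + 2 * s * + p * + r - P * (+ p * + r - (+ 2 * + r + + D))
          right = trans (∑-⊖ elems _ _) (cong₂ _-_ (trans (∑-*ʳ elems (+ p * + r) _) (trans (cong (_* (+ p * + r)) (trans (∑-+ elems _ _) (cong (λ t → s + t) shifted-supp))) (lem s (+ p) (+ r))))
              (∑-*ʳ elems (+ p * + r - (+ 2 * + r + + D)) _))
            where
            lem : ∀ s p r → (s + s) * (p * r) ≡ + 2 * s * p * r
            lem = solve-∀
          bound : ∀ j → + p * (+ (c j ⊓ r) + + (c (j ⊹ i₀) ⊓ r)) ≤
            (⟦ supp j ⟧ + ⟦ supp (j ⊹ i₀) ⟧) * (+ p * + r) - ⟦ supp j ∧ supp (j ⊹ i₀) ⟧ * (+ p * + r - (+ 2 * + r + + D))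
          bound j = go (c j) (c (j ⊹ i₀)) (kneser-weights j i₀)
            where
            go : ∀ x y → (1ℤ ≤ + x → 1ℤ ≤ + M → 1ℤ ≤ + y → + p * (+ x + + M + + y) ≤ (+ p + 1ℤ) * + Q) →
              + p * (+ (x ⊓ r) + + (y ⊓ r)) ≤ (⟦ 0 <ᵇ x ⟧ + ⟦ 0 <ᵇ y ⟧) * (+ p * + r) - ⟦ (0 <ᵇ x) ∧ (0 <ᵇ y) ⟧ * (+ p * + r - (+ 2 * + r + + D))
            go ℕ.zero ℕ.zero _ = ℤ.≤-reflexive (lem (+ p) (+ p * + r) (+ p * + r - (+ 2 * + r + + D)))
              where
              lem : ∀ p a b → p * (0ℤ + 0ℤ) ≡ (0ℤ + 0ℤ) * a - 0ℤ * b
              lem = solve-∀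
            go ℕ.zero (suc y) _ = 0≤⇒≤ _ (0≤* (0≤+ℕ p) (≤⇒0≤ (+≤+ (ℕ.m⊓n≤n (suc y) r)))) (lem (+ p) (+ r) (+ (suc y ⊓ r)) (+ p * + r - (+ 2 * + r + + D)))
              where
              lem : ∀ p r y b → p * (r - y) ≡ (0ℤ + 1ℤ) * (p * r) - 0ℤ * b - p * (0ℤ + y)
              lem = solve-∀
            go (suc x) ℕ.zero _ = 0≤⇒≤ _ (0≤* (0≤+ℕ p) (≤⇒0≤ (+≤+ (ℕ.m⊓n≤n (suc x) r)))) (lem (+ p) (+ r) (+ (suc x ⊓ r)) (+ p * + r - (+ 2 * + r + + D)))
              where
              lem : ∀ p r x b → p * (r - x) ≡ (1ℤ + 0ℤ) * (p * r) - 0ℤ * b - p * (x + 0ℤ)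
              lem = solve-∀
            go (suc x) (suc y) k = 0≤⇒≤ _ (0≤+ (≤⇒0≤ (k (+≤+ (ℕ.s≤s ℕ.z≤n)) (+≤+ (ℕ.≤-<-trans ℕ.z≤n r<M)) (+≤+ (ℕ.s≤s ℕ.z≤n))))
                  (0≤+ (0≤* (0≤+ℕ p) (≤⇒0≤ (+≤+ (ℕ.m⊓n≤m (suc x) r)))) (0≤* (0≤+ℕ p) (≤⇒0≤ (+≤+ (ℕ.m⊓n≤m (suc y) r))))))
                (trans (cong₂ (λ q M → ((+ p + 1ℤ) * q - + p * (+ suc x + M + + suc y)) + (+ p * (+ suc x - + (suc x ⊓ r)) + + p * (+ suc y - + (suc y ⊓ r)))) Qℤ Mℤ)
                  (lem (+ p) (+ r) (+ D) (+ suc x) (+ suc y) (+ (suc x ⊓ r)) (+ (suc y ⊓ r))))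
              where
              lem : ∀ p r D x y x′ y′ → ((p + 1ℤ) * (+ 2 * r + D) - p * (x + (r + D) + y)) + (p * (x - x′) + p * (y - y′))
                ≡ (1ℤ + 1ℤ) * (p * r) - 1ℤ * (p * r - (+ 2 * r + D)) - p * (x′ + y′)
              lem = solve-∀

        -- The index i₀ + i₀ is outside the support, because twice the peak exceeds Q.
        s≤p-1 : s ≤ + 3 * m - + 2
        s≤p-1 = 0≤⇒≤ _ (≤⇒0≤ (subst (s + 1ℤ ≤_) size≡p (card-strict {supp} {λ _ → true} (i₀ ⊹ i₀) (λ _ _ → refl) refl
            (heavy-pair i₀ i₀ (subst (+ Q + 1ℤ ≤_) (lem₀ (+ M)) heavy)))))
            (trans (cong (_- (s + 1ℤ)) p≡3m-1) (lem m s))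
          where
          lem₀ : ∀ x → + 2 * x ≡ x + x
          lem₀ = solve-∀
          lem : ∀ m s → + 3 * m - 1ℤ - (s + 1ℤ) ≡ + 3 * m - + 2 - s
          lem = solve-∀

        s≤m : s ≤ m
        s≤m = SupportArithmetic.support≤m m s P R X (+ r) (+ D) (0≤+ℕ r) (1≤+ℕ (ℕ.m<n⇒0<n∸m r<M)) X≤ R≤
          (subst (λ t → + 2 * s - t ≤ P) p≡3m-1 P≥)
          (subst (λ t → + 2 * t * R ≤ + 2 * s * t * + r - P * (t * + r - (+ 2 * + r + + D))) p≡3m-1 R≤′)
          1≤m
          (subst (λ t → (+ 2 * t * m - t + + 2) * (+ 2 * + r + + D) ≤ + 2 * t * (R + X)) p≡3m-1
            (subst₂ (λ q n → (+ 2 * + p * m - + p + + 2) * q ≤ + 2 * + p * n) Qℤ N≡R+X dense))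
          s≤p-1

        1≤Q : 1ℤ ≤ + Q
        1≤Q = +≤+ (ℕ.≤-trans (ℕ.≤-<-trans ℕ.z≤n r<M) (c≤Q i₀))

        m≤s : m ≤ s
        m≤s with m ℤ.≤? s
        ... | yes h = h
        ... | no h = ⊥-elim (0≰-1
            (0≤+ (≤⇒0≤ dense) (0≤+ (0≤* (0≤* (0≤+ℕ 2) (0≤+ℕ p)) (≤⇒0≤ N≤sQ)) (0≤+ (0≤* (0≤* (0≤* (0≤+ℕ 2) (0≤+ℕ p)) (0≤+ℕ Q)) (≤⇒0≤ (≰⇒1+≤ h)))
              (0≤+ (0≤* (0≤+ℕ p) (0≤+ℕ Q)) (0≤+ (0≤* (0≤+ℕ 2) (≤⇒0≤ 1≤Q)) (0≤+ℕ 1))))))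
            (lem (+ p) m (+ Q) N s))
          where
          N≤sQ : N ≤ s * + Q
          N≤sQ = subst (N ≤_) (∑-*ʳ elems (+ Q) _) (∑-mono elems bound)
            where
            bound : ∀ i → + c i ≤ ⟦ supp i ⟧ * + Q
            bound i with c i | c≤Q i
            ... | ℕ.zero | _ = ℤ.≤-reflexive (sym (ℤ.*-zeroˡ (+ Q)))
            ... | suc k | h = subst (+ suc k ≤_) (sym (ℤ.*-identityˡ (+ Q))) (+≤+ h)
          lem : ∀ p m q n s → (+ 2 * p * n - (+ 2 * p * m - p + + 2) * q) + (+ 2 * p * (s * q - n) + (+ 2 * p * q * (m - (1ℤ + s)) + (p * q + (+ 2 * (q - 1ℤ) + + 1)))) ≡ - 1ℤ
          lem = solve-∀

        s≡m : s ≡ m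
        s≡m = ℤ.≤-antisym s≤m m≤s

        -- Of the m weights the others are at most Q each, so N ≤ (m - 1)Q + c i, while the density
        -- exceeds (m - 1/2)Q.
        supp-heavy : ∀ i → supp i ≡ true → + Q + 1ℤ ≤ + 2 * + c i
        supp-heavy i hi with + 2 * + c i ℤ.≤? + Q
        ... | no h = subst (_≤ + 2 * + c i) (ℤ.+-comm 1ℤ (+ Q)) (≰⇒1+≤ h)
        ... | yes h = ⊥-elim (0≰-1
            (0≤+ (≤⇒0≤ dense) (0≤+ (0≤* (0≤* (0≤+ℕ 2) (0≤+ℕ p)) (≤⇒0≤ N≤)) (0≤+ (0≤* (0≤+ℕ p) (≤⇒0≤ h)) (0≤+ (0≤* (0≤* (0≤* (0≤+ℕ 2) (0≤+ℕ p)) (0≤+ℕ Q)) (≤⇒0≤ s≤m)) (0≤+ (0≤* (0≤+ℕ 2) (≤⇒0≤ 1≤Q)) (0≤+ℕ 1))))))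
            (lem (+ p) m (+ Q) N s (+ c i)))
          where
          N≤ : N ≤ s * + Q - (+ Q - + c i)
          N≤ = subst (N ≤_) (trans (∑-⊖ elems _ _) (cong₂ _-_ (∑-*ʳ elems (+ Q) _) (pick i (λ _ → + Q - + c i)))) (∑-mono elems bound)
            where
            value : ∀ j → + c j ≤ ⟦ supp j ⟧ * + Q
            value j with c j | c≤Q j
            ... | ℕ.zero | _ = ℤ.≤-reflexive (sym (ℤ.*-zeroˡ (+ Q)))
            ... | suc k | h = subst (+ suc k ≤_) (sym (ℤ.*-identityˡ (+ Q))) (+≤+ h)
            bound : ∀ j → + c j ≤ ⟦ supp j ⟧ * + Q - ⟦ does (j ≟ i) ⟧ * (+ Q - + c i)
            bound j with j ≟ i
            ... | yes refl rewrite hi = ℤ.≤-reflexive (lem₁ (+ Q) (+ c j))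
              where
              lem₁ : ∀ q x → x ≡ 1ℤ * q - 1ℤ * (q - x)
              lem₁ = solve-∀
            ... | no _ = subst (+ c j ≤_) (lem₂ (⟦ supp j ⟧ * + Q) (+ Q - + c i)) (value j)
              where
              lem₂ : ∀ a b → a ≡ a - 0ℤ * b
              lem₂ = solve-∀
          lem : ∀ p m q n s x → (+ 2 * p * n - (+ 2 * p * m - p + + 2) * q) + (+ 2 * p * (s * q - (q - x) - n) + (p * (q - + 2 * x) + (+ 2 * p * q * (m - s) + (+ 2 * (q - 1ℤ) + + 1)))) ≡ - 1ℤ
          lem = solve-∀

        supp-sum-free : ∀ i j → supp i ≡ true → supp j ≡ true → supp (i ⊹ j) ≡ false
        supp-sum-free i j hi hj = heavy-pair i j (*-cancel-≤ {+ 2} {+ Q + 1ℤ} {+ c i + + c j} (+≤+ (ℕ.s≤s ℕ.z≤n))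
            (0≤⇒≤ _ (0≤+ (≤⇒0≤ (supp-heavy i hi)) (≤⇒0≤ (supp-heavy j hj))) (lem (+ Q) (+ c i) (+ c j))))
          where
          lem : ∀ q x y → (+ 2 * x - (q + 1ℤ)) + (+ 2 * y - (q + 1ℤ)) ≡ + 2 * (x + y) - + 2 * (q + 1ℤ)
          lem = solve-∀

      support-structure : ∀ i₁ → + Q + 1ℤ ≤ + 2 * + c i₁ →
        card supp ≡ m × (∃ λ i → supp i ≡ true) × (∀ i j → supp i ≡ true → supp j ≡ true → supp (i ⊹ j) ≡ false)
      support-structure i₁ h = Peak.s≡m i₀ max heavy , (i₀ , <ᵇ-true (ℕ.≤-<-trans ℕ.z≤n (Peak.r<M i₀ max heavy))) , Peak.supp-sum-free i₀ max heavy
        where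
        peak = maximum finite c Q c≤Q i₁
        i₀ = proj₁ peak
        max = proj₂ peak
        heavy : + Q + 1ℤ ≤ + 2 * + c i₀
        heavy = ℤ.≤-trans h (ℤ.*-monoˡ-≤-nonNeg (+ 2) (+≤+ (max i₁)))

-- Sum-free sets of (p + 1)/3 residues

module ArithmeticProgressions where

  open import Data.Integer using (ℤ; +_; -_; _+_; _-_; _≤_; 1ℤ)
  open FiniteSums
  open SumsetTheory

  some : ∀ {X : Set} → Finite X → (X → Bool) → Bool
  some F P = not (every F (λ x → not (P x)))

  some-intro : ∀ {X : Set} (F : Finite X) {P} x → P x ≡ true → some F P ≡ true
  some-intro F {P} x h = cong not (¬true⇒false (λ e → true≢false h (not-elim (every-elim F e x))))

  some-elim : ∀ {X : Set} (F : Finite X) {P} → some F P ≡ true → ∃ λ x → P x ≡ true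
  some-elim F {P} e with every-false F (not-elim e)
  ... | x , h = x , ¬false⇒true (λ h′ → true≢false (cong not h′) h)

  first-exit : ∀ (P : ℕ → Bool) t → P 0 ≡ true → P t ≡ false →
    ∃ λ j → j ℕ.< t × (∀ i → i ℕ.≤ j → P i ≡ true) × P (suc j) ≡ false
  first-exit P ℕ.zero h₀ hₜ = ⊥-elim (true≢false h₀ hₜ)
  first-exit P (suc t) h₀ hₜ with P 1 in e
  ... | false = 0 , ℕ.s≤s ℕ.z≤n , (λ { ℕ.zero _ → h₀ }) , e
  ... | true with first-exit (λ i → P (suc i)) t e hₜ
  ...   | j , j<t , before , after = suc j , ℕ.s≤s j<t , (λ { ℕ.zero _ → h₀ ; (suc i) (ℕ.s≤s i≤j) → before i i≤j }) , after

  module Progressions {p : ℕ} {G : Set} (E : ElementaryAbelian p G) (pr : Prime p) (size≡p : ElementaryAbelian.size E ≡ + p) where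
    open Elementary E
    open Primal pr

    trivial : Subgroup
    trivial = record
      { mem = λ x → does (x ≟ 0#)
      ; 0∈ = does-yes (0# ≟ 0#) refl
      ; +∈ = λ {x} {y} hx hy → does-yes (x ⊹ y ≟ 0#) (trans (cong₂ _⊹_ (yes-does (x ≟ 0#) hx) (yes-does (y ≟ 0#) hy)) (identityˡ 0#)) }

    module _ (d : G) (d≢0 : d ≢ 0#) where

      ⋆-injective : ∀ {i j} → i ℕ.< p → j ℕ.< p → i ⋆ d ≡ j ⋆ d → i ≡ j
      ⋆-injective {i} {j} i<p j<p e = trans (sym (Fin.toℕ-fromℕ< i<p)) (trans (cong toℕ
        (translates-distinct trivial {d} {i ⋆ d} (does-no (d ≟ 0#) d≢0) (fromℕ< i<p) (fromℕ< j<p) (vanish i<p refl) (vanish j<p e)))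
        (Fin.toℕ-fromℕ< j<p))
        where
        vanish : ∀ {k} (k<p : k ℕ.< p) → i ⋆ d ≡ k ⋆ d → does ((i ⋆ d) ⊝ (toℕ (fromℕ< k<p) ⋆ d) ≟ 0#) ≡ true
        vanish k<p e′ = does-yes (_ ≟ 0#) (trans (cong (λ l → (i ⋆ d) ⊝ (l ⋆ d)) (Fin.toℕ-fromℕ< k<p)) (trans (cong (_⊝ _) e′) (inverseʳ _)))

      progression : G → ℕ → G → Bool
      progression u k x = some (finFinite k) (λ t → does (x ≟ u ⊹ toℕ t ⋆ d))

      progression-∋ : ∀ u {k t} → t ℕ.< k → progression u k (u ⊹ t ⋆ d) ≡ true
      progression-∋ u {k} {t} t<k = some-intro (finFinite k) (fromℕ< t<k) (does-yes (_ ≟ _) (cong (λ s → u ⊹ s ⋆ d) (sym (Fin.toℕ-fromℕ< t<k))))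

      progression-elim : ∀ u {k x} → progression u k x ≡ true → ∃ λ t → t ℕ.< k × x ≡ u ⊹ t ⋆ d
      progression-elim u {k} {x} h with some-elim (finFinite k) h
      ... | t , e = toℕ t , Fin.toℕ<n t , yes-does (x ≟ _) e

      hits : ∀ u k → G → ℤ
      hits u k x = Finite.card (finFinite k) (λ t → does (x ≟ u ⊹ toℕ t ⋆ d))

      hits-total : ∀ u k → sum (hits u k) ≡ + k
      hits-total u k = trans (∑-swap elems (Finite.elems (finFinite k)) _)
        (trans (∑-cong (Finite.elems (finFinite k)) (λ t → once (u ⊹ toℕ t ⋆ d))) (size-Fin k))

      progression-card≤ : ∀ u k → card (progression u k) ≤ + k
      progression-card≤ u k = subst (card (progression u k) ≤_) (hits-total u k) (∑-mono elems bound)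
        where
        bound : ∀ x → ⟦ progression u k x ⟧ ≤ hits u k x
        bound x with progression u k x in e
        ... | true = Finite.card≥1 (finFinite k) (proj₁ (some-elim (finFinite k) e)) (proj₂ (some-elim (finFinite k) e))
        ... | false = Finite.card≥0 (finFinite k) _

      progression-card≥ : ∀ u k → k ℕ.≤ p → + k ≤ card (progression u k)
      progression-card≥ u k k≤p = subst (_≤ card (progression u k)) (hits-total u k) (∑-mono elems bound)
        where
        bound : ∀ x → hits u k x ≤ ⟦ progression u k x ⟧
        bound x with progression u k x in e
        ... | true = Finite.card≤1 (finFinite k) (λ s t hs ht → Fin.toℕ-injective (⋆-injective (ℕ.<-≤-trans (Fin.toℕ<n s) k≤p) (ℕ.<-≤-trans (Fin.toℕ<n t) k≤p)
                (⊹-cancelˡ u (trans (sym (yes-does (x ≟ _) hs)) (yes-does (x ≟ _) ht)))))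
        ... | false = ℤ.≤-reflexive (Finite.card-empty (finFinite k) (λ t → ¬true⇒false (λ h → true≢false (some-intro (finFinite k) t h) e)))

      multiples : ∀ x → ∃ λ t → t ℕ.< p × x ≡ t ⋆ d
      multiples x with progression-elim 0# {p} {x} (card-⊆-≥ {progression 0# p} {λ _ → true} (λ _ _ → refl)
          (subst (_≤ card (progression 0# p)) (sym size≡p) (progression-card≥ 0# p ℕ.≤-refl)) x refl)
      ... | t , t<p , e = t , t<p , trans e (identityˡ _)

    module MiddleThird (S : G → Bool) (m : ℕ) (3m≡p+1 : 3 ℕ.* m ≡ suc p) (S-card : card S ≡ + m)
      (sum-free : ∀ i j → S i ≡ true → S j ≡ true → S (i ⊹ j) ≡ false) where

      0∉S : S 0# ≡ false
      0∉S = ¬true⇒false (λ h → true≢false (subst (λ x → S x ≡ true) (sym (identityˡ 0#)) h) (sum-free 0# 0# h h))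

      p+1≡ : suc p ≡ m ℕ.+ (m ℕ.+ m)
      p+1≡ = trans (sym 3m≡p+1) (cong (λ k → m ℕ.+ (m ℕ.+ k)) (ℕ.+-identityʳ m))

      Dilate : G → Set
      Dilate d = ∀ x → S x ≡ true → ∃ λ k → m ℕ.≤ k × k ℕ.+ 1 ℕ.≤ 2 ℕ.* m × x ≡ k ⋆ d

      module _ (d : G) (d≢0 : d ≢ 0#) (one-end : card (λ c → not (S c) ∧ not (not (S (c ⊝ d)))) ≤ 1ℤ) (y₀ : G) (y₀∈ : S y₀ ≡ true) where

        run : ∀ y → S y ≡ true → ∃ λ j → suc j ℕ.≤ m × S (y ⊹ j ⋆ d) ≡ true × S (y ⊹ suc j ⋆ d) ≡ false
        run y y∈ with multiples d d≢0 (⊟ y)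
        ... | t , t<p , e with first-exit (λ i → S (y ⊹ i ⋆ d)) t (subst (λ x → S x ≡ true) (sym (identityʳ y)) y∈)
                             (subst (λ x → S x ≡ false) (sym (trans (cong (y ⊹_) (sym e)) (inverseʳ y))) 0∉S)
        ...   | j , j<t , before , after = j , j<m , before j ℕ.≤-refl , after
          where
          j<m : suc j ℕ.≤ m
          j<m = ℤ.drop‿+≤+ (subst (+ suc j ≤_) S-card (ℤ.≤-trans (progression-card≥ d d≢0 y (suc j) (ℕ.≤-trans j<t (ℕ.<⇒≤ t<p)))
            (card-mono (λ x h → inside (progression-elim d d≢0 y h)))))
            where
            inside : ∀ {x} → (∃ λ i → i ℕ.< suc j × x ≡ y ⊹ i ⋆ d) → S x ≡ true
            inside (i , ℕ.s≤s i≤j , refl) = before i i≤j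

        end : ∀ y j → S (y ⊹ j ⋆ d) ≡ true → S (y ⊹ suc j ⋆ d) ≡ false → not (S (y ⊹ suc j ⋆ d)) ∧ not (not (S (y ⊹ suc j ⋆ d ⊝ d))) ≡ true
        end y j h h′ = ∧-intro (cong not h′) (cong (λ b → not (not b)) (trans (cong S (back y j)) h))
          where
          back : ∀ y j → y ⊹ suc j ⋆ d ⊝ d ≡ y ⊹ j ⋆ d
          back y j = trans (cong (λ x → y ⊹ x ⊝ d) (comm d (j ⋆ d))) (trans (cong (_⊝ d) (sym (assoc y (j ⋆ d) d))) (add-sub _ d))

        j₀ : ℕ
        j₀ = proj₁ (run y₀ y₀∈)

        u : G
        u = (y₀ ⊹ suc j₀ ⋆ d) ⊝ m ⋆ d

        S⊆ : ∀ y → S y ≡ true → progression d d≢0 u m y ≡ true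
        S⊆ y y∈ = subst (λ x → progression d d≢0 u m x ≡ true) (sym eq) (progression-∋ d d≢0 u (ℕ.∸-monoʳ-< (ℕ.s≤s ℕ.z≤n) j<m))
          where
          j = proj₁ (run y y∈)
          j<m = proj₁ (proj₂ (run y y∈))
          h = proj₁ (proj₂ (proj₂ (run y y∈)))
          h′ = proj₂ (proj₂ (proj₂ (run y y∈)))
          same : y ⊹ suc j ⋆ d ≡ y₀ ⊹ suc j₀ ⋆ d
          same = card<2 {λ c → not (S c) ∧ not (not (S (c ⊝ d)))} one-end (y ⊹ suc j ⋆ d) (y₀ ⊹ suc j₀ ⋆ d) (end y j h h′) (end y₀ j₀ (proj₁ (proj₂ (proj₂ (run y₀ y₀∈)))) (proj₂ (proj₂ (proj₂ (run y₀ y₀∈)))))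
          eq : y ≡ u ⊹ (m ∸ suc j) ⋆ d
          eq = begin
            y                                                              ≡⟨ sym (add-sub y (suc j ⋆ d)) ⟩
            (y ⊹ suc j ⋆ d) ⊝ suc j ⋆ d                                    ≡⟨ cong (_⊝ suc j ⋆ d) (sym (sub-add _ (m ⋆ d))) ⟩
            ((y ⊹ suc j ⋆ d) ⊝ m ⋆ d ⊹ m ⋆ d) ⊝ suc j ⋆ d                  ≡⟨ cong (λ x → (x ⊝ m ⋆ d ⊹ m ⋆ d) ⊝ suc j ⋆ d) same ⟩
            (u ⊹ m ⋆ d) ⊝ suc j ⋆ d                                        ≡⟨ cong (λ k → (u ⊹ k ⋆ d) ⊝ suc j ⋆ d) (sym (ℕ.m∸n+n≡m j<m)) ⟩
            (u ⊹ (m ∸ suc j ℕ.+ suc j) ⋆ d) ⊝ suc j ⋆ d                    ≡⟨ cong (λ x → (u ⊹ x) ⊝ suc j ⋆ d) (Mult.×-homo-+ d (m ∸ suc j) (suc j)) ⟩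
            (u ⊹ ((m ∸ suc j) ⋆ d ⊹ suc j ⋆ d)) ⊝ suc j ⋆ d                ≡⟨ cong (_⊝ suc j ⋆ d) (sym (assoc u _ _)) ⟩
            (u ⊹ (m ∸ suc j) ⋆ d ⊹ suc j ⋆ d) ⊝ suc j ⋆ d                  ≡⟨ add-sub _ _ ⟩
            u ⊹ (m ∸ suc j) ⋆ d                                            ∎
            where open ≡-Reasoning

        S⊇ : ∀ k → k ℕ.< m → S (u ⊹ k ⋆ d) ≡ true
        S⊇ k k<m = card-⊆-≥ S⊆ (subst (card (progression d d≢0 u m) ≤_) (sym S-card) (progression-card≤ d d≢0 u m)) _ (progression-∋ d d≢0 u k<m)

        0<m : 0 ℕ.< m
        0<m = ℕ.≤-trans (ℕ.s≤s ℕ.z≤n) (proj₁ (proj₂ (run y₀ y₀∈)))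

        u∈S : S u ≡ true
        u∈S = subst (λ x → S x ≡ true) (identityʳ u) (S⊇ 0 0<m)

        -- Writing u = αd, the sums of elements of S are u + (α + i)d with 0 ≤ i ≤ 2m - 2; none may return to S.
        α : ℕ
        α = proj₁ (multiples d d≢0 u)

        α<p : α ℕ.< p
        α<p = proj₁ (proj₂ (multiples d d≢0 u))

        u≡α⋆d : u ≡ α ⋆ d
        u≡α⋆d = proj₂ (proj₂ (multiples d d≢0 u))

        α≮m : ¬ α ℕ.< m
        α≮m α<m = true≢false (S⊇ α α<m) (subst (λ x → S (u ⊹ x) ≡ false) u≡α⋆d (sum-free u u u∈S u∈S))

        m≮α : ¬ m ℕ.< α
        m≮α m<α = true≢false u∈S (subst (λ x → S x ≡ false) wrap (sum-free _ _ (S⊇ i₁ i₁<m) (S⊇ i₂ i₂<m)))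
          where
          i i₁ i₂ m′ : ℕ
          i = p ∸ α
          m′ = ℕ.pred m
          i₁ = m′ ⊓ i
          i₂ = i ∸ m′
          m≡ : m ≡ suc m′
          m≡ = sym (ℕ.suc-pred m {{ℕ.>-nonZero 0<m}})
          i₁<m : i₁ ℕ.< m
          i₁<m = ℕ.≤-trans (ℕ.s≤s (ℕ.m⊓n≤m m′ i)) (ℕ.≤-reflexive (sym m≡))
          p≤ : p ℕ.≤ α ℕ.+ (m′ ℕ.+ m′)
          p≤ = ℕ.s≤s⁻¹ (ℕ.≤-trans (ℕ.≤-reflexive (trans p+1≡ (trans (cong (λ k → m ℕ.+ (k ℕ.+ k)) m≡) (trans (cong (m ℕ.+_) (cong suc (ℕ.+-suc m′ m′))) (trans (ℕ.+-suc m _) (cong suc (ℕ.+-suc m _)))))))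
                (ℕ.s≤s (ℕ.+-monoˡ-≤ (m′ ℕ.+ m′) m<α)))
          i₂<m : i₂ ℕ.< m
          i₂<m = ℕ.≤-trans (ℕ.s≤s (ℕ.m≤n+o⇒m∸n≤o i m′ (ℕ.m≤n+o⇒m∸n≤o p α p≤))) (ℕ.≤-reflexive (sym m≡))
          total : i₁ ℕ.+ i₂ ≡ i
          total = ℕ.m⊓n+n∸m≡n m′ i
          wrap : (u ⊹ i₁ ⋆ d) ⊹ (u ⊹ i₂ ⋆ d) ≡ u
          wrap = begin
            (u ⊹ i₁ ⋆ d) ⊹ (u ⊹ i₂ ⋆ d)      ≡⟨ CP.interchange u (i₁ ⋆ d) u (i₂ ⋆ d) ⟩
            (u ⊹ u) ⊹ (i₁ ⋆ d ⊹ i₂ ⋆ d)      ≡⟨ cong ((u ⊹ u) ⊹_) (trans (sym (Mult.×-homo-+ d i₁ i₂)) (cong (_⋆ d) total)) ⟩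
            (u ⊹ u) ⊹ i ⋆ d                  ≡⟨ assoc u u (i ⋆ d) ⟩
            u ⊹ (u ⊹ i ⋆ d)                  ≡⟨ cong (λ x → u ⊹ (x ⊹ i ⋆ d)) u≡α⋆d ⟩
            u ⊹ (α ⋆ d ⊹ i ⋆ d)              ≡⟨ cong (u ⊹_) (trans (sym (Mult.×-homo-+ d α i)) (cong (_⋆ d) (ℕ.m+[n∸m]≡n (ℕ.<⇒≤ α<p)))) ⟩
            u ⊹ p ⋆ d                        ≡⟨ trans (cong (u ⊹_) (torsion d)) (identityʳ u) ⟩
            u                                ∎
            where open ≡-Reasoning

        u≡m⋆d : u ≡ m ⋆ d
        u≡m⋆d = trans u≡α⋆d (cong (_⋆ d) (ℕ.≤-antisym (ℕ.≮⇒≥ m≮α) (ℕ.≮⇒≥ α≮m)))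

        dilate : Dilate d
        dilate x x∈ = m ℕ.+ k , ℕ.m≤m+n m k ,
            ℕ.≤-trans (ℕ.≤-reflexive (trans (ℕ.+-assoc m k 1) (cong (m ℕ.+_) (ℕ.+-comm k 1)))) (ℕ.≤-trans (ℕ.+-monoʳ-≤ m k<m) (ℕ.≤-reflexive (cong (m ℕ.+_) (sym (ℕ.+-identityʳ m))))) ,
            trans e (trans (cong (_⊹ k ⋆ d) u≡m⋆d) (sym (Mult.×-homo-+ d m k)))
          where
          k = proj₁ (progression-elim d d≢0 u (S⊆ x x∈))
          k<m = proj₁ (proj₂ (progression-elim d d≢0 u (S⊆ x x∈)))
          e = proj₂ (proj₂ (progression-elim d d≢0 u (S⊆ x x∈)))

      middle-third : (∃ λ y → S y ≡ true) → ∃ λ d → d ≢ 0# × Dilate d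
      middle-third (y₀ , y₀∈) with + 2 ℤ.≤? card S
      ... | no h = y₀ , (λ e → true≢false (subst (λ x → S x ≡ true) e y₀∈) 0∉S) , only
        where
        S≤1 : card S ≤ 1ℤ
        S≤1 = 0≤⇒≤ _ (≤⇒0≤ (≰⇒1+≤ h)) (lem (card S))
          where
          lem : ∀ c → + 2 - (1ℤ + c) ≡ 1ℤ - c
          lem = solve-∀
        1≤m : 1 ℕ.≤ m
        1≤m = ℤ.drop‿+≤+ (subst (1ℤ ≤_) S-card (card≥1 y₀ y₀∈))
        m≤1 : m ℕ.≤ 1
        m≤1 = ℤ.drop‿+≤+ (subst (_≤ 1ℤ) S-card S≤1)
        only : Dilate y₀
        only x x∈ = 1 , m≤1 , ℕ.*-monoʳ-≤ 2 1≤m , trans (card<2 S≤1 x y₀ x∈ y₀∈) (sym (identityʳ y₀))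
      ... | yes 2≤S = proj₁ v , proj₁ (proj₂ v) , dilate (proj₁ v) (proj₁ (proj₂ v)) (proj₂ (proj₂ v)) y₀ y₀∈
        where
        critical : card (λ x → not (S x)) + 1ℤ ≤ card S + card S
        critical = ℤ.≤-reflexive (trans (lem₁ (card S) (card (λ x → not (S x)))) (trans (cong (λ t → t + 1ℤ - card S) (trans (card-not S) size≡p))
          (trans (cong (_- card S) (trans (cong +_ (trans (ℕ.+-comm p 1) p+1≡)) (cong (λ t → t + (t + t)) (sym S-card)))) (lem₂ (card S)))))
          where
          lem₁ : ∀ s n → n + 1ℤ ≡ s + n + 1ℤ - s
          lem₁ = solve-∀
          lem₂ : ∀ s → s + (s + s) - s ≡ s + s
          lem₂ = solve-∀
        v = vosper size≡p m S S (λ x → not (S x)) {y₀} 2≤S 2≤S (ℤ.≤-reflexive S-card)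
          (λ x y hx hy → cong not (sum-free x y hx hy)) (cong not y₀∈) critical

module Assembly where

  open import Defs
  open import Data.Integer using (∣_∣; +_; -_; _+_; _*_; _-_; _≤_; _<_; 0ℤ; 1ℤ; +≤+)
  open FiniteSums
  open SumsetTheory
  open PrimeFieldVectors
  open FibreStatistics
  open HeavyFibres
  open FibreSumsets
  open SupportStructure
  open ArithmeticProgressions

  T⇒≡ : ∀ {b} → T b → b ≡ true
  T⇒≡ {true} _ = refl

  ≡⇒T : ∀ {b} → b ≡ true → T b
  ≡⇒T refl = tt

  length-filter : ∀ {X : Set} (A : X → Bool) xs → + length (filter (λ x → T? (A x)) xs) ≡ ∑ xs (λ x → ⟦ A x ⟧)
  length-filter A [] = refl
  length-filter A (x ∷ xs) with A x
  ... | true = cong (λ z → 1ℤ + z) (length-filter A xs)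
  ... | false = trans (length-filter A xs) (sym (ℤ.+-identityˡ _))

  3[p+1]/3 : ∀ p → p % 3 ≡ 2 → 3 ℕ.* (suc p / 3) ≡ suc p
  3[p+1]/3 p h = trans (cong (3 ℕ.*_) (trans (cong (_/ 3) p+1≡) (m*n/n≡m (suc (p / 3)) 3))) (trans (ℕ.*-comm 3 (suc (p / 3))) (sym p+1≡))
    where
    p+1≡ : suc p ≡ suc (p / 3) ℕ.* 3
    p+1≡ = cong suc (trans (m≡m%n+[m/n]*n p 3) (cong (ℕ._+ (p / 3) ℕ.* 3) h))

  module Density (p : ℕ) (p%3≡2 : p % 3 ≡ 2) where

    m : ℕ
    m = suc p / 3

    3m≡p+1 : 3 ℕ.* m ≡ suc p
    3m≡p+1 = 3[p+1]/3 p p%3≡2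

    1≤m : 1 ℕ.≤ m
    1≤m = ℕ.n≢0⇒n>0 (λ e → ℕ.1+n≢0 (trans (sym 3m≡p+1) (trans (cong (3 ℕ.*_) e) refl)))

    p≤2pm : p ℕ.≤ 2 ℕ.* p ℕ.* m
    p≤2pm = ℕ.≤-trans (ℕ.≤-reflexive (sym (ℕ.*-identityʳ p))) (ℕ.*-mono-≤ (ℕ.m≤m+n p (p ℕ.+ 0)) 1≤m)

    coefficient>0 : 0 ℕ.< 2 ℕ.* p ℕ.* m ℕ.+ 2 ∸ p
    coefficient>0 = ℕ.m<n⇒0<n∸m (ℕ.≤-<-trans p≤2pm (ℕ.m<m+n (2 ℕ.* p ℕ.* m) (ℕ.s≤s ℕ.z≤n)))

    coefficient : + (2 ℕ.* p ℕ.* m ℕ.+ 2 ∸ p) ≡ + 2 * + p * + m - + p + + 2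
    coefficient = trans (sym (ℤ.⊖-≥ (ℕ.≤-trans p≤2pm (ℕ.m≤m+n _ 2)))) (trans (sym (ℤ.m-n≡m⊖n (2 ℕ.* p ℕ.* m ℕ.+ 2) p))
      (trans (cong (λ z → z + + 2 - + p) (trans (ℤ.pos-* (2 ℕ.* p) m) (cong (_* + m) (ℤ.pos-* 2 p)))) (lem (+ 2 * + p * + m) (+ p))))
      where
      lem : ∀ x p → x + + 2 - p ≡ x - p + + 2
      lem = solve-∀

    3mℤ : + 3 * + m ≡ + p + 1ℤ
    3mℤ = trans (sym (ℤ.pos-* 3 m)) (trans (cong +_ (trans 3m≡p+1 (ℕ.+-comm 1 p))) refl)

    dense-ℤ : ∀ q N → 0 ℕ.< p → (2 ℕ.* p ℕ.* m ℕ.+ 2 ∸ p) ℕ.* (p ℕ.* q) ℕ.≤ 2 ℕ.* p ℕ.* p ℕ.* N →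
      (+ 2 * + p * + m - + p + + 2) * + q ≤ + 2 * + p * + N
    dense-ℤ q N 0<p h = *-cancel-≤ {+ p} {(+ 2 * + p * + m - + p + + 2) * + q} {+ 2 * + p * + N} (1≤+ℕ 0<p)
      (subst₂ _≤_ left right (+≤+ h))
      where
      left : + ((2 ℕ.* p ℕ.* m ℕ.+ 2 ∸ p) ℕ.* (p ℕ.* q)) ≡ + p * ((+ 2 * + p * + m - + p + + 2) * + q)
      left = trans (ℤ.pos-* (2 ℕ.* p ℕ.* m ℕ.+ 2 ∸ p) (p ℕ.* q)) (trans (cong₂ _*_ coefficient (ℤ.pos-* p q)) (lem (+ 2 * + p * + m - + p + + 2) (+ p) (+ q)))
        where
        lem : ∀ k p q → k * (p * q) ≡ p * (k * q)
        lem = solve-∀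
      right : + (2 ℕ.* p ℕ.* p ℕ.* N) ≡ + p * (+ 2 * + p * + N)
      right = trans (ℤ.pos-* (2 ℕ.* p ℕ.* p) N) (trans (cong (_* + N) (trans (ℤ.pos-* (2 ℕ.* p) p) (cong (_* + p) (ℤ.pos-* 2 p)))) (lem (+ p) (+ N)))
        where
        lem : ∀ p n → + 2 * p * p * n ≡ p * (+ 2 * p * n)
        lem = solve-∀

    dense-3 : ∀ q N → (+ 2 * + p * + m - + p + + 2) * q ≤ + 2 * + p * N → (+ 2 * (+ p * + p) - + p + + 6) * q ≤ + 6 * + p * N
    dense-3 q N h = 0≤⇒≤ _ (0≤* (0≤+ℕ 3) (≤⇒0≤ h)) (trans (lem₁ (+ p) (+ m) q N) (trans (cong (λ t → + 6 * + p * N - (+ 2 * + p * t - + 3 * + p + + 6) * q) 3mℤ) (lem₂ (+ p) q N)))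
      where
      lem₁ : ∀ p m q n → + 3 * (+ 2 * p * n - (+ 2 * p * m - p + + 2) * q) ≡ + 6 * p * n - (+ 2 * p * (+ 3 * m) - + 3 * p + + 6) * q
      lem₁ = solve-∀
      lem₂ : ∀ p q n → + 6 * p * n - (+ 2 * p * (p + 1ℤ) - + 3 * p + + 6) * q ≡ + 6 * p * n - (+ 2 * (p * p) - p + + 6) * q
      lem₂ = solve-∀

  module FromFunctional (p : ℕ) .{{_ : NonZero p}} (pr : Prime p) {n : ℕ} where

    open Field p
    private module V = Elementary (vecGroup n)

    module _ (ξ e : Vecp p n) (ξ∙e : ξ ∙ e ≡ ι 1) (d : F) (d≢0 : d ≢ ι 0) where

      ξ∙⋆e : ∀ a → ξ ∙ (toℕ a V.⋆ e) ≡ a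
      ξ∙⋆e a = trans (∙-⋆ ξ (toℕ a) e) (trans (cong (toℕ a 𝔾.⋆_) ξ∙e) (toℕ⋆1 a))

      1≢0 : ι 1 ≢ ι 0
      1≢0 e = ℕ.1+n≢0 (trans (sym (residue 1<p)) (trans (cong toℕ e) (residue (ℕ.<⇒≤ 1<p))))
        where
        1<p : 1 ℕ.< p
        1<p = ℕ.nonTrivial⇒n>1 p {{prime⇒nonTrivial pr}}
        residue : ∀ {k} → k ℕ.< p → toℕ (ι k) ≡ k
        residue {k} k<p = trans (toℕ-ι k) (m<n⇒m%n≡m k<p)

      Kernel : Vecp p n → Set
      Kernel x = ξ ∙ x ≡ ι 0

      subspace : IsSubspace p Kernel
      subspace = record
        { zero-mem = ∙0 ξ
        ; add-mem = λ u v hu hv → trans (∙-⊞ ξ u v) (trans (cong₂ _⊞_ hu hv) (⊞-identityˡ (ι 0)))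
        ; smul-mem = λ a v hv → trans (cong (ξ ∙_) (sym (×-ℕ· (toℕ a) v))) (trans (∙-⋆ ξ (toℕ a) v) (trans (cong (toℕ a 𝔾.⋆_) hv) (𝔾.n⋆0 (toℕ a))))
        }

      remainder : ∀ x y → ξ ∙ x ≡ ξ ∙ y → Kernel (x V.⊝ y)
      remainder x y h = trans (∙-⊝ ξ x y) (trans (cong (𝔾._⊝ (ξ ∙ y)) h) (𝔾.inverseʳ (ξ ∙ y)))

      split : ∀ k x y → x ≡ _⊕_ p (_ℕ·_ p k y) (x V.⊝ (k V.⋆ y))
      split k x y = trans (sym (V.+-cancel- x (k V.⋆ y))) (cong (λ z → z ⊞ⱽ (x V.⊝ (k V.⋆ y))) (×-ℕ· k y))

      codim1 : Codim1 p Kernel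
      codim1 = e , (λ h → 1≢0 (trans (sym ξ∙e) h)) , λ x →
        ξ ∙ x , x V.⊝ (toℕ (ξ ∙ x) V.⋆ e) , remainder x _ (sym (ξ∙⋆e (ξ ∙ x))) , split (toℕ (ξ ∙ x)) x e

      normal : ∀ {m} {A : Subset p n} → (∀ a → A a ≡ true → ∃ λ k → m ℕ.≤ k × k ℕ.+ 1 ℕ.≤ 2 ℕ.* m × ξ ∙ a ≡ k 𝔾.⋆ d) → Normal p m A
      normal slice = Kernel , subspace , codim1 , toℕ d V.⋆ e , (λ h → d≢0 (trans (sym (ξ∙⋆e d)) h)) , λ a a∈ → cover a (slice a (T⇒≡ a∈))
        where
        cover : ∀ {m} a → (∃ λ k → m ℕ.≤ k × k ℕ.+ 1 ℕ.≤ 2 ℕ.* m × ξ ∙ a ≡ k 𝔾.⋆ d) →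
          ∃ λ k → ∃ λ v → m ℕ.≤ k × k ℕ.+ 1 ℕ.≤ 2 ℕ.* m × Kernel v × a ≡ _⊕_ p (_ℕ·_ p k (toℕ d V.⋆ e)) v
        cover a (k , m≤k , k<2m , eq) = k , a V.⊝ (k V.⋆ (toℕ d V.⋆ e)) , m≤k , k<2m ,
          remainder a _ (trans eq (sym (trans (∙-⋆ ξ k _) (cong (k 𝔾.⋆_) (ξ∙⋆e d))))) , split k a (toℕ d V.⋆ e)

  module Conclusion (p : ℕ) .{{_ : NonZero p}} (pr : Prime p) (p%3≡2 : p % 3 ≡ 2) (n : ℕ) (A : Vecp p (suc n) → Bool)
    (sum-free : ∀ x y z → A x ≡ true → A y ≡ true → A z ≡ true → z ≢ _⊕_ p x y) where

    open Density p p%3≡2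
    open Field p
    open Fibres p pr n A sum-free
    open FibreSums p pr n A sum-free

    module Direction (ξ : Vᵖ) (ξ≢0 : ξ ≢ 0ⱽ) (i₁ : F) (heavy : q + 1ℤ ≤ + 2 * c ξ i₁)
      (dense : (+ 2 * + p * + m - + p + + 2) * q ≤ + 2 * + p * N) where

      weight : F → ℕ
      weight i = ∣ c ξ i ∣

      +weight : ∀ i → + weight i ≡ c ξ i
      +weight i = ℤ.0≤i⇒+∣i∣≡i (V.card≥0 (fibre ξ i))

      weight≤ : ∀ i → weight i ℕ.≤ p ^ n
      weight≤ i = ℤ.drop‿+≤+ (subst₂ _≤_ (sym (+weight i)) (on-card ξ ξ≢0 i) (V.card-mono (λ x → ∧-elimʳ {A x})))

      module W = Weights.Bounded fieldGroup pr (size-Fin p) weight (p ^ n) (+ m) 3mℤ (1≤+ℕ 1≤m)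
        (λ i j k → subst₂ (λ a b → a + b ≤ q) (sym (+weight i)) (sym (+weight j)) (fibre-pair ξ ξ≢0 i j (subst (1ℤ ≤_) (+weight (i ⊞ j)) k)))
        (λ i j hi hj hk → subst (λ t → + p * t ≤ (+ p + 1ℤ) * q) (cong₂ _+_ (cong₂ _+_ (sym (+weight i)) (sym (+weight j))) (sym (+weight (i ⊞ j))))
          (fibre-kneser ξ ξ≢0 i j (subst (1ℤ ≤_) (+weight i) hi) (subst (1ℤ ≤_) (+weight j) hj) (subst (1ℤ ≤_) (+weight (i ⊞ j)) hk)))
        weight≤
        (subst (λ t → (+ 2 * + p * + m - + p + + 2) * q ≤ + 2 * + p * t) (sym (trans (∑-cong 𝔾.elems +weight) (c-total ξ))) dense)

      structure = W.support-structure i₁ (subst (λ t → q + 1ℤ ≤ + 2 * t) (sym (+weight i₁)) heavy)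

      third : ∃ λ d → d ≢ ι 0 × (∀ i → W.supp i ≡ true → ∃ λ k → m ℕ.≤ k × k ℕ.+ 1 ℕ.≤ 2 ℕ.* m × i ≡ k 𝔾.⋆ d)
      third = Progressions.MiddleThird.middle-third fieldGroup pr (size-Fin p) W.supp m 3m≡p+1 (proj₁ structure) (proj₂ (proj₂ structure)) (proj₁ (proj₂ structure))

      in-support : ∀ a → A a ≡ true → W.supp (ξ ∙ a) ≡ true
      in-support a a∈ = W.supp-⇐ {ξ ∙ a} (subst (1ℤ ≤_) (sym (+weight (ξ ∙ a))) (V.card≥1 a (∧-intro a∈ (does-yes (ξ ∙ a Fin.≟ ξ ∙ a) refl))))

      normal : Normal p m A
      normal = FromFunctional.normal p pr ξ (proj₁ (dual pr ξ ξ≢0)) (proj₂ (dual pr ξ ξ≢0)) (proj₁ third) (proj₁ (proj₂ third))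
        (λ a a∈ → proj₂ (proj₂ third) (ξ ∙ a) (in-support a a∈))

    normal : (+ 2 * + p * + m - + p + + 2) * q ≤ + 2 * + p * N → Normal p m A
    normal dense = Direction.normal (proj₁ h) (proj₁ (proj₂ h)) (proj₁ (proj₂ (proj₂ h))) (proj₂ (proj₂ (proj₂ h))) dense
      where
      h = HeavyFibre.heavy p pr n A sum-free p%3≡2 (dense-3 q N dense)

  not-dense : ∀ p .{{_ : NonZero p}} → p % 3 ≡ 2 → (A : Subset p 0) → SumFree p A →
    ¬ ((2 ℕ.* p ℕ.* (suc p / 3) ℕ.+ 2 ∸ p) ℕ.* p ^ 0 ℕ.≤ 2 ℕ.* p ℕ.* p ℕ.* card p A)
  not-dense p p%3≡2 A sf dense = ℕ.<⇒≱ positive (subst (λ k → (2 ℕ.* p ℕ.* (suc p / 3) ℕ.+ 2 ∸ p) ℕ.* 1 ℕ.≤ 2 ℕ.* p ℕ.* p ℕ.* k) empty dense)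
    where
    empty : card p A ≡ 0
    empty = ℤ.+-injective (trans (length-filter A (allVecs p 0)) (cong (λ b → ⟦ b ⟧ + 0ℤ) (¬true⇒false (λ h → sf [] [] [] (≡⇒T h) (≡⇒T h) (≡⇒T h) refl))))
    positive : 2 ℕ.* p ℕ.* p ℕ.* 0 ℕ.< (2 ℕ.* p ℕ.* (suc p / 3) ℕ.+ 2 ∸ p) ℕ.* 1
    positive = subst₂ ℕ._<_ (sym (ℕ.*-zeroʳ (2 ℕ.* p ℕ.* p))) (sym (ℕ.*-identityʳ _)) (Density.coefficient>0 p p%3≡2)

  dense⇒normal : ∀ p .{{_ : NonZero p}} → Prime p → p % 3 ≡ 2 → ∀ {n} (A : Subset p (suc n)) → SumFree p A →
    (2 ℕ.* p ℕ.* (suc p / 3) ℕ.+ 2 ∸ p) ℕ.* p ^ suc n ℕ.≤ 2 ℕ.* p ℕ.* p ℕ.* card p A → Normal p (suc p / 3) A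
  dense⇒normal p pr p%3≡2 {n} A sf dense = Conclusion.normal p pr p%3≡2 n A
      (λ x y z hx hy hz e → sf x y z (≡⇒T hx) (≡⇒T hy) (≡⇒T hz) (sym e))
      (subst (λ t → (+ 2 * + p * + m - + p + + 2) * + (p ^ n) ≤ + 2 * + p * t) (length-filter A (allVecs p (suc n)))
        (dense-ℤ (p ^ n) (card p A) (ℕ.>-nonZero⁻¹ p {{prime⇒nonZero pr}}) dense))
    where
    open Density p p%3≡2

open import Defs
open import Data.Nat using (ℕ; suc; _+_; _*_; _∸_; _^_; _≤_; NonZero)
open import Data.Nat.DivMod using (_%_; _/_)
open import Data.Nat.Primality using (Prime)
open import Relation.Binary.PropositionalEquality using (_≡_)

theorem1p5 : (p : ℕ) → .{{_ : NonZero p}} → Prime p → p % 3 ≡ 2 →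
    (n : ℕ) (A : Subset p n) → SumFree p A →
    (2 * p * ((suc p) / 3) + 2 ∸ p) * p ^ n ≤ 2 * p * p * card p A →
    Normal p ((suc p) / 3) A
theorem1p5 p pr p%3≡2 ℕ.zero A sf dense = ⊥-elim (Assembly.not-dense p p%3≡2 A sf dense)
theorem1p5 p pr p%3≡2 (suc n) A sf dense = Assembly.dense⇒normal p pr p%3≡2 A sf dense
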